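{- For any $\varepsilon>0$ and any $0<\alpha\leq 1-\varepsilon$, the problem $\mathsf{MCSP}[n^{\alpha}]$ on inputs of length $n$ does not have comparator circuits with $n^{1+\alpha/2-\varepsilon}$ gates (for all sufficiently large $n$).
   Context: $\mathsf{MCSP}[n^{\alpha}]$ is the problem: given an $n$-bit string (with $n$ a power of two) viewed as the truth table of a Boolean function on $\log n$ variables, decide whether this function can be computed by some general Boolean circuit of size at most $n^{\alpha}$. A comparator circuit on $n$ variables consists of a set of wires, each labelled by an input literal ($x_i$ or $\neg x_i$), a sequence of gates, each an ordered pair of distinct wires $(w_i,w_j)$, and a designated output wire. On input $a\in\{0,1\}^n$, wires are initialised with the values of their literals and each gate $(w_i,w_j)$ in order replaces the current values $(u,v)$ by $(u\wedge v,u\vee v)$; the final value of the output wire is the output. The size is the number of gates.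
   Formalization: The parameters ε and α are taken to be rational numbers rather than arbitrary real numbers; the bounds n^α and n^{1+α/2-ε} are otherwise interpreted exactly. -}

module Defs where

open import Data.Bool using (Bool; true; false; _∧_; _∨_; not; if_then_else_)
open import Data.Nat using (ℕ; zero; suc; _+_; _*_; _^_; _≤_)
open import Data.Integer using (ℤ; +_; -[1+_])
open import Data.Rational using (ℚ)
open import Data.Fin using (Fin; zero; suc; _↑ˡ_; _↑ʳ_)
open import Data.Vec using (Vec; []; _∷_; lookup; _[_]≔_)
open import Data.List using (List; []; _∷_; length)
open import Data.Product using (_×_; _,_; Σ; ∃-syntax)
open import Relation.Binary.PropositionalEquality using (_≡_; _≢_)

-- Rational powers: "x ≤ n ^ r" for a rational exponent r = p / d,
-- stated without reals as  x ^ d ≤ n ^ p  (p ≥ 0), resp.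
-- x ^ d * n ^ |p| ≤ 1  (p < 0).  For natural x, n this is exactly the
-- real inequality x ≤ n^r.

AtMostPowℤ : ℕ → ℕ → ℤ → ℕ → Set
AtMostPowℤ x n (+ p)     d = x ^ d ≤ n ^ p
AtMostPowℤ x n -[1+ p ]  d = x ^ d * n ^ suc p ≤ 1

_≤_^^_ : ℕ → ℕ → ℚ → Set
x ≤ n ^^ r = AtMostPowℤ x n (ℚ.numerator r) (suc (ℚ.denominator-1 r))

-- General Boolean circuits: fan-in two gates, each computing an
-- arbitrary binary Boolean function (basis B₂).  A circuit with k gates
-- on m inputs has k + m nodes; node indices are Fin (k + m), where the
-- most recently added gate has index zero and the inputs are the last m.
-- The size is the number of gates k.

data Circuit (m : ℕ) : ℕ → Set where
  inputs : Circuit m 0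
  gate   : ∀ {k} → Circuit m k → (Bool → Bool → Bool)
         → Fin (k + m) → Fin (k + m) → Circuit m (suc k)

evalNodes : ∀ {m k} → Circuit m k → Vec Bool m → Vec Bool (k + m)
evalNodes inputs       x = x
evalNodes (gate c f i j) x =
  let v = evalNodes c x in f (lookup v i) (lookup v j) ∷ v

CircuitComputes : ∀ {m k} → Circuit m k → (Vec Bool m → Bool) → Set
CircuitComputes {m} {k} c g =
  Σ (Fin (k + m)) λ o → ∀ x → lookup (evalNodes c x) o ≡ g x

-- Truth tables.  A string of length 2^m is the truth table of a function
-- on m variables; the assignment (x₁,…,x_m) selects the entry whose
-- binary index has x₁ as most significant bit.

ttIndex : ∀ {m} → Vec Bool m → Fin (2 ^ m)
ttIndex []                = zero
ttIndex {suc m} (false ∷ xs) = ttIndex xs ↑ˡ (2 ^ m + 0)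
ttIndex {suc m} (true  ∷ xs) = (2 ^ m) ↑ʳ (ttIndex xs ↑ˡ 0)

ttFunction : ∀ {m} → (Fin (2 ^ m) → Bool) → Vec Bool m → Bool
ttFunction a x = a (ttIndex x)

MCSP : (m : ℕ) → ℚ → (Fin (2 ^ m) → Bool) → Set
MCSP m α a = ∃[ k ] (k ≤ (2 ^ m) ^^ α × Σ (Circuit m k) λ c → CircuitComputes c (ttFunction a))

-- A literal: variable index and polarity (true = x_i, false = ¬ x_i).
Literal : ℕ → Set
Literal n = Fin n × Bool

CGate : ℕ → Set
CGate w = Σ (Fin w × Fin w) λ { (i , j) → i ≢ j }

record Comparator (n : ℕ) : Set where
  field
    wires  : ℕ
    label  : Fin wires → Literal n
    gates  : List (CGate wires)
    output : Fin wires

open Comparator public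

size : ∀ {n} → Comparator n → ℕ
size C = length (gates C)

litValue : ∀ {n} → (Fin n → Bool) → Literal n → Bool
litValue a (i , true)  = a i
litValue a (i , false) = not (a i)

initWires : ∀ {n w} → (Fin w → Literal n) → (Fin n → Bool) → Vec Bool w
initWires {w = zero}  ℓ a = []
initWires {w = suc w} ℓ a = litValue a (ℓ zero) ∷ initWires (λ i → ℓ (suc i)) a

applyGate : ∀ {w} → Vec Bool w → CGate w → Vec Bool w
applyGate v ((i , j) , _) =
  let u = lookup v i ; t = lookup v j in
  (v [ i ]≔ (u ∧ t)) [ j ]≔ (u ∨ t)

applyGates : ∀ {w} → Vec Bool w → List (CGate w) → Vec Bool w
applyGates v []       = v
applyGates v (g ∷ gs) = applyGates (applyGate v g) gs

evalComparator : ∀ {n} → Comparator n → (Fin n → Bool) → Bool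
evalComparator C a = lookup (applyGates (initWires (label C) a) (gates C)) (output C)

Decides : ∀ {n} → Comparator n → ((Fin n → Bool) → Set) → Set
Decides C L = ∀ a → (evalComparator C a ≡ true → L a) × (L a → evalComparator C a ≡ true)

{-# OPTIONS --safe #-}

-- Cut the n positions of the truth table into blocks of v = n^(small) bits.  On a block carrying k of the
-- wires touched by gates, a comparator circuit has at most 2^(k² polylog k) subfunctions (Gál and Robere): a
-- gate between wires that are comparable as functions of the block only renames wires, and any other gate
-- increases the number of comparable pairs.  With n^(1+α/2-ε) gates most blocks have k ≤ n^(α/2-ε) v, so there
-- are at most 2^S subfunctions with S ≤ n^(α-ε).
--
-- Keep t ≈ n^α / v^(3/4) such blocks alive and put zeros elsewhere.  There are more than n^α live bits (times
-- logarithms), so by counting circuits at least half of the live strings are rejected.  Now replace the live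
-- blocks one at a time by elements of a set H, each chosen so as to minimise the number of accepted
-- completions.  H consists of all sums a₁ ⊕ … ⊕ a_c with a_i from a table of n^(α-ε) blocks; suitable tables
-- exist such that H estimates the density of every subfunction up to an additive error below 1/(2t), since each
-- further table damps the deviation in the supremum norm by a factor n^(-small).  Hence the final string is
-- rejected.  But it is described by the tables and t tuples of indices, so it has circuits of size below n^α.

module Submission where

open import Defs
open import Data.Bool using (Bool; true; false; not; _∧_; _∨_; if_then_else_; _xor_)
open import Data.Bool.Properties using (xor-comm) renaming (_≟_ to _≟ᵇ_)
open import Data.Empty using (⊥; ⊥-elim)
open import Data.Fin using (Fin; zero; suc; _≟_; _↑ˡ_; _↑ʳ_; splitAt; fromℕ<)
open import Data.Fin.Properties using (splitAt-↑ˡ; splitAt-↑ʳ; splitAt⁻¹-↑ˡ; splitAt⁻¹-↑ʳ)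
open import Data.Integer as ℤ using (-[1+_]; +[1+_]; +≤+; +<+) renaming (+_ to posℤ)
import Data.Integer.Properties as ℤₚ
open import Data.List as List using (List; []; _∷_; length; map; _++_; concatMap; cartesianProduct; downFrom; allFin; filter; filterᵇ; take; deduplicate)
open import Data.List.Membership.DecPropositional using (_∈?_)
open import Data.List.Membership.Propositional using (_∈_; _∉_; find)
open import Data.List.Membership.Propositional.Properties
open import Data.List.Properties using (length-map; length-++; length-downFrom; length-tabulate; length-take; length-deduplicate; filter-accept; filter-reject)
open import Data.List.Relation.Binary.Permutation.Propositional using (_↭_; prep; swap)
open import Data.List.Relation.Binary.Permutation.Propositional.Properties using (∈-resp-↭)
open import Data.List.Relation.Unary.All using (All; []; _∷_) renaming (lookup to lookupAll; map to mapAll; all? to allAll?; tabulate to tabulateAll)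
open import Data.List.Relation.Unary.All.Properties using (all-filter) renaming (take⁺ to All-take⁺)
open import Data.List.Relation.Unary.AllPairs using ([]; _∷_)
open import Data.List.Relation.Unary.Any using (Any; here; there; index) renaming (map to mapAny)
open import Data.List.Relation.Unary.Any.Properties using (lookup-index)
open import Data.List.Relation.Unary.Unique.DecPropositional.Properties using (deduplicate-!)
open import Data.List.Relation.Unary.Unique.Propositional using (Unique)
open import Data.List.Relation.Unary.Unique.Propositional.Properties using (filter⁺) renaming (map⁺ to Unique-map⁺; ++⁺ to Unique-++⁺; take⁺ to Unique-take⁺)
open import Data.Maybe using (Maybe; just; nothing)
open import Data.Nat hiding (_≟_)
open import Data.Nat.Coprimality using (Coprime)
open import Data.Nat.DivMod using (_/_; _%_; m/n*n≤m; m≡m%n+[m/n]*n; m%n<n; m*n/n≡m; /-monoˡ-≤)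
open import Data.Nat.Properties hiding (_≟_)
open import Data.Nat.Tactic.RingSolver using (solve-∀)
open import Data.Product using (_×_; _,_; proj₁; proj₂; ∃; ∃-syntax; Σ)
open import Data.Rational as ℚ using (ℚ; mkℚ; 0ℚ; 1ℚ; ½; toℚᵘ)
import Data.Rational.Properties as ℚₚ
open import Data.Rational.Unnormalised as ℚᵘ using (mkℚᵘ; 1ℚᵘ)
import Data.Rational.Unnormalised.Properties as ℚᵘₚ
open import Data.Sum as Sum using (_⊎_; inj₁; inj₂)
open import Data.Unit using (tt)
open import Data.Vec as Vec using (Vec; []; _∷_; lookup; tabulate; head; tail; zipWith; _[_]≔_)
open import Data.Vec.Properties using (lookup∘update; lookup∘update′; tabulate∘lookup; lookup-zipWith; tabulate-cong; lookup-replicate; lookup-++ˡ; lookup-++ʳ; zipWith-comm; ∷-injectiveʳ)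
open import Relation.Binary.PropositionalEquality
open import Relation.Nullary
open import Relation.Nullary.Decidable using (map′; dec-true; dec-false)

-- The exponent α/2 comes from the square in the bound on subfunctions: a block loaded with k wires
-- has about 2^(k²) of them, and k² must stay below n^α by a polynomial factor. The obstacle is
-- accuracy. A single sampled table with error δ needs about S/δ² entries; at δ = 1/(2t), with t
-- close to n^α, its circuit would be far larger than n^α. Summing entries of c tables of moderate
-- accuracy 1/Q multiplies the errors while the circuit sizes only add, so a constant c suffices.
-- The window for t is narrow as well: t blocks must hold more than n^α log n bits, or counting
-- circuits would not force rejection, yet t index tuples must fit into a circuit of size below n^α.
-- Blocks of polynomial length open this window, since a block costs only its indices. Densities are
-- kept as counts with denominators cleared, and rational powers of n are replaced by powers of two
-- whose exponents are multiples of one number l.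

private variable
  A B : Set
  k m n p s t w : ℕ

-- Sums over lists

∑ : List A → (A → ℕ) → ℕ
∑ []       f = 0
∑ (x ∷ xs) f = f x + ∑ xs f

∑-mono-∈ : (xs : List A) {f g : A → ℕ} → (∀ {x} → x ∈ xs → f x ≤ g x) → ∑ xs f ≤ ∑ xs g
∑-mono-∈ []       h = z≤n
∑-mono-∈ (x ∷ xs) h = +-mono-≤ (h (here refl)) (∑-mono-∈ xs (λ p → h (there p)))

∑-mono : (xs : List A) {f g : A → ℕ} → (∀ x → f x ≤ g x) → ∑ xs f ≤ ∑ xs g
∑-mono xs h = ∑-mono-∈ xs (λ {x} _ → h x)

∑-cong : (xs : List A) {f g : A → ℕ} → (∀ x → f x ≡ g x) → ∑ xs f ≡ ∑ xs g
∑-cong []       h = refl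
∑-cong (x ∷ xs) h = cong₂ _+_ (h x) (∑-cong xs h)

∑-+ : (xs : List A) (f g : A → ℕ) → ∑ xs (λ x → f x + g x) ≡ ∑ xs f + ∑ xs g
∑-+ []       f g = refl
∑-+ (x ∷ xs) f g = trans (cong (f x + g x +_) (∑-+ xs f g)) (lem (f x) (g x) _ _)
  where
  lem : ∀ a b c d → a + b + (c + d) ≡ a + c + (b + d)
  lem = solve-∀

∑-*ˡ : (xs : List A) (c : ℕ) (f : A → ℕ) → ∑ xs (λ x → c * f x) ≡ c * ∑ xs f
∑-*ˡ []       c f = sym (*-zeroʳ c)
∑-*ˡ (x ∷ xs) c f = trans (cong (c * f x +_) (∑-*ˡ xs c f)) (sym (*-distribˡ-+ c (f x) _))

∑-const : (xs : List A) (c : ℕ) → ∑ xs (λ _ → c) ≡ length xs * c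
∑-const []       c = refl
∑-const (x ∷ xs) c = cong (c +_) (∑-const xs c)

∑-zero : (xs : List A) → ∑ xs (λ _ → 0) ≡ 0
∑-zero xs = trans (∑-const xs 0) (*-zeroʳ (length xs))

∑-swap : (xs : List A) (ys : List B) (f : A → B → ℕ) →
  ∑ xs (λ x → ∑ ys (f x)) ≡ ∑ ys (λ y → ∑ xs (λ x → f x y))
∑-swap []       ys f = sym (∑-zero ys)
∑-swap (x ∷ xs) ys f = trans (cong (∑ ys (f x) +_) (∑-swap xs ys f)) (sym (∑-+ ys (f x) _))

∑-++ : (xs ys : List A) (f : A → ℕ) → ∑ (xs ++ ys) f ≡ ∑ xs f + ∑ ys f
∑-++ []       ys f = refl
∑-++ (x ∷ xs) ys f = trans (cong (f x +_) (∑-++ xs ys f)) (sym (+-assoc (f x) _ _))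

∑-map : (xs : List A) (h : A → B) (f : B → ℕ) → ∑ (map h xs) f ≡ ∑ xs (λ x → f (h x))
∑-map []       h f = refl
∑-map (x ∷ xs) h f = cong (f (h x) +_) (∑-map xs h f)

term≤∑ : {xs : List A} (f : A → ℕ) {x : A} → x ∈ xs → f x ≤ ∑ xs f
term≤∑ f (here refl) = m≤m+n _ _
term≤∑ f (there p)   = ≤-trans (term≤∑ f p) (m≤n+m _ _)

∃-min : (xs : List A) → 1 ≤ length xs → (g : A → ℕ) → ∃ λ a → a ∈ xs × (∀ {x} → x ∈ xs → g a ≤ g x)
∃-min (x ∷ [])     _ g = x , here refl , λ { (here refl) → ≤-refl }
∃-min (x ∷ y ∷ xs) _ g with ∃-min (y ∷ xs) (s≤s z≤n) g
... | a , a∈ , least with g x ≤? g a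
... | yes gx≤ga = x , here refl , λ { (here refl) → ≤-refl ; (there p) → ≤-trans gx≤ga (least p) }
... | no  gx≰ga = a , there a∈ , λ { (here refl) → <⇒≤ (≰⇒> gx≰ga) ; (there p) → least p }

∃-≤-mean : (xs : List A) → 1 ≤ length xs → (g : A → ℕ) → ∃ λ a → a ∈ xs × length xs * g a ≤ ∑ xs g
∃-≤-mean xs nonempty g with ∃-min xs nonempty g
... | a , a∈ , least = a , a∈ , ≤-trans (≤-reflexive (sym (∑-const xs (g a)))) (∑-mono-∈ xs least)

⟦_⟧ : Bool → ℕ
⟦ false ⟧ = 0
⟦ true  ⟧ = 1

⟦⟧≤1 : ∀ b → ⟦ b ⟧ ≤ 1
⟦⟧≤1 false = z≤n
⟦⟧≤1 true  = ≤-refl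

count : (A → Bool) → List A → ℕ
count f xs = ∑ xs (λ x → ⟦ f x ⟧)

count≤length : (f : A → Bool) (xs : List A) → count f xs ≤ length xs
count≤length f xs = ≤-trans (∑-mono xs (λ x → ⟦⟧≤1 (f x)))
  (≤-reflexive (trans (∑-const xs 1) (*-identityʳ _)))

∏ : List A → (A → ℕ) → ℕ
∏ []       f = 1
∏ (x ∷ xs) f = f x * ∏ xs f

-- The product is hi^count · lo^(length - count); the extra factor lo^count on the left removes the
-- subtraction in the exponent.
∏-two-valued : (xs : List A) (f : A → Bool) (lo hi : ℕ) →
  ∏ xs (λ x → if f x then hi else lo) * lo ^ count f xs ≡ hi ^ count f xs * lo ^ length xs
∏-two-valued []       f lo hi = refl
∏-two-valued (x ∷ xs) f lo hi with f x
... | false = trans (lem lo (∏ xs (λ x → if f x then hi else lo)) _) (trans (cong (lo *_) (∏-two-valued xs f lo hi)) (lem' lo (hi ^ count f xs) _))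
  where
  lem : ∀ a b c → a * b * c ≡ a * (b * c)
  lem = solve-∀
  lem' : ∀ a b c → a * (b * c) ≡ b * (a * c)
  lem' = solve-∀
... | true = trans (lem hi lo (∏ xs (λ x → if f x then hi else lo)) _) (trans (cong (hi * lo *_) (∏-two-valued xs f lo hi)) (lem' hi lo (hi ^ count f xs) _))
  where
  lem : ∀ a b c d → a * c * (b * d) ≡ a * b * (c * d)
  lem = solve-∀
  lem' : ∀ a b c d → a * b * (c * d) ≡ a * c * (b * d)
  lem' = solve-∀

-- Sampling

-- Minimising the potential ∑ᵢ ∏ φᵢ one sample at a time.
greedy-samples : {I : Set} (dom : List A) → 1 ≤ length dom → (fam : List I) (φ : I → A → ℕ) (P : ℕ) →
  (∀ {i} → i ∈ fam → ∑ dom (φ i) ≤ length dom * P) → ∀ r →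
  ∃ λ as → length as ≡ r × ∑ fam (λ i → ∏ as (φ i)) ≤ length fam * P ^ r
greedy-samples dom nonempty fam φ P mean zero = [] , refl , ≤-reflexive (∑-const fam 1)
greedy-samples {I = I} dom nonempty fam φ P mean (suc r)
  with greedy-samples dom nonempty fam φ P mean r
... | as , len , bound with ∃-≤-mean dom nonempty (λ a → ∑ fam (λ i → φ i a * ∏ as (φ i)))
... | a , _ , below = a ∷ as , cong suc len , *-cancelˡ-≤ N {{>-nonZero nonempty}} (begin
  N * ∑ fam (λ i → φ i a * ∏ as (φ i))                  ≤⟨ below ⟩
  ∑ dom (λ a → ∑ fam (λ i → φ i a * ∏ as (φ i)))        ≡⟨ ∑-swap dom fam _ ⟩
  ∑ fam (λ i → ∑ dom (λ a → φ i a * ∏ as (φ i)))        ≡⟨ ∑-cong fam (λ i → trans (∑-cong dom (λ a → *-comm (φ i a) _)) (∑-*ˡ dom (∏ as (φ i)) (φ i))) ⟩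
  ∑ fam (λ i → ∏ as (φ i) * ∑ dom (φ i))                ≤⟨ ∑-mono-∈ fam (λ {i} i∈ → *-monoʳ-≤ (∏ as (φ i)) (mean i∈)) ⟩
  ∑ fam (λ i → ∏ as (φ i) * (N * P))                    ≡⟨ trans (∑-cong fam (λ i → *-comm (∏ as (φ i)) _)) (∑-*ˡ fam (N * P) (λ i → ∏ as (φ i))) ⟩
  N * P * ∑ fam (λ i → ∏ as (φ i))                      ≤⟨ *-monoʳ-≤ (N * P) bound ⟩
  N * P * (length fam * P ^ r)                          ≡⟨ lem N P (length fam) (P ^ r) ⟩
  N * (length fam * (P * P ^ r))                        ∎)
  where
  open ≤-Reasoning
  N = length dom
  lem : ∀ n p l x → n * p * (l * x) ≡ n * (l * (p * x))
  lem = solve-∀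

-- Bernoulli's inequality (1 + x/P)^j ≥ 1 + jx/P, multiplied by P^(j+1).
bernoulli⁺ : ∀ P x j → P ^ j * (P + j * x) ≤ P * (P + x) ^ j
bernoulli⁺ P x zero    = ≤-reflexive (lem P)
  where
  lem : ∀ P → 1 * (P + 0) ≡ P * 1
  lem = solve-∀
bernoulli⁺ P x (suc j) = begin
  P * P ^ j * (P + suc j * x)                ≡⟨ lem P (P ^ j) x j ⟩
  P * (P ^ j * (P + j * x)) + x * (P * P ^ j)  ≤⟨ +-mono-≤ (*-monoʳ-≤ P (bernoulli⁺ P x j)) (*-monoʳ-≤ x (*-monoʳ-≤ P (^-monoˡ-≤ j (m≤m+n P x)))) ⟩
  P * (P * (P + x) ^ j) + x * (P * (P + x) ^ j) ≡⟨ lem' P x ((P + x) ^ j) ⟩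
  P * ((P + x) * (P + x) ^ j)                ∎
  where
  open ≤-Reasoning
  lem : ∀ P y x j → P * y * (P + (1 + j) * x) ≡ P * (y * (P + j * x)) + x * (P * y)
  lem = solve-∀
  lem' : ∀ P x y → P * (P * y) + x * (P * y) ≡ P * ((P + x) * y)
  lem' = solve-∀

-- With P = lo + m this is (1 - m/P)^j ≥ 1 - jm/P, multiplied by P^(j+1) and with the negative term
-- moved across.
bernoulli⁻ : ∀ lo m j → (lo + m) ^ j * (lo + m) ≤ (lo + m) * lo ^ j + j * m * (lo + m) ^ j
bernoulli⁻ lo m zero    = ≤-reflexive (lem (lo + m))
  where
  lem : ∀ P → 1 * P ≡ P * 1 + 0
  lem = solve-∀
bernoulli⁻ lo m (suc j) = begin
  P * P ^ j * P                                      ≡⟨ lem P (P ^ j) ⟩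
  P * (P ^ j * P)                                    ≤⟨ *-monoʳ-≤ P (bernoulli⁻ lo m j) ⟩
  P * (P * lo ^ j + j * m * P ^ j)                   ≡⟨ lem' lo m (lo ^ j) j (P ^ j) ⟩
  P * (lo * lo ^ j) + j * m * (P * P ^ j) + m * (P * lo ^ j) ≤⟨ +-monoʳ-≤ (P * (lo * lo ^ j) + j * m * (P * P ^ j)) (*-monoʳ-≤ m (*-monoʳ-≤ P (^-monoˡ-≤ j (m≤m+n lo m)))) ⟩
  P * (lo * lo ^ j) + j * m * (P * P ^ j) + m * (P * P ^ j)  ≡⟨ lem'' (P * (lo * lo ^ j)) j m (P * P ^ j) ⟩
  P * (lo * lo ^ j) + suc j * m * (P * P ^ j)        ∎
  where
  open ≤-Reasoning
  P = lo + m
  lem : ∀ P y → P * y * P ≡ P * (y * P)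
  lem = solve-∀
  lem' : ∀ lo m y j z → (lo + m) * ((lo + m) * y + j * m * z) ≡ (lo + m) * (lo * y) + j * m * ((lo + m) * z) + m * ((lo + m) * y)
  lem' = solve-∀
  lem'' : ∀ u j m w → u + j * m * w + m * w ≡ u + (1 + j) * m * w
  lem'' = solve-∀

-- The common denominator of the weights: 1/(2Q²) is Q units of 1/`scale Q`, and 1/(2Q²) times a
-- density m/Q is m such units.
scale : ℕ → ℕ
scale Q = 2 * (Q * Q * Q)

-- With λ = 1/(2Q²) and d = m/Q this is (1 + λ(1-d))^(m+1) (1 - λd)^(Q-m-1) ≥ 1 + 1/(4Q²), with all
-- denominators cleared.
potential-gain : ∀ m x lo → let Q = m + suc x in lo + m ≡ scale Q →
  (1 + 4 * (Q * Q)) * scale Q ^ Q ≤ 4 * (Q * Q) * ((lo + Q) ^ suc m * lo ^ x)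
potential-gain m x lo eq = *-cancelˡ-≤ (P * P) {{P²≢0}} (begin
  P * P * ((1 + z) * P ^ Q)                        ≡⟨ cong (λ t → P * P * ((1 + z) * t)) P^Q ⟩
  P * P * ((1 + z) * (P ^ suc m * P ^ x))          ≡⟨ s1 (P * P) z (P ^ suc m * P ^ x) ⟩
  (1 + z) * (P * P) * (P ^ suc m * P ^ x)          ≤⟨ *-monoˡ-≤ (P ^ suc m * P ^ x) quadratic ⟩
  z * ((P + suc m * suc x) * D) * (P ^ suc m * P ^ x)   ≡⟨ s2 z (P + suc m * suc x) D (P ^ suc m) (P ^ x) ⟩
  z * ((P ^ suc m * (P + suc m * suc x)) * (P ^ x * D)) ≤⟨ *-monoʳ-≤ z (*-mono-≤ upper lower) ⟩
  z * (P * (lo + Q) ^ suc m * (P * lo ^ x))        ≡⟨ s3 z P ((lo + Q) ^ suc m) (lo ^ x) ⟩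
  P * P * (z * ((lo + Q) ^ suc m * lo ^ x))        ∎)
  where
  open ≤-Reasoning
  Q = m + suc x
  z = 4 * (Q * Q)
  P = scale Q
  instance
    Q≢0 : NonZero Q
    Q≢0 = >-nonZero (≤-trans (s≤s z≤n) (m≤n+m (suc x) m))
    Q³≢0 : NonZero (Q * Q * Q)
    Q³≢0 = m*n≢0 (Q * Q) Q {{m*n≢0 Q Q}}
    P≢0 : NonZero P
    P≢0 = m*n≢0 2 (Q * Q * Q)
  P²≢0 : NonZero (P * P)
  P²≢0 = m*n≢0 P P
  s1 : ∀ p z w → p * ((1 + z) * w) ≡ (1 + z) * p * w
  s1 = solve-∀
  s2 : ∀ z u d p q → z * (u * d) * (p * q) ≡ z * ((p * u) * (q * d))
  s2 = solve-∀
  s3 : ∀ z p u v → z * (p * u * (p * v)) ≡ p * p * (z * (u * v))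
  s3 = solve-∀
  P^Q : P ^ Q ≡ P ^ suc m * P ^ x
  P^Q = trans (cong (P ^_) (+-suc m x)) (^-distribˡ-+-* P (suc m) x)
  x<Q : suc x ≤ Q
  x<Q = m≤n+m (suc x) m
  m<Q : suc m ≤ Q
  m<Q = ≤-trans (≤-reflexive (+-comm 1 m)) (+-monoʳ-≤ m (s≤s z≤n))
  B≤Q² : x * m ≤ Q * Q
  B≤Q² = *-mono-≤ (<⇒≤ x<Q) (<⇒≤ m<Q)
  B≤P : x * m ≤ P
  B≤P = begin
    x * m           ≤⟨ B≤Q² ⟩
    Q * Q           ≤⟨ m≤m*n (Q * Q) Q ⟩
    Q * Q * Q       ≤⟨ m≤m+n _ _ ⟩
    P               ∎
  D = P ∸ x * m
  B+D : x * m + D ≡ P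
  B+D = m+[n∸m]≡n B≤P
  upper : P ^ suc m * (P + suc m * suc x) ≤ P * (lo + Q) ^ suc m
  upper = subst (λ h → P ^ suc m * (P + suc m * suc x) ≤ P * h ^ suc m)
    (trans (cong (_+ suc x) (sym eq)) (+-assoc lo m (suc x))) (bernoulli⁺ P (suc x) (suc m))
  lower : P ^ x * D ≤ P * lo ^ x
  lower = +-cancelʳ-≤ (x * m * P ^ x) _ _ (begin
    P ^ x * D + x * m * P ^ x     ≡⟨ s4 (P ^ x) D (x * m) ⟩
    P ^ x * (x * m + D)           ≡⟨ cong (P ^ x *_) B+D ⟩
    P ^ x * P                     ≤⟨ subst (λ p → p ^ x * p ≤ p * lo ^ x + x * m * p ^ x) eq (bernoulli⁻ lo m x) ⟩
    P * lo ^ x + x * m * P ^ x    ∎)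
    where
    s4 : ∀ p d b → p * d + b * p ≡ p * (b + d)
    s4 = solve-∀
  -- To first order the gain is (m+1)(x+1) - xm = Q, that is Q/P = 1/(2Q²); the product of the two
  -- corrections costs at most Q⁴/P² = 1/(4Q²), so half of the gain survives.
  quadratic : (1 + z) * (P * P) ≤ z * ((P + suc m * suc x) * D)
  quadratic = +-cancelʳ-≤ (z * (Q * Q * (Q * Q))) _ _ (begin
    (1 + z) * (P * P) + z * (Q * Q * (Q * Q))                      ≡⟨ s5 Q ⟩
    z * (P * P + Q * P)                                            ≡⟨ cong (z *_) (trans (cong (λ p → p * p + Q * p) (sym B+D)) (trans (s6 m x D) (cong (λ p → (p + suc m * suc x) * D + suc m * suc x * (x * m)) B+D))) ⟩
    z * ((P + suc m * suc x) * D + suc m * suc x * (x * m))        ≤⟨ *-monoʳ-≤ z (+-monoʳ-≤ ((P + suc m * suc x) * D) (*-mono-≤ (*-mono-≤ m<Q x<Q) B≤Q²)) ⟩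
    z * ((P + suc m * suc x) * D + Q * Q * (Q * Q))                ≡⟨ *-distribˡ-+ z ((P + suc m * suc x) * D) (Q * Q * (Q * Q)) ⟩
    z * ((P + suc m * suc x) * D) + z * (Q * Q * (Q * Q))          ∎)
    where
    s5 : ∀ Q → (1 + 4 * (Q * Q)) * (2 * (Q * Q * Q) * (2 * (Q * Q * Q))) + 4 * (Q * Q) * (Q * Q * (Q * Q))
             ≡ 4 * (Q * Q) * (2 * (Q * Q * Q) * (2 * (Q * Q * Q)) + Q * (2 * (Q * Q * Q)))
    s5 = solve-∀
    s6 : ∀ m x D → (x * m + D) * (x * m + D) + (m + (1 + x)) * (x * m + D)
                 ≡ (x * m + D + (1 + m) * (1 + x)) * D + (1 + m) * (1 + x) * (x * m)
    s6 = solve-∀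

^-distribʳ-* : ∀ a b n → (a * b) ^ n ≡ a ^ n * b ^ n
^-distribʳ-* a b zero    = refl
^-distribʳ-* a b (suc n) = trans (cong (a * b *_) (^-distribʳ-* a b n)) (lem a b (a ^ n) (b ^ n))
  where
  lem : ∀ a b x y → a * b * (x * y) ≡ a * x * (b * y)
  lem = solve-∀

-- (1 + 1/z)^z ≥ 2 by Bernoulli, so r ≥ zS factors 1 + 1/z multiply to at least 2^S.
2^*^≤suc^ : ∀ z S r → z * S ≤ r → 1 ≤ z → 2 ^ S * z ^ r ≤ suc z ^ r
2^*^≤suc^ z S r zS≤r 1≤z = begin
  2 ^ S * z ^ r                               ≡⟨ cong (λ t → 2 ^ S * z ^ t) (sym (m+[n∸m]≡n zS≤r)) ⟩
  2 ^ S * z ^ (z * S + rest)                  ≡⟨ cong (2 ^ S *_) (trans (^-distribˡ-+-* z (z * S) rest) (cong (_* z ^ rest) (sym (^-*-assoc z z S)))) ⟩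
  2 ^ S * ((z ^ z) ^ S * z ^ rest)            ≡⟨ sym (*-assoc (2 ^ S) ((z ^ z) ^ S) _) ⟩
  2 ^ S * (z ^ z) ^ S * z ^ rest              ≡⟨ cong (_* z ^ rest) (sym (^-distribʳ-* 2 (z ^ z) S)) ⟩
  (2 * z ^ z) ^ S * z ^ rest                  ≤⟨ *-mono-≤ (^-monoˡ-≤ S double) (^-monoˡ-≤ rest (n≤1+n z)) ⟩
  (suc z ^ z) ^ S * suc z ^ rest              ≡⟨ cong (_* suc z ^ rest) (^-*-assoc (suc z) z S) ⟩
  suc z ^ (z * S) * suc z ^ rest              ≡⟨ sym (^-distribˡ-+-* (suc z) (z * S) rest) ⟩
  suc z ^ (z * S + rest)                      ≡⟨ cong (suc z ^_) (m+[n∸m]≡n zS≤r) ⟩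
  suc z ^ r                                   ∎
  where
  open ≤-Reasoning
  rest = r ∸ z * S
  double : 2 * z ^ z ≤ suc z ^ z
  double = *-cancelˡ-≤ z {{>-nonZero 1≤z}} (begin
    z * (2 * z ^ z)          ≡⟨ lem z (z ^ z) ⟩
    z ^ z * (z + z * 1)      ≤⟨ bernoulli⁺ z 1 z ⟩
    z * (z + 1) ^ z          ≡⟨ cong (λ t → z * t ^ z) (+-comm z 1) ⟩
    z * suc z ^ z            ∎)
    where
    lem : ∀ z y → z * (2 * y) ≡ y * (z + z * 1)
    lem = solve-∀

-- Let μ/Q be the density of `f i` rounded up. If more than (μ+1)r of the Qr samples satisfied
-- `f i`, the product for i alone would reach (1 + 1/(4Q²))^r ≥ 2^S times its expected size, more
-- than the sum over the whole family allows. So the density on the sample exceeds the true one by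
-- at most 2/Q: one 1/Q for the rounding, one for the excess.
sampling : {A I : Set} (dom : List A) → 1 ≤ length dom → (fam : List I) (f : I → A → Bool) (Q r S : ℕ) →
  1 ≤ Q → length fam < 2 ^ S → 4 * (Q * Q) * S ≤ r →
  ∃ λ as → length as ≡ Q * r ×
    (∀ {i} → i ∈ fam → length dom * count (f i) as ≤ r * (Q * count (f i) dom + 2 * length dom))
sampling {A} {I} dom nonempty fam f Q r S 1≤Q small r-large =
  as , len , λ {i} i∈ → ≤-trans (*-monoʳ-≤ N (few i∈)) (begin
    N * (suc (μ i) * r)                ≡⟨ lem₁ N (μ i) r ⟩
    r * (μ i * N + N)                  ≤⟨ *-monoʳ-≤ r (+-monoˡ-≤ N (μ-upper i)) ⟩
    r * (Q * e i + N + N)              ≡⟨ cong (r *_) (lem₂ (Q * e i) N) ⟩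
    r * (Q * e i + 2 * N)              ∎)
  where
  open ≤-Reasoning
  N = length dom
  instance
    N≢0 : NonZero N
    N≢0 = >-nonZero nonempty
    Q≢0 : NonZero Q
    Q≢0 = >-nonZero 1≤Q
    Q²≢0 : NonZero (Q * Q)
    Q²≢0 = m*n≢0 Q Q
  P = scale Q
  e : I → ℕ
  e i = count (f i) dom
  -- Rounding up keeps the mean weight at most P, and a multiple of 1/Q keeps the weights natural
  -- numbers.
  μ : I → ℕ
  μ i = suc (Q * e i / N)
  lem₁ : ∀ n μ r → n * ((1 + μ) * r) ≡ r * (μ * n + n)
  lem₁ = solve-∀
  lem₂ : ∀ q n → q + n + n ≡ q + 2 * n
  lem₂ = solve-∀
  μ-upper : ∀ i → μ i * N ≤ Q * e i + N
  μ-upper i = ≤-trans (≤-reflexive (+-comm N _)) (+-monoˡ-≤ N (m/n*n≤m (Q * e i) N))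
  μ-lower : ∀ i → Q * e i ≤ μ i * N
  μ-lower i = begin
    Q * e i                                   ≡⟨ m≡m%n+[m/n]*n (Q * e i) N ⟩
    Q * e i % N + Q * e i / N * N             ≤⟨ +-monoˡ-≤ _ (<⇒≤ (m%n<n (Q * e i) N)) ⟩
    μ i * N                                   ∎
  Q≤P : Q + Q ≤ P
  Q≤P = begin
    Q + Q               ≡⟨ cong (Q +_) (sym (+-identityʳ Q)) ⟩
    2 * Q               ≤⟨ *-monoʳ-≤ 2 (m≤n*m Q (Q * Q)) ⟩
    2 * (Q * Q * Q)     ∎
  μ≤P : ∀ i → μ i ≤ P
  μ≤P i = *-cancelʳ-≤ (μ i) P N (begin
    μ i * N           ≤⟨ μ-upper i ⟩
    Q * e i + N       ≤⟨ +-mono-≤ (*-monoʳ-≤ Q (count≤length (f i) dom)) (m≤n*m N Q) ⟩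
    Q * N + Q * N     ≡⟨ sym (*-distribʳ-+ N Q Q) ⟩
    (Q + Q) * N       ≤⟨ *-monoˡ-≤ N Q≤P ⟩
    P * N             ∎)
  lo : I → ℕ
  lo i = P ∸ μ i
  φ : I → A → ℕ
  φ i a = if f i a then lo i + Q else lo i
  φ-linear : ∀ i a → φ i a ≡ lo i + Q * ⟦ f i a ⟧
  φ-linear i a with f i a
  ... | false = sym (trans (cong (lo i +_) (*-zeroʳ Q)) (+-identityʳ _))
  ... | true  = cong (lo i +_) (sym (*-identityʳ Q))
  mean : ∀ i → ∑ dom (φ i) ≤ N * P
  mean i = begin
    ∑ dom (φ i)                                    ≡⟨ ∑-cong dom (φ-linear i) ⟩
    ∑ dom (λ a → lo i + Q * ⟦ f i a ⟧)             ≡⟨ ∑-+ dom (λ _ → lo i) _ ⟩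
    ∑ dom (λ _ → lo i) + ∑ dom (λ a → Q * ⟦ f i a ⟧) ≡⟨ cong₂ _+_ (∑-const dom (lo i)) (∑-*ˡ dom Q (λ a → ⟦ f i a ⟧)) ⟩
    N * lo i + Q * e i                             ≤⟨ +-monoʳ-≤ (N * lo i) (μ-lower i) ⟩
    N * lo i + μ i * N                             ≡⟨ cong (N * lo i +_) (*-comm (μ i) N) ⟩
    N * lo i + N * μ i                             ≡⟨ sym (*-distribˡ-+ N (lo i) (μ i)) ⟩
    N * (lo i + μ i)                               ≡⟨ cong (N *_) (m∸n+n≡m (μ≤P i)) ⟩
    N * P                                          ∎
  samples = greedy-samples dom nonempty fam φ P (λ {i} _ → mean i) (Q * r)
  as = proj₁ samples
  len = proj₁ (proj₂ samples)
  few : ∀ {i} → i ∈ fam → count (f i) as ≤ suc (μ i) * r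
  few {i} i∈ = ≮⇒≥ λ many → absurd many
    where
    z = 4 * (Q * Q)
    c = count (f i) as
    hi = lo i + Q
    absurd : suc (μ i) * r < c → ⊥
    absurd many = <-irrefl refl (begin-strict
      suc z ^ r * P ^ (Q * r)              ≡⟨ cong (suc z ^ r *_) (sym (^-*-assoc P Q r)) ⟩
      suc z ^ r * (P ^ Q) ^ r              ≡⟨ sym (^-distribʳ-* (suc z) (P ^ Q) r) ⟩
      (suc z * P ^ Q) ^ r                  ≤⟨ ^-monoˡ-≤ r gain ⟩
      (z * (hi ^ suc (μ i) * lo i ^ x)) ^ r ≡⟨ ^-distribʳ-* z _ r ⟩
      z ^ r * (hi ^ suc (μ i) * lo i ^ x) ^ r ≤⟨ *-monoʳ-≤ (z ^ r) product ⟩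
      z ^ r * ∏ as (φ i)                   ≤⟨ *-monoʳ-≤ (z ^ r) (term≤∑ (λ i → ∏ as (φ i)) i∈) ⟩
      z ^ r * ∑ fam (λ i → ∏ as (φ i))     ≤⟨ *-monoʳ-≤ (z ^ r) (proj₂ (proj₂ samples)) ⟩
      z ^ r * (length fam * P ^ (Q * r))   <⟨ *-monoʳ-< (z ^ r) {{m^n≢0 z r {{z≢0}}}} (*-monoˡ-< (P ^ (Q * r)) {{m^n≢0 P (Q * r) {{P≢0}}}} small) ⟩
      z ^ r * (2 ^ S * P ^ (Q * r))        ≡⟨ lem₃ (z ^ r) (2 ^ S) (P ^ (Q * r)) ⟩
      2 ^ S * z ^ r * P ^ (Q * r)          ≤⟨ *-monoˡ-≤ (P ^ (Q * r)) (2^*^≤suc^ z S r r-large (>-nonZero⁻¹ z {{z≢0}})) ⟩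
      suc z ^ r * P ^ (Q * r)              ∎)
      where
      z≢0 : NonZero z
      z≢0 = m*n≢0 4 (Q * Q)
      P≢0 : NonZero P
      P≢0 = >-nonZero (≤-trans 1≤Q (≤-trans (m≤m+n Q Q) Q≤P))
      lem₃ : ∀ a b c → a * (b * c) ≡ b * a * c
      lem₃ = solve-∀
      -- There are only Qr samples, so an excess over (μ+1)r forces μ+1 < Q, and Q splits into μ+1
      -- and x.
      μ<Q : suc (μ i) < Q
      μ<Q = *-cancelʳ-< _ _ _ (<-≤-trans many (≤-trans (count≤length (f i) as) (≤-reflexive len)))
      x = Q ∸ suc (μ i)
      Q-split : suc (μ i) + x ≡ Q
      Q-split = m+[n∸m]≡n (<⇒≤ μ<Q)
      gain : suc z * P ^ Q ≤ z * (hi ^ suc (μ i) * lo i ^ x)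
      gain = subst (λ q → lo i + μ i ≡ scale q → suc (4 * (q * q)) * scale q ^ q ≤ 4 * (q * q) * ((lo i + q) ^ suc (μ i) * lo i ^ x))
        (trans (+-suc (μ i) x) Q-split) (potential-gain (μ i) x (lo i)) (m∸n+n≡m (μ≤P i))
      lo≢0 : NonZero (lo i)
      lo≢0 = >-nonZero (m<n⇒0<n∸m (<-≤-trans (<-trans (n<1+n (μ i)) μ<Q) (≤-trans (m≤m+n Q Q) Q≤P)))
      y = c ∸ suc (μ i) * r
      c-split : suc (μ i) * r + y ≡ c
      c-split = m+[n∸m]≡n (<⇒≤ many)
      lem₄ : ∀ a b c d → a * b * (c * d) ≡ a * d * (c * b)
      lem₄ = solve-∀
      -- Satisfying samples beyond (μ+1)r only enlarge the product, because hi ≥ lo.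
      product : (hi ^ suc (μ i) * lo i ^ x) ^ r ≤ ∏ as (φ i)
      product = *-cancelʳ-≤ _ _ (lo i ^ c) {{m^n≢0 (lo i) c {{lo≢0}}}} (begin
        (hi ^ suc (μ i) * lo i ^ x) ^ r * lo i ^ c
          ≡⟨ cong₂ _*_ (trans (^-distribʳ-* (hi ^ suc (μ i)) (lo i ^ x) r) (cong₂ _*_ (^-*-assoc hi (suc (μ i)) r) (^-*-assoc (lo i) x r)))
                       (trans (cong (lo i ^_) (sym c-split)) (^-distribˡ-+-* (lo i) (suc (μ i) * r) y)) ⟩
        hi ^ (suc (μ i) * r) * lo i ^ (x * r) * (lo i ^ (suc (μ i) * r) * lo i ^ y)
          ≡⟨ lem₄ (hi ^ (suc (μ i) * r)) (lo i ^ (x * r)) (lo i ^ (suc (μ i) * r)) (lo i ^ y) ⟩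
        hi ^ (suc (μ i) * r) * lo i ^ y * (lo i ^ (suc (μ i) * r) * lo i ^ (x * r))
          ≤⟨ *-monoˡ-≤ _ (*-monoʳ-≤ (hi ^ (suc (μ i) * r)) (^-monoˡ-≤ y (m≤m+n (lo i) Q))) ⟩
        hi ^ (suc (μ i) * r) * hi ^ y * (lo i ^ (suc (μ i) * r) * lo i ^ (x * r))
          ≡⟨ cong₂ _*_ (trans (sym (^-distribˡ-+-* hi (suc (μ i) * r) y)) (cong (hi ^_) c-split))
                       (trans (sym (^-distribˡ-+-* (lo i) (suc (μ i) * r) (x * r))) (cong (lo i ^_) (trans (sym (*-distribʳ-+ r (suc (μ i)) x)) (trans (cong (_* r) Q-split) (sym len))))) ⟩
        hi ^ c * lo i ^ length as
          ≡⟨ sym (∏-two-valued as (f i) (lo i) hi) ⟩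
        ∏ as (φ i) * lo i ^ c ∎)

-- Sums of entries from several tables

∑-concatMap : (xs : List A) (h : A → List B) (f : B → ℕ) → ∑ (concatMap h xs) f ≡ ∑ xs (λ x → ∑ (h x) f)
∑-concatMap []       h f = refl
∑-concatMap (x ∷ xs) h f = trans (∑-++ (h x) (concatMap h xs) f) (cong (∑ (h x) f +_) (∑-concatMap xs h f))

length≡∑ : (xs : List A) → length xs ≡ ∑ xs (λ _ → 1)
length≡∑ xs = sym (trans (∑-const xs 1) (*-identityʳ (length xs)))

count-not : (f g : A → Bool) → (∀ x → g x ≡ not (f x)) → (xs : List A) → count g xs + count f xs ≡ length xs
count-not f g h []       = refl
count-not f g h (x ∷ xs) = trans (lem ⟦ g x ⟧ (count g xs) ⟦ f x ⟧ (count f xs)) (cong₂ _+_ one (count-not f g h xs))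
  where
  lem : ∀ a b c d → a + b + (c + d) ≡ a + c + (b + d)
  lem = solve-∀
  one : ⟦ g x ⟧ + ⟦ f x ⟧ ≡ 1
  one rewrite h x with f x
  ... | false = refl
  ... | true  = refl

<ᵇ-true : ∀ {m n} → m < n → (m <ᵇ n) ≡ true
<ᵇ-true {m} {n} m<n with m <ᵇ n | <⇒<ᵇ m<n
... | true | _ = refl

<ᵇ-false : ∀ {m n} → n ≤ m → (m <ᵇ n) ≡ false
<ᵇ-false {m} {n} n≤m with m <ᵇ n | <ᵇ⇒< m n
... | false | _ = refl
... | true  | h = ⊥-elim (<⇒≱ (h tt) n≤m)

-- Layer-cake decomposition: a bounded natural number is a sum of Boolean thresholds, which makes
-- `sampling`, stated for Boolean functions, applicable to counts.
∑-thresholds : ∀ R u → ∑ (downFrom R) (λ k → ⟦ k <ᵇ u ⟧) ≡ R ⊓ u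
∑-thresholds zero    u = refl
∑-thresholds (suc n) u with n <? u
... | yes n<u rewrite <ᵇ-true n<u | ∑-thresholds n u | m≤n⇒m⊓n≡m n<u | m≤n⇒m⊓n≡m (<⇒≤ n<u) = refl
... | no  n≮u rewrite <ᵇ-false (≮⇒≥ n≮u) | ∑-thresholds n u | m≥n⇒m⊓n≡n (≮⇒≥ n≮u) | m≥n⇒m⊓n≡n (m≤n⇒m≤1+n (≮⇒≥ n≮u)) = refl

-- A list with repetitions: a `count` over it divided by its length is the probability for
-- independent uniform choices from the tables. The offset s accumulates the summands chosen so far.
sums : (A → A → A) → List (List A) → A → List A
sums _⊕_ []       s = s ∷ []
sums _⊕_ (T ∷ Ts) s = concatMap (λ a → sums _⊕_ Ts (s ⊕ a)) T

length-sums : (_⊕_ : A → A → A) (n : ℕ) (Ts : List (List A)) → All (λ T → length T ≡ n) Ts →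
  ∀ s → length (sums _⊕_ Ts s) ≡ n ^ length Ts
length-sums _⊕_ n []       []         s = refl
length-sums _⊕_ n (T ∷ Ts) (eq ∷ eqs) s = begin
  length (concatMap (λ a → sums _⊕_ Ts (s ⊕ a)) T)      ≡⟨ length≡∑ (concatMap (λ a → sums _⊕_ Ts (s ⊕ a)) T) ⟩
  ∑ (concatMap (λ a → sums _⊕_ Ts (s ⊕ a)) T) (λ _ → 1) ≡⟨ ∑-concatMap T _ _ ⟩
  ∑ T (λ a → ∑ (sums _⊕_ Ts (s ⊕ a)) (λ _ → 1))         ≡⟨ ∑-cong T (λ a → trans (sym (length≡∑ (sums _⊕_ Ts (s ⊕ a)))) (length-sums _⊕_ n Ts eqs (s ⊕ a))) ⟩
  ∑ T (λ _ → n ^ length Ts)                             ≡⟨ ∑-const T _ ⟩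
  length T * n ^ length Ts                              ≡⟨ cong (_* n ^ length Ts) eq ⟩
  n * n ^ length Ts                                     ∎
  where open ≡-Reasoning

length-cartesianProduct : (xs : List A) (ys : List B) → length (cartesianProduct xs ys) ≡ length xs * length ys
length-cartesianProduct []       ys = refl
length-cartesianProduct (x ∷ xs) ys = trans (length-++ (map (x ,_) ys))
  (cong₂ _+_ (length-map (x ,_) ys) (length-cartesianProduct xs ys))

-- Closure under complement turns one-sided estimates into two-sided ones; the group structure
-- enters only through translation invariance of sums over `dom`. The factors beside `length fam` in
-- `small` count the offsets and thresholds to which each member gives rise.
module Sampler {A I : Set} (dom : List A) (complete : ∀ x → x ∈ dom) (nonempty : 1 ≤ length dom)
  (_⊕_ : A → A → A)
  (shiftˡ : ∀ s (g : A → ℕ) → ∑ dom (λ a → g (s ⊕ a)) ≡ ∑ dom g)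
  (shiftʳ : ∀ s (g : A → ℕ) → ∑ dom (λ a → g (a ⊕ s)) ≡ ∑ dom g)
  (fam : List I) (f : I → A → Bool)
  (compl : I → I) (compl-∈ : ∀ {i} → i ∈ fam → compl i ∈ fam) (f-compl : ∀ i x → f (compl i) x ≡ not (f i x))
  (Q r S c : ℕ) (1≤Q : 1 ≤ Q) (small : length fam * (length dom * (2 * (4 * r) ^ c)) < 2 ^ S)
  (1≤r : 1 ≤ r) (r-large : 4 * (Q * Q) * S ≤ r)
  where

  open ≤-Reasoning

  private
    N : ℕ
    N = length dom

    instance
      N≢0 : NonZero N
      N≢0 = >-nonZero nonempty

  -- Divided by N(Qr)^l: the density along the sums exceeds the true density by at most (4/Q)^l. All
  -- offsets are covered at once because the next table evaluates these sums at shifted offsets.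
  Approximates : List (List A) → ℕ → Set
  Approximates Ts l = ∀ {i} → i ∈ fam → ∀ s →
    N * count (f i) (sums _⊕_ Ts s) ≤ (Q * r) ^ l * count (f i) dom + N * (4 * r) ^ l

  -- Averaging over all offsets makes s ⊕ a uniform for each a, so the estimate is exact on average;
  -- only its fluctuation with s remains to be damped.
  ∑-count-sums : (g : A → Bool) (Ts : List (List A)) → All (λ T → length T ≡ Q * r) Ts →
    ∑ dom (λ s → count g (sums _⊕_ Ts s)) ≡ (Q * r) ^ length Ts * count g dom
  ∑-count-sums g []       []         = trans (∑-cong dom (λ s → +-identityʳ _)) (sym (*-identityˡ _))
  ∑-count-sums g (T ∷ Ts) (eq ∷ eqs) = begin-equality
    ∑ dom (λ s → count g (concatMap (λ a → sums _⊕_ Ts (s ⊕ a)) T)) ≡⟨ ∑-cong dom (λ s → ∑-concatMap T _ _) ⟩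
    ∑ dom (λ s → ∑ T (λ a → count g (sums _⊕_ Ts (s ⊕ a))))         ≡⟨ ∑-swap dom T _ ⟩
    ∑ T (λ a → ∑ dom (λ s → count g (sums _⊕_ Ts (s ⊕ a))))         ≡⟨ ∑-cong T (λ a → trans (shiftʳ a (λ s → count g (sums _⊕_ Ts s))) (∑-count-sums g Ts eqs)) ⟩
    ∑ T (λ _ → (Q * r) ^ length Ts * count g dom)                   ≡⟨ ∑-const T _ ⟩
    length T * ((Q * r) ^ length Ts * count g dom)                  ≡⟨ cong (_* _) eq ⟩
    Q * r * ((Q * r) ^ length Ts * count g dom)                     ≡⟨ sym (*-assoc (Q * r) _ _) ⟩
    (Q * r) ^ suc (length Ts) * count g dom                         ∎

  -- Averaging over one more table multiplies the oscillation of s ↦ count (f i) (sums Ts s), relative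
  -- to its maximum, by O(1/Q): the sampling lemma is applied to all its threshold functions.
  add-table : ∀ l → l < c → (Ts : List (List A)) → length Ts ≡ l → All (λ T → length T ≡ Q * r) Ts →
    Approximates Ts l → ∃ λ T → length T ≡ Q * r × Approximates (T ∷ Ts) (suc l)
  add-table l l<c Ts refl lens approx = T , T-len , λ {i} i∈ s → result i∈ s
    where
    L = (Q * r) ^ l
    E = (4 * r) ^ l
    R = 2 * E
    e : I → ℕ
    e i = count (f i) dom
    g : I → A → ℕ
    g i s = count (f i) (sums _⊕_ Ts s)

    -- An upper bound for the complement is a lower bound for i.
    lower : ∀ {i} → i ∈ fam → ∀ s → L * e i ≤ N * g i s + N * E
    lower {i} i∈ s = +-cancelˡ-≤ (N * g (compl i) s) _ _ (begin
      N * g (compl i) s + L * e i                        ≤⟨ +-monoˡ-≤ (L * e i) (approx (compl-∈ i∈) s) ⟩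
      L * e (compl i) + N * E + L * e i                  ≡⟨ lem₁ L (e (compl i)) (e i) (N * E) ⟩
      L * (e (compl i) + e i) + N * E                    ≡⟨ cong (λ t → L * t + N * E) (count-not (f i) (f (compl i)) (f-compl i) dom) ⟩
      L * N + N * E                                      ≡⟨ cong (λ t → t * N + N * E) (sym (trans (count-not (f i) (f (compl i)) (f-compl i) (sums _⊕_ Ts s)) (length-sums _⊕_ (Q * r) Ts lens s))) ⟩
      (g (compl i) s + g i s) * N + N * E                ≡⟨ lem₂ (g (compl i) s) (g i s) N E ⟩
      N * g (compl i) s + (N * g i s + N * E)            ∎)
      where
      lem₁ : ∀ l a b n → l * a + n + l * b ≡ l * (a + b) + n
      lem₁ = solve-∀
      lem₂ : ∀ a b n e → (a + b) * n + n * e ≡ n * a + (n * b + n * e)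
      lem₂ = solve-∀

    -- An error E in both directions gives oscillation at most 2E, so R thresholds suffice.
    oscillation : ∀ {i} → i ∈ fam → ∀ s s′ → g i s ≤ g i s′ + R
    oscillation {i} i∈ s s′ = *-cancelˡ-≤ N (begin
      N * g i s                           ≤⟨ approx i∈ s ⟩
      L * e i + N * E                     ≤⟨ +-monoˡ-≤ (N * E) (lower i∈ s′) ⟩
      N * g i s′ + N * E + N * E          ≡⟨ lem N (g i s′) E ⟩
      N * (g i s′ + 2 * E)                ∎)
      where
      lem : ∀ n g e → n * g + n * e + n * e ≡ n * (g + 2 * e)
      lem = solve-∀

    least : (i : I) → ∃ λ a → a ∈ dom × (∀ {x} → x ∈ dom → g i a ≤ g i x)
    least i = ∃-min dom nonempty (g i)
    lo : I → ℕ
    lo i = g i (proj₁ (least i))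
    lo≤ : ∀ i s → lo i ≤ g i s
    lo≤ i s = proj₂ (proj₂ (least i)) (complete s)

    u : I → A → A → ℕ
    u i s a = g i (s ⊕ a) ∸ lo i

    threshold : I × (A × ℕ) → A → Bool
    threshold (i , s , k) a = k <ᵇ u i s a

    fam′ : List (I × (A × ℕ))
    fam′ = cartesianProduct fam (cartesianProduct dom (downFrom R))

    fam′-small : length fam′ < 2 ^ S
    fam′-small = begin-strict
      length fam′                              ≡⟨ trans (length-cartesianProduct fam _) (cong (length fam *_) (trans (length-cartesianProduct dom _) (cong (N *_) (length-downFrom R)))) ⟩
      length fam * (N * R)                     ≤⟨ *-monoʳ-≤ (length fam) (*-monoʳ-≤ N (*-monoʳ-≤ 2 (^-monoʳ-≤ (4 * r) {{m*n≢0 4 r {{_}} {{>-nonZero 1≤r}}}} (<⇒≤ l<c)))) ⟩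
      length fam * (N * (2 * (4 * r) ^ c))     <⟨ small ⟩
      2 ^ S                                    ∎

    samples = sampling dom nonempty fam′ threshold Q r S 1≤Q fam′-small r-large
    T : List A
    T = proj₁ samples
    T-len : length T ≡ Q * r
    T-len = proj₁ (proj₂ samples)

    ∑u : ∀ {i} → i ∈ fam → ∀ s xs → ∑ xs (u i s) ≡ ∑ (downFrom R) (λ k → count (threshold (i , s , k)) xs)
    ∑u {i} i∈ s xs = trans (∑-cong xs (λ a → sym (trans (∑-thresholds R (u i s a)) (m≥n⇒m⊓n≡n (bound a))))) (∑-swap xs (downFrom R) _)
      where
      bound : ∀ a → u i s a ≤ R
      bound a = begin
        g i (s ⊕ a) ∸ lo i       ≤⟨ ∸-monoˡ-≤ (lo i) (oscillation i∈ (s ⊕ a) _) ⟩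
        lo i + R ∸ lo i          ≡⟨ m+n∸m≡n (lo i) R ⟩
        R                        ∎

    ∑g : ∀ i s xs → ∑ xs (λ a → g i (s ⊕ a)) ≡ ∑ xs (u i s) + length xs * lo i
    ∑g i s xs = trans (∑-cong xs (λ a → sym (m∸n+n≡m (lo≤ i (s ⊕ a)))))
      (trans (∑-+ xs (u i s) (λ _ → lo i)) (cong (∑ xs (u i s) +_) (∑-const xs (lo i))))

    -- The minimum `lo i` is carried along exactly; only the part `u` above it, at most R = 2E,
    -- suffers the sampling error 2/Q. The two factors 2 make the 4 in (4r)^(l+1).
    result : ∀ {i} → i ∈ fam → ∀ s →
      N * count (f i) (sums _⊕_ (T ∷ Ts) s) ≤ (Q * r) ^ suc l * e i + N * (4 * r) ^ suc l
    result {i} i∈ s = begin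
      N * count (f i) (sums _⊕_ (T ∷ Ts) s)
        ≡⟨ cong (N *_) (trans (∑-concatMap T _ _) (∑g i s T)) ⟩
      N * (∑ T (u i s) + length T * lo i)
        ≡⟨ trans (*-distribˡ-+ N (∑ T (u i s)) _) (cong (λ t → N * ∑ T (u i s) + N * (t * lo i)) T-len) ⟩
      N * ∑ T (u i s) + N * (Q * r * lo i)
        ≡⟨ cong (λ t → t + N * (Q * r * lo i)) (trans (cong (N *_) (∑u i∈ s T)) (sym (∑-*ˡ (downFrom R) N _))) ⟩
      ∑ (downFrom R) (λ k → N * count (threshold (i , s , k)) T) + N * (Q * r * lo i)
        ≤⟨ +-monoˡ-≤ _ (∑-mono-∈ (downFrom R) (λ k∈ → proj₂ (proj₂ samples) (∈-cartesianProduct⁺ i∈ (∈-cartesianProduct⁺ (complete s) k∈)))) ⟩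
      ∑ (downFrom R) (λ k → r * (Q * count (threshold (i , s , k)) dom + 2 * N)) + N * (Q * r * lo i)
        ≡⟨ cong (_+ N * (Q * r * lo i)) (trans (∑-*ˡ (downFrom R) r _) (cong (r *_) (trans (∑-+ (downFrom R) (λ k → Q * count (threshold (i , s , k)) dom) _)
             (cong₂ _+_ (trans (∑-*ˡ (downFrom R) Q _) (cong (Q *_) (sym (∑u i∈ s dom)))) (trans (∑-const (downFrom R) (2 * N)) (cong (_* (2 * N)) (length-downFrom R))))))) ⟩
      r * (Q * ∑ dom (u i s) + R * (2 * N)) + N * (Q * r * lo i)
        ≡⟨ lem₁ r Q (∑ dom (u i s)) E N (lo i) ⟩
      Q * r * (∑ dom (u i s) + N * lo i) + N * (4 * r * E)
        ≡⟨ cong (λ t → Q * r * t + N * (4 * r * E)) (trans (sym (∑g i s dom)) (trans (shiftˡ s (g i)) (∑-count-sums (f i) Ts lens))) ⟩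
      Q * r * (L * e i) + N * (4 * r * E)
        ≡⟨ cong (_+ N * (4 * r * E)) (sym (*-assoc (Q * r) L (e i))) ⟩
      (Q * r) ^ suc l * e i + N * (4 * r) ^ suc l ∎
      where
      lem₁ : ∀ r q x e n l → r * (q * x + 2 * e * (2 * n)) + n * (q * r * l) ≡ q * r * (x + n * l) + n * (4 * r * e)
      lem₁ = solve-∀

  tables : ∀ l → l ≤ c → ∃ λ Ts → length Ts ≡ l × All (λ T → length T ≡ Q * r) Ts × Approximates Ts l
  tables zero    _   = [] , refl , [] , λ {i} i∈ s → begin
    N * (⟦ f i s ⟧ + 0)            ≡⟨ cong (N *_) (+-identityʳ _) ⟩
    N * ⟦ f i s ⟧                  ≤⟨ *-monoʳ-≤ N (⟦⟧≤1 (f i s)) ⟩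
    N * 1                          ≤⟨ m≤n+m _ _ ⟩
    1 * count (f i) dom + N * 1    ∎
  tables (suc l) l<c with tables l (<⇒≤ l<c)
  ... | Ts , len , lens , approx with add-table l l<c Ts len lens approx
  ... | T , T-len , approx′ = T ∷ Ts , cong suc len , T-len ∷ lens , λ {i} → approx′ {i}

-- Subfunctions of comparator circuits

∑-↭ : {xs ys : List A} (f : A → ℕ) → xs ↭ ys → ∑ xs f ≡ ∑ ys f
∑-↭ f _↭_.refl         = refl
∑-↭ f (prep x p)   = cong (f x +_) (∑-↭ f p)
∑-↭ f (swap x y p) = trans (lem (f x) (f y) _) (cong (λ t → f y + (f x + t)) (∑-↭ f p))
  where
  lem : ∀ a b c → a + (b + c) ≡ b + (a + c)
  lem = solve-∀
∑-↭ f (_↭_.trans p q)  = trans (∑-↭ f p) (∑-↭ f q)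

pairs : (A → A → ℕ) → List A → ℕ
pairs f []       = 0
pairs f (x ∷ xs) = ∑ xs (f x) + pairs f xs

pairs-↭ : {xs ys : List A} (f : A → A → ℕ) → (∀ x y → f x y ≡ f y x) → xs ↭ ys → pairs f xs ≡ pairs f ys
pairs-↭ f f-sym _↭_.refl         = refl
pairs-↭ f f-sym (prep x p)   = cong₂ _+_ (∑-↭ (f x) p) (pairs-↭ f f-sym p)
pairs-↭ f f-sym (swap x y p) rewrite f-sym x y | ∑-↭ (f x) p | ∑-↭ (f y) p | pairs-↭ f f-sym p =
  lem (f y x) _ _ _
  where
  lem : ∀ a b c d → a + b + (c + d) ≡ a + c + (b + d)
  lem = solve-∀
pairs-↭ f f-sym (_↭_.trans p q)  = trans (pairs-↭ f f-sym p) (pairs-↭ f f-sym q)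

pairs-mono : (xs : List A) {f g : A → A → ℕ} → (∀ {x y} → x ∈ xs → y ∈ xs → f x y ≤ g x y) → pairs f xs ≤ pairs g xs
pairs-mono []       h = z≤n
pairs-mono (x ∷ xs) h = +-mono-≤ (∑-mono-∈ xs (λ y∈ → h (here refl) (there y∈))) (pairs-mono xs (λ p q → h (there p) (there q)))

pairs≤length² : (f : A → A → ℕ) → (∀ x y → f x y ≤ 1) → (xs : List A) → pairs f xs ≤ length xs * length xs
pairs≤length² f f≤1 []       = z≤n
pairs≤length² f f≤1 (x ∷ xs) = begin
  ∑ xs (f x) + pairs f xs             ≤⟨ +-mono-≤ (∑-mono xs (f≤1 x)) (pairs≤length² f f≤1 xs) ⟩
  ∑ xs (λ _ → 1) + len * len              ≡⟨ cong (_+ len * len) (∑-const xs 1) ⟩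
  len * 1 + len * len                       ≤⟨ ≤-trans (m≤m+n _ (len + 1)) (≤-reflexive (lem len)) ⟩
  suc len * suc len                       ∎
  where
  open ≤-Reasoning
  len = length xs
  lem : ∀ n → n * 1 + n * n + (n + 1) ≡ (1 + n) * (1 + n)
  lem = solve-∀

extract : {a : A} {xs : List A} → Unique xs → a ∈ xs →
  ∃ λ ys → xs ↭ a ∷ ys × Unique ys × (∀ {y} → y ∈ ys → y ∈ xs × y ≢ a)
extract {xs = x ∷ xs} (x∉ ∷ xs!) (here refl) =
  xs , _↭_.refl , xs! , λ y∈ → there y∈ , λ y≡x → lookupAll x∉ y∈ (sym y≡x)
extract {xs = x ∷ xs} (x∉ ∷ xs!) (there a∈) with extract xs! a∈
... | ys , perm , ys! , sub = x ∷ ys , _↭_.trans (prep x perm) (swap x _ _↭_.refl) ,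
  tabulateAll (λ y∈ → lookupAll x∉ (proj₁ (sub y∈))) ∷ ys! ,
  λ { (here refl) → here refl , lookupAll x∉ a∈ ; (there y∈) → there (proj₁ (sub y∈)) , proj₂ (sub y∈) }

-- Gate lists acting on wires

State : Set → ℕ → Set
State X w = X → Fin w → Bool

step : Fin w × Fin w → (Fin w → Bool) → (Fin w → Bool)
step (a , b) v c = if does (c ≟ a) then v a ∧ v b else if does (c ≟ b) then v a ∨ v b else v c

run : List (Fin w × Fin w) → (Fin w → Bool) → (Fin w → Bool)
run []       v = v
run (g ∷ gs) v = run gs (step g v)

step-∧ : (a b : Fin w) (v : Fin w → Bool) → step (a , b) v a ≡ v a ∧ v b
step-∧ a b v with a ≟ a
... | yes _  = refl
... | no a≢a = ⊥-elim (a≢a refl)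

step-∨ : (a b : Fin w) (v : Fin w → Bool) → a ≢ b → step (a , b) v b ≡ v a ∨ v b
step-∨ a b v a≢b with b ≟ a
... | yes b≡a = ⊥-elim (a≢b (sym b≡a))
... | no _ with b ≟ b
... | yes _  = refl
... | no b≢b = ⊥-elim (b≢b refl)

step-other : (a b : Fin w) (v : Fin w → Bool) {c : Fin w} → c ≢ a → c ≢ b → step (a , b) v c ≡ v c
step-other a b v {c} c≢a c≢b with c ≟ a
... | yes c≡a = ⊥-elim (c≢a c≡a)
... | no _ with c ≟ b
... | yes c≡b = ⊥-elim (c≢b c≡b)
... | no _    = refl

Within : List (Fin w) → List (Fin w × Fin w) → Set
Within U = All (λ g → proj₁ g ∈ U × proj₂ g ∈ U)

∈∉⇒≢ : {x y : A} {xs : List A} → x ∉ xs → y ∈ xs → x ≢ y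
∈∉⇒≢ x∉ y∈ refl = x∉ y∈

run-outside : (U : List (Fin w)) (gs : List (Fin w × Fin w)) → Within U gs → (v : Fin w → Bool) → ∀ {c} → c ∉ U → run gs v c ≡ v c
run-outside U []             []               v c∉ = refl
run-outside U ((a , b) ∷ gs) ((a∈ , b∈) ∷ p) v c∉ =
  trans (run-outside U gs p _ c∉) (step-other a b v (∈∉⇒≢ c∉ a∈) (∈∉⇒≢ c∉ b∈))

run-agree : (U : List (Fin w)) (gs : List (Fin w × Fin w)) → Within U gs → (v v′ : Fin w → Bool) →
  (∀ {c} → c ∈ U → v c ≡ v′ c) → ∀ {c} → c ∈ U → run gs v c ≡ run gs v′ c
run-agree U []             []               v v′ eq c∈ = eq c∈
run-agree U ((a , b) ∷ gs) ((a∈ , b∈) ∷ p) v v′ eq c∈ = run-agree U gs p _ _ step-eq c∈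
  where
  step-eq : ∀ {c} → c ∈ U → step (a , b) v c ≡ step (a , b) v′ c
  step-eq {c} c∈ with c ≟ a
  ... | yes _ = cong₂ _∧_ (eq a∈) (eq b∈)
  ... | no _ with c ≟ b
  ... | yes _ = cong₂ _∨_ (eq a∈) (eq b∈)
  ... | no _  = eq c∈

∧-projˡ : ∀ {p q} → p ∧ q ≡ true → p ≡ true
∧-projˡ {true} _ = refl

∧-projʳ : ∀ {p q} → p ∧ q ≡ true → q ≡ true
∧-projʳ {true} eq = eq

∧-pair : ∀ {p q} → p ≡ true → q ≡ true → p ∧ q ≡ true
∧-pair refl refl = refl

∨-case : ∀ {p q} → p ∨ q ≡ true → p ≡ true ⊎ q ≡ true
∨-case {true}  _  = inj₁ refl
∨-case {false} eq = inj₂ eq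

∨-injˡ : ∀ {p q} → p ≡ true → p ∨ q ≡ true
∨-injˡ refl = refl

∨-injʳ : ∀ {p q} → q ≡ true → p ∨ q ≡ true
∨-injʳ {true}  refl = refl
∨-injʳ {false} refl = refl

⇒-∧ : ∀ {p q} → (p ≡ true → q ≡ true) → p ∧ q ≡ p
⇒-∧ {true}  h = h refl
⇒-∧ {false} h = refl

⇒-∨ : ∀ {p q} → (p ≡ true → q ≡ true) → p ∨ q ≡ q
⇒-∨ {true}  h = sym (h refl)
⇒-∨ {false} h = refl

⇐-∧ : ∀ {p q} → (q ≡ true → p ≡ true) → p ∧ q ≡ q
⇐-∧ {true}          h = refl
⇐-∧ {false} {false} h = refl
⇐-∧ {false} {true}  h = h refl

⇐-∨ : ∀ {p q} → (q ≡ true → p ≡ true) → p ∨ q ≡ p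
⇐-∨ {true}          h = refl
⇐-∨ {false} {false} h = refl
⇐-∨ {false} {true}  h = sym (h refl)

-- π after the transposition of i and j: a gate that exchanges two values is absorbed into the
-- naming of its wires.
swapped : Fin w → Fin w → (Fin w → Fin w) → Fin w → Fin w
swapped i j π l = if does (l ≟ i) then π j else if does (l ≟ j) then π i else π l

data Swapped {w : ℕ} (i j : Fin w) (π : Fin w → Fin w) (l : Fin w) : Fin w → Set where
  first  : l ≡ i → Swapped i j π l (π j)
  second : l ≢ i → l ≡ j → Swapped i j π l (π i)
  other  : l ≢ i → l ≢ j → Swapped i j π l (π l)

swapped-view : (i j : Fin w) (π : Fin w → Fin w) (l : Fin w) → Swapped i j π l (swapped i j π l)
swapped-view i j π l with l ≟ i
... | yes l≡i = first l≡i
... | no l≢i with l ≟ j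
... | yes l≡j = second l≢i l≡j
... | no l≢j  = other l≢i l≢j

swapped-injective : (i j : Fin w) (π : Fin w → Fin w) → (∀ {k l} → π k ≡ π l → k ≡ l) →
  ∀ {k l} → swapped i j π k ≡ swapped i j π l → k ≡ l
swapped-injective i j π inj {k} {l} eq
  with swapped i j π k | swapped-view i j π k | swapped i j π l | swapped-view i j π l
... | _ | first refl     | _ | first refl     = refl
... | _ | first refl     | _ | second l≢i refl = ⊥-elim (l≢i (inj eq))
... | _ | first refl     | _ | other _ l≢j    = ⊥-elim (l≢j (sym (inj eq)))
... | _ | second k≢i refl | _ | first refl     = ⊥-elim (k≢i (sym (inj eq)))
... | _ | second _ refl  | _ | second _ refl  = refl
... | _ | second _ refl  | _ | other l≢i _    = ⊥-elim (l≢i (sym (inj eq)))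
... | _ | other _ k≢j    | _ | first refl     = ⊥-elim (k≢j (inj eq))
... | _ | other k≢i _    | _ | second _ refl  = ⊥-elim (k≢i (inj eq))
... | _ | other _ _      | _ | other _ _      = inj eq

-- Gates between incomparable wires

module Useful {X : Set} (dom : List X) (complete : ∀ x → x ∈ dom) where

  Below : State X w → Fin w → Fin w → Set
  Below st a b = ∀ x → st x a ≡ true → st x b ≡ true

  below? : (st : State X w) (a b : Fin w) → Dec (Below st a b)
  below? st a b = map′ (λ all x → lookupAll all (complete x)) (λ h → tabulateAll (λ {x} _ → h x))
    (allAll? (λ x → (st x a ≟ᵇ true) →-dec (st x b ≟ᵇ true)) dom)

  Comparable : State X w → Fin w → Fin w → Set
  Comparable st a b = Below st a b ⊎ Below st b a

  comparable? : (st : State X w) (a b : Fin w) → Dec (Comparable st a b)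
  comparable? st a b = below? st a b ⊎-dec below? st b a

  abstract
    incomp : State X w → Fin w → Fin w → ℕ
    incomp st a b = ⟦ not (does (comparable? st a b)) ⟧

    comparable⇒0 : (st : State X w) {a b : Fin w} → Comparable st a b → incomp st a b ≡ 0
    comparable⇒0 st {a} {b} c = cong (λ t → ⟦ not t ⟧) (dec-true (comparable? st a b) c)

    incomparable⇒1 : (st : State X w) {a b : Fin w} → ¬ Comparable st a b → incomp st a b ≡ 1
    incomparable⇒1 st {a} {b} ¬c = cong (λ t → ⟦ not t ⟧) (dec-false (comparable? st a b) ¬c)

    incomp≤1 : (st : State X w) (a b : Fin w) → incomp st a b ≤ 1
    incomp≤1 st a b = ⟦⟧≤1 _

  incomp-sym : (st : State X w) (a b : Fin w) → incomp st a b ≡ incomp st b a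
  incomp-sym st a b with comparable? st a b
  ... | yes c = trans (comparable⇒0 st c) (sym (comparable⇒0 st (Sum.swap c)))
  ... | no ¬c = trans (incomparable⇒1 st ¬c) (sym (incomparable⇒1 st (λ c → ¬c (Sum.swap c))))

  module _ (st : State X w) (a b : Fin w) (a≢b : a ≢ b) (¬ab : ¬ Comparable st a b) where

    private
      st′ : State X w
      st′ x = step (a , b) (st x)

    -- After the gate, a wire comparable with a or with b before is comparable with at least one of
    -- them, and with both if it was comparable with both.
    incomp-pair : ∀ {d} → d ≢ a → d ≢ b → incomp st′ a d + incomp st′ b d ≤ incomp st a d + incomp st b d
    incomp-pair {d} d≢a d≢b = cases (comparable? st a d) (comparable? st b d)
      where
      at-a : ∀ x → st′ x a ≡ st x a ∧ st x b
      at-a x = step-∧ a b (st x)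
      at-b : ∀ x → st′ x b ≡ st x a ∨ st x b
      at-b x = step-∨ a b (st x) a≢b
      at-d : ∀ x → st′ x d ≡ st x d
      at-d x = step-other a b (st x) d≢a d≢b
      a′≤d : Below st a d ⊎ Below st b d → Below st′ a d
      a′≤d (inj₁ h) x p = trans (at-d x) (h x (∧-projˡ (trans (sym (at-a x)) p)))
      a′≤d (inj₂ h) x p = trans (at-d x) (h x (∧-projʳ (trans (sym (at-a x)) p)))
      d≤b′ : Below st d a ⊎ Below st d b → Below st′ d b
      d≤b′ (inj₁ h) x p = trans (at-b x) (∨-injˡ (h x (trans (sym (at-d x)) p)))
      d≤b′ (inj₂ h) x p = trans (at-b x) (∨-injʳ (h x (trans (sym (at-d x)) p)))
      b′≤d : Below st a d → Below st b d → Below st′ b d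
      b′≤d h k x p with ∨-case (trans (sym (at-b x)) p)
      ... | inj₁ q = trans (at-d x) (h x q)
      ... | inj₂ q = trans (at-d x) (k x q)
      d≤a′ : Below st d a → Below st d b → Below st′ d a
      d≤a′ h k x p = trans (at-a x) (∧-pair (h x (trans (sym (at-d x)) p)) (k x (trans (sym (at-d x)) p)))
      one-a : Comparable st′ a d → incomp st′ a d + incomp st′ b d ≤ 1
      one-a c = +-mono-≤ (≤-reflexive (comparable⇒0 st′ c)) (incomp≤1 st′ b d)
      one-b : Comparable st′ b d → incomp st′ a d + incomp st′ b d ≤ 1
      one-b c = +-mono-≤ (incomp≤1 st′ a d) (≤-reflexive (comparable⇒0 st′ c))
      both : Comparable st′ a d → Comparable st′ b d → incomp st′ a d + incomp st′ b d ≤ 0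
      both c c′ = +-mono-≤ (≤-reflexive (comparable⇒0 st′ c)) (≤-reflexive (comparable⇒0 st′ c′))
      1≤ˡ : ¬ Comparable st a d → 1 ≤ incomp st a d + incomp st b d
      1≤ˡ ¬h = ≤-trans (≤-reflexive (sym (incomparable⇒1 st ¬h))) (m≤m+n _ _)
      1≤ʳ : ¬ Comparable st b d → 1 ≤ incomp st a d + incomp st b d
      1≤ʳ ¬k = ≤-trans (≤-reflexive (sym (incomparable⇒1 st ¬k))) (m≤n+m _ _)
      cases : Dec (Comparable st a d) → Dec (Comparable st b d) → incomp st′ a d + incomp st′ b d ≤ incomp st a d + incomp st b d
      cases (yes (inj₁ h)) (yes (inj₁ k)) = ≤-trans (both (inj₁ (a′≤d (inj₁ h))) (inj₁ (b′≤d h k))) z≤n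
      cases (yes (inj₂ h)) (yes (inj₂ k)) = ≤-trans (both (inj₂ (d≤a′ h k)) (inj₂ (d≤b′ (inj₁ h)))) z≤n
      -- If d lay between a and b, then a and b would be comparable; the next case is symmetric.
      cases (yes (inj₁ h)) (yes (inj₂ k)) = ⊥-elim (¬ab (inj₁ (λ x p → k x (h x p))))
      cases (yes (inj₂ h)) (yes (inj₁ k)) = ⊥-elim (¬ab (inj₂ (λ x p → h x (k x p))))
      cases (yes (inj₁ h)) (no ¬k) = ≤-trans (one-a (inj₁ (a′≤d (inj₁ h)))) (1≤ʳ ¬k)
      cases (yes (inj₂ h)) (no ¬k) = ≤-trans (one-b (inj₂ (d≤b′ (inj₁ h)))) (1≤ʳ ¬k)
      cases (no ¬h) (yes (inj₁ k)) = ≤-trans (one-a (inj₁ (a′≤d (inj₂ k)))) (1≤ˡ ¬h)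
      cases (no ¬h) (yes (inj₂ k)) = ≤-trans (one-b (inj₂ (d≤b′ (inj₂ k)))) (1≤ˡ ¬h)
      cases (no ¬h) (no ¬k) = +-mono-≤ (≤-trans (incomp≤1 st′ a d) (≤-reflexive (sym (incomparable⇒1 st ¬h))))
        (≤-trans (incomp≤1 st′ b d) (≤-reflexive (sym (incomparable⇒1 st ¬k))))

    incomp-unchanged : ∀ {c d} → c ≢ a → c ≢ b → d ≢ a → d ≢ b → incomp st′ c d ≤ incomp st c d
    incomp-unchanged {c} {d} c≢a c≢b d≢a d≢b with comparable? st c d
    ... | no ¬c = ≤-trans (incomp≤1 st′ c d) (≤-reflexive (sym (incomparable⇒1 st ¬c)))
    ... | yes (inj₁ h) = ≤-trans (≤-reflexive (comparable⇒0 st′ (inj₁ (λ x p → trans (step-other a b (st x) d≢a d≢b) (h x (trans (sym (step-other a b (st x) c≢a c≢b)) p)))))) z≤n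
    ... | yes (inj₂ h) = ≤-trans (≤-reflexive (comparable⇒0 st′ (inj₂ (λ x p → trans (step-other a b (st x) c≢a c≢b) (h x (trans (sym (step-other a b (st x) d≢a d≢b)) p)))))) z≤n

    incomp-ab : incomp st′ a b ≡ 0
    incomp-ab = comparable⇒0 st′ (inj₁ (λ x p → trans (step-∨ a b (st x) a≢b) (∨-injˡ {st x a} {st x b} (∧-projˡ {st x a} {st x b} (trans (sym (step-∧ a b (st x))) p)))))

    -- The pair a, b itself becomes comparable, as a conjunction lies below the disjunction. For
    -- other wires d the contributions of a and b are bounded jointly, since one of them alone may
    -- rise.
    potential-drops : (U : List (Fin _)) → Unique U → a ∈ U → b ∈ U → pairs (incomp st′) U < pairs (incomp st) U
    potential-drops U U! a∈ b∈ with extract U! a∈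
    ... | U₁ , perm₁ , U₁! , sub₁ with extract U₁! (∈-tail (∈-resp-↭ perm₁ b∈) (λ b≡a → a≢b (sym b≡a)))
      where
      ∈-tail : {x y : Fin _} {xs : List (Fin _)} → x ∈ y ∷ xs → x ≢ y → x ∈ xs
      ∈-tail (here eq)  x≢y = ⊥-elim (x≢y eq)
      ∈-tail (there x∈) x≢y = x∈
    ... | V , perm₂ , _ , sub₂ = begin-strict
      pairs (incomp st′) U                             ≡⟨ rearranged st′ ⟩
      incomp st′ a b + (∑ V (λ d → incomp st′ a d + incomp st′ b d) + pairs (incomp st′) V)
                                                       ≡⟨ cong (_+ (∑ V (λ d → incomp st′ a d + incomp st′ b d) + pairs (incomp st′) V)) incomp-ab ⟩
      ∑ V (λ d → incomp st′ a d + incomp st′ b d) + pairs (incomp st′) V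
                                                       ≤⟨ +-mono-≤ (∑-mono-∈ V (λ d∈ → incomp-pair (≢a d∈) (≢b d∈)))
                                                           (pairs-mono V (λ c∈ d∈ → incomp-unchanged (≢a c∈) (≢b c∈) (≢a d∈) (≢b d∈))) ⟩
      ∑ V (λ d → incomp st a d + incomp st b d) + pairs (incomp st) V
                                                       <⟨ n<1+n _ ⟩
      1 + (∑ V (λ d → incomp st a d + incomp st b d) + pairs (incomp st) V)
                                                       ≡⟨ cong (_+ (∑ V (λ d → incomp st a d + incomp st b d) + pairs (incomp st) V)) (sym (incomparable⇒1 st ¬ab)) ⟩
      incomp st a b + (∑ V (λ d → incomp st a d + incomp st b d) + pairs (incomp st) V)
                                                       ≡⟨ sym (rearranged st) ⟩
      pairs (incomp st) U                              ∎
      where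
      open ≤-Reasoning
      ≢a : ∀ {d} → d ∈ V → d ≢ a
      ≢a d∈ = proj₂ (sub₁ (proj₁ (sub₂ d∈)))
      ≢b : ∀ {d} → d ∈ V → d ≢ b
      ≢b d∈ = proj₂ (sub₂ d∈)
      lem : ∀ i x y z → i + x + (y + z) ≡ i + (x + y + z)
      lem = solve-∀
      rearranged : (s : State X _) → pairs (incomp s) U ≡ incomp s a b + (∑ V (λ d → incomp s a d + incomp s b d) + pairs (incomp s) V)
      rearranged s = trans (pairs-↭ (incomp s) (incomp-sym s) (_↭_.trans perm₁ (prep a perm₂)))
        (trans (lem (incomp s a b) (∑ V (incomp s a)) (∑ V (incomp s b)) (pairs (incomp s) V))
          (cong (λ t → incomp s a b + (t + pairs (incomp s) V)) (sym (∑-+ V (incomp s a) (incomp s b)))))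

  -- A comparator network acts on "virtual" wires, renamed by an injection π.  A gate whose inputs are
  -- comparable as functions of x is either void or a swap, which only changes π; each remaining
  -- gate decreases the number of incomparable pairs.
  module _ (E U : List (Fin w)) (U! : Unique U) where

    Frozen : State X w → Set
    Frozen st = ∀ {c} → c ∈ E → c ∉ U → ∀ x y → st x c ≡ st y c

    -- A constantly false wire lies below every wire, a constantly true one above every wire.
    const⇒comparable : (st : State X w) (a b : Fin w) → (∀ x y → st x a ≡ st y a) → Comparable st a b
    const⇒comparable st a b const with below? st a b
    ... | yes h = inj₁ h
    ... | no ¬h = inj₂ (λ x _ → decide x (st x a) refl)
      where
      decide : ∀ x v → st x a ≡ v → v ≡ true
      decide x true  eq = refl
      decide x false eq = ⊥-elim (¬h (λ y p → ⊥-elim (false≢true (trans (sym eq) (trans (const x y) p)))))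
        where
        false≢true : false ≢ true
        false≢true ()

    -- This confines the surviving gates to U, so both the length and the alphabet of the code are
    -- governed by the load of the block and not by the size of the circuit.
    incomparable⇒∈ : (st : State X w) → Frozen st → ∀ {a b} → a ∈ E → ¬ Comparable st a b → a ∈ U
    incomparable⇒∈ st frozen {a} {b} a∈E ¬ab with _∈?_ _≟_ a U
    ... | yes a∈U = a∈U
    ... | no  a∉U = ⊥-elim (¬ab (const⇒comparable st a b (frozen a∈E a∉U)))

    EndpointsIn : CGate w → Set
    EndpointsIn ((i , j) , _) = i ∈ E × j ∈ E

    Simulated : State X w → (X → Vec Bool w) → List (CGate w) → Set
    Simulated st V gs = Σ (List (Fin w × Fin w)) λ code → Σ (Fin w → Fin w) λ π → Within U code × length code ≤ pairs (incomp st) U ×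
      (∀ {i} → i ∈ E → π i ∈ E) × (∀ x i → lookup (applyGates (V x) gs) i ≡ run code (st x) (π i))

    simulate : (gs : List (CGate w)) → All EndpointsIn gs → (st : State X w) → Frozen st → (π : Fin w → Fin w) →
      (∀ {k l} → π k ≡ π l → k ≡ l) → (∀ {i} → i ∈ E → π i ∈ E) → (V : X → Vec Bool w) →
      (∀ x i → lookup (V x) i ≡ st x (π i)) → Simulated st V gs
    simulate []                      []                   st frozen π inj π-E V V-st = [] , π , [] , z≤n , π-E , V-st
    simulate (g@((i , j) , i≢j) ∷ gs) ((i∈ , j∈) ∷ ends) st frozen π inj π-E V V-st = by-cases (below? st a b) (below? st b a)
      where
      a = π i
      b = π j
      V′ : X → Vec Bool w
      V′ x = applyGate (V x) g
      at-j : ∀ x → lookup (V′ x) j ≡ st x a ∨ st x b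
      at-j x = trans (lookup∘update j (V x [ i ]≔ _) _) (cong₂ _∨_ (V-st x i) (V-st x j))
      at-i : ∀ x → lookup (V′ x) i ≡ st x a ∧ st x b
      at-i x = trans (lookup∘update′ i≢j (V x [ i ]≔ _) _) (trans (lookup∘update i (V x) _) (cong₂ _∧_ (V-st x i) (V-st x j)))
      at-other : ∀ x {l} → l ≢ i → l ≢ j → lookup (V′ x) l ≡ st x (π l)
      at-other x {l} l≢i l≢j = trans (lookup∘update′ l≢j (V x [ i ]≔ _) _) (trans (lookup∘update′ l≢i (V x) _) (V-st x l))
      by-cases : Dec (Below st a b) → Dec (Below st b a) → Simulated st V (g ∷ gs)
      by-cases (yes a≤b) _ = simulate gs ends st frozen π inj π-E V′ same
        where
        same : ∀ x l → lookup (V′ x) l ≡ st x (π l)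
        same x l with l ≟ i | l ≟ j
        ... | yes refl | _        = trans (at-i x) (⇒-∧ (a≤b x))
        ... | no _     | yes refl = trans (at-j x) (⇒-∨ (a≤b x))
        ... | no l≢i   | no l≢j   = at-other x l≢i l≢j
      by-cases (no _) (yes b≤a) = simulate gs ends st frozen (swapped i j π) (swapped-injective i j π inj) in-E V′ same
        where
        in-E : ∀ {l} → l ∈ E → swapped i j π l ∈ E
        in-E {l} l∈ with swapped i j π l | swapped-view i j π l
        ... | _ | first _    = π-E j∈
        ... | _ | second _ _ = π-E i∈
        ... | _ | other _ _  = π-E l∈
        same : ∀ x l → lookup (V′ x) l ≡ st x (swapped i j π l)
        same x l with swapped i j π l | swapped-view i j π l
        ... | _ | first refl     = trans (at-i x) (⇐-∧ (b≤a x))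
        ... | _ | second _ refl  = trans (at-j x) (⇐-∨ (b≤a x))
        ... | _ | other l≢i l≢j  = at-other x l≢i l≢j
      by-cases (no a≰b) (no b≰a) with simulate gs ends st′ frozen′ π inj π-E V′ same
        where
        st′ : State X w
        st′ x = step (a , b) (st x)
        a≢b : a ≢ b
        a≢b a≡b = i≢j (inj a≡b)
        a∈U : a ∈ U
        a∈U = incomparable⇒∈ st frozen (π-E i∈) λ { (inj₁ h) → a≰b h ; (inj₂ h) → b≰a h }
        b∈U : b ∈ U
        b∈U = incomparable⇒∈ st frozen (π-E j∈) λ { (inj₁ h) → b≰a h ; (inj₂ h) → a≰b h }
        frozen′ : Frozen st′
        frozen′ c∈E c∉U x y = trans (step-other a b (st x) (∈∉⇒≢ c∉U a∈U) (∈∉⇒≢ c∉U b∈U))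
          (trans (frozen c∈E c∉U x y) (sym (step-other a b (st y) (∈∉⇒≢ c∉U a∈U) (∈∉⇒≢ c∉U b∈U))))
        same : ∀ x l → lookup (V′ x) l ≡ st′ x (π l)
        same x l with l ≟ i | l ≟ j
        ... | yes refl | _        = trans (at-i x) (sym (step-∧ a b (st x)))
        ... | no _     | yes refl = trans (at-j x) (sym (step-∨ a b (st x) a≢b))
        ... | no l≢i   | no l≢j   = trans (at-other x l≢i l≢j) (sym (step-other a b (st x) (λ p → l≢i (inj p)) (λ p → l≢j (inj p))))
      ... | code , π′ , within , short , π′-E , runs = (a , b) ∷ code , π′ , (a∈U , b∈U) ∷ within , ≤-trans (s≤s short) drops , π′-E , runs
        where
        ¬ab : ¬ Comparable st a b
        ¬ab (inj₁ h) = a≰b h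
        ¬ab (inj₂ h) = b≰a h
        a∈U : a ∈ U
        a∈U = incomparable⇒∈ st frozen (π-E i∈) ¬ab
        b∈U : b ∈ U
        b∈U = incomparable⇒∈ st frozen (π-E j∈) λ { (inj₁ h) → b≰a h ; (inj₂ h) → a≰b h }
        drops = potential-drops st a b (λ a≡b → i≢j (inj a≡b)) ¬ab U U! a∈U b∈U

-- Enumerating the subfunctions on a block

listsUpTo : List A → ℕ → List (List A)
listsUpTo alph zero    = [] ∷ []
listsUpTo alph (suc n) = [] ∷ map (λ p → proj₁ p ∷ proj₂ p) (cartesianProduct alph (listsUpTo alph n))

∈-listsUpTo : {alph xs : List A} → All (_∈ alph) xs → ∀ {n} → length xs ≤ n → xs ∈ listsUpTo alph n
∈-listsUpTo []        {zero}  _         = here refl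
∈-listsUpTo []        {suc n} _         = here refl
∈-listsUpTo (x∈ ∷ xs) {suc n} (s≤s len) = there (∈-map⁺ _ (∈-cartesianProduct⁺ x∈ (∈-listsUpTo xs len)))

length-listsUpTo : (alph : List A) (n : ℕ) → length (listsUpTo alph n) ≤ suc (length alph) ^ n
length-listsUpTo alph zero    = ≤-refl
length-listsUpTo alph (suc n) = begin
  1 + length (map _ (cartesianProduct alph (listsUpTo alph n)))  ≡⟨ cong suc (trans (length-map _ (cartesianProduct alph (listsUpTo alph n))) (length-cartesianProduct alph (listsUpTo alph n))) ⟩
  1 + length alph * length (listsUpTo alph n)      ≤⟨ +-mono-≤ (m^n>0 (suc (length alph)) n) (*-monoʳ-≤ (length alph) (length-listsUpTo alph n)) ⟩
  suc (length alph) ^ suc n                        ∎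
  where open ≤-Reasoning

endpoints : List (CGate w) → List (Fin w)
endpoints []                   = []
endpoints (((i , j) , _) ∷ gs) = i ∷ j ∷ endpoints gs

length-endpoints : (gs : List (CGate w)) → length (endpoints gs) ≡ 2 * length gs
length-endpoints []       = refl
length-endpoints (g ∷ gs) = trans (cong (2 +_) (length-endpoints gs)) (sym (*-suc 2 (length gs)))

endpoints-∈ : (gs : List (CGate w)) → All (λ g → proj₁ (proj₁ g) ∈ endpoints gs × proj₂ (proj₁ g) ∈ endpoints gs) gs
endpoints-∈ []       = []
endpoints-∈ (g ∷ gs) = (here refl , there (here refl)) ∷
  mapAll (λ (p , q) → there (there p) , there (there q)) (endpoints-∈ gs)

-- The size bounds the number of gates but not of wires, so only wires that meet a gate, and the
-- output, are counted.
touched : (C : Comparator n) → List (Fin (wires C))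
touched C = deduplicate _≟_ (output C ∷ endpoints (gates C))

length-touched : (C : Comparator n) → length (touched C) ≤ 1 + 2 * size C
length-touched C = ≤-trans (length-deduplicate _≟_ (output C ∷ endpoints (gates C))) (≤-reflexive (cong suc (length-endpoints (gates C))))

live? : {n : ℕ} (C : Comparator n) (live : Fin n → Bool) (c : Fin (wires C)) → Dec (live (proj₁ (label C c)) ≡ true)
live? C live c = live (proj₁ (label C c)) ≟ᵇ true

active : {n : ℕ} (C : Comparator n) → (Fin n → Bool) → List (Fin (wires C))
active C live = filter (live? C live) (touched C)

lookup-initWires : (ℓ : Fin w → Literal n) (a : Fin n → Bool) (c : Fin w) → lookup (initWires ℓ a) c ≡ litValue a (ℓ c)
lookup-initWires ℓ a zero    = refl
lookup-initWires ℓ a (suc c) = lookup-initWires (λ i → ℓ (suc i)) a c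

litValue-cong : (a b : Fin n → Bool) (l : Literal n) → a (proj₁ l) ≡ b (proj₁ l) → litValue a l ≡ litValue b l
litValue-cong a b (i , true)  eq = eq
litValue-cong a b (i , false) eq = cong not eq

initWires-cong : (ℓ : Fin w → Literal n) {a b : Fin n → Bool} → (∀ i → a i ≡ b i) → initWires ℓ a ≡ initWires ℓ b
initWires-cong {w = zero}  ℓ eq = refl
initWires-cong {w = suc w} ℓ eq = cong₂ Vec._∷_ (litValue-cong _ _ (ℓ zero) (eq _)) (initWires-cong (λ i → ℓ (suc i)) eq)

evalComparator-cong : (C : Comparator n) {a b : Fin n → Bool} → (∀ i → a i ≡ b i) → evalComparator C a ≡ evalComparator C b
evalComparator-cong C eq = cong (λ v → lookup (applyGates v (gates C)) (output C)) (initWires-cong (label C) eq)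

module Subfunctions {n : ℕ} (C : Comparator n) {X : Set} (dom : List X) (complete : ∀ x → x ∈ dom) (x₀ : X)
  (live : Fin n → Bool) (input₀ : X → Fin n → Bool) where

  open Useful dom complete

  -- `nothing` stands for the constants, `just` for a code with its output wire; the Boolean
  -- negates, which closes the family under complement.
  Index : Set
  Index = Bool × Maybe (List (Fin (wires C) × Fin (wires C)) × Fin (wires C))

  private
    U : List (Fin (wires C))
    U = active C live
    ι : (X → Fin n → Bool) → State X (wires C)
    ι input x c = litValue (input x) (label C c)

  member : Index → X → Bool
  member (neg , nothing)         x = neg
  member (neg , just (code , o)) x = neg xor run code (ι input₀ x) o

  complement : Index → Index
  complement (neg , k) = not neg , k

  member-complement : ∀ k x → member (complement k) x ≡ not (member k x)
  member-complement (neg   , nothing) x = refl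
  member-complement (false , just _)  x = refl
  member-complement (true  , just (code , o)) x with run code (ι input₀ x) o
  ... | false = refl
  ... | true  = refl

  codes : List (List (Fin (wires C) × Fin (wires C)) × Fin (wires C))
  codes = cartesianProduct (listsUpTo (cartesianProduct U U) (length U * length U)) U

  family : List Index
  family = cartesianProduct (false ∷ true ∷ []) (nothing ∷ map just codes)

  ∈-family : ∀ b {k} → k ∈ nothing ∷ map just codes → (b , k) ∈ family
  ∈-family false k∈ = ∈-cartesianProduct⁺ {xs = false ∷ true ∷ []} {ys = nothing ∷ map just codes} (here refl) k∈
  ∈-family true  k∈ = ∈-cartesianProduct⁺ {xs = false ∷ true ∷ []} {ys = nothing ∷ map just codes} (there (here refl)) k∈

  complement-∈ : ∀ {k} → k ∈ family → complement k ∈ family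
  complement-∈ {neg , k} k∈ = ∈-family (not neg) (proj₂ (∈-cartesianProduct⁻ (false ∷ true ∷ []) (nothing ∷ map just codes) k∈))

  length-family : length family ≤ 2 * (1 + suc (length U * length U) ^ (length U * length U) * length U)
  length-family = begin
    length family                                        ≡⟨ length-cartesianProduct (false ∷ true ∷ []) (nothing ∷ map just codes) ⟩
    2 * (1 + length (map just codes))                       ≡⟨ cong (λ t → 2 * (1 + t)) (trans (length-map just codes) (length-cartesianProduct lists U)) ⟩
    2 * (1 + length lists * length U)                    ≤⟨ *-monoʳ-≤ 2 (+-monoʳ-≤ 1 (*-monoˡ-≤ (length U) (length-listsUpTo (cartesianProduct U U) L))) ⟩
    2 * (1 + suc (length (cartesianProduct U U)) ^ L * length U)  ≡⟨ cong (λ t → 2 * (1 + suc t ^ L * length U)) (length-cartesianProduct U U) ⟩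
    2 * (1 + suc (length U * length U) ^ L * length U)   ∎
    where
    open ≤-Reasoning
    L = length U * length U
    lists = listsUpTo (cartesianProduct U U) L

  -- The input outside the block decides which gates survive and to which wire the output is
  -- renamed, and both are recorded in the index. On U the initial values agree with `input₀`, so
  -- running the code there gives the subfunction.
  subfunction-∈ : (input : X → Fin n → Bool) → (∀ x i → live i ≡ true → input x i ≡ input₀ x i) →
    (∀ x y i → live i ≢ true → input x i ≡ input y i) →
    ∃ λ k → k ∈ family × (∀ x → evalComparator C (input x) ≡ member k x)
  subfunction-∈ input agree rest
    with simulate E U U! (gates C) ends (ι input) frozen (λ c → c) (λ eq → eq) (λ c∈ → c∈)
           (λ x → initWires (label C) (input x)) (λ x c → lookup-initWires (label C) (input x) c)
    where
    E = touched C
    U! : Unique U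
    U! = filter⁺ (live? C live) (deduplicate-! _≟_ (output C ∷ endpoints (gates C)))
    ends : All (EndpointsIn E U U!) (gates C)
    ends = mapAll (λ (p , q) → ∈-deduplicate⁺ _≟_ (there p) , ∈-deduplicate⁺ _≟_ (there q)) (endpoints-∈ (gates C))
    frozen : Frozen E U U! (ι input)
    frozen {c} c∈E c∉U x y = litValue-cong _ _ (label C c) (rest x y _ (λ p → c∉U (∈-filter⁺ (live? C live) c∈E p)))
  ... | code , π , within , short , π-E , runs with _∈?_ _≟_ (π (output C)) U
  ... | yes o∈U = (false , just (code , π (output C))) ,
    ∈-family false (there (∈-map⁺ just (∈-cartesianProduct⁺
      (∈-listsUpTo (mapAll (λ (p , q) → ∈-cartesianProduct⁺ p q) within) (≤-trans short (pairs≤length² _ (incomp≤1 (ι input)) U))) o∈U))) ,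
    λ x → trans (runs x (output C)) (run-agree U code within (ι input x) (ι input₀ x)
      (λ {c} c∈ → litValue-cong _ _ (label C c) (agree x _ (proj₂ (∈-filter⁻ (live? C live) {xs = touched C} c∈)))) o∈U)
  -- The renamed output lies on a frozen wire, so the subfunction is constant and its value can be
  -- read at x₀.
  ... | no o∉U = (ι input x₀ (π (output C)) , nothing) , ∈-family _ (here refl) ,
    λ x → trans (runs x (output C)) (trans (run-outside U code within (ι input x) o∉U)
      (litValue-cong _ _ (label C (π (output C))) (rest x x₀ _ (λ p → o∉U (∈-filter⁺ (live? C live) (π-E (∈-deduplicate⁺ _≟_ {xs = output C ∷ endpoints (gates C)} (here refl))) p)))))

-- Circuit constructions

BoolFun : ℕ → Set
BoolFun m = Vec Bool m → Bool

-- g can be computed with s further gates in every circuit that already computes all of gs.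
Cost : List (BoolFun m) → ℕ → BoolFun m → Set
Cost {m} gs s g = ∀ {k} (c : Circuit m k) → All (CircuitComputes c) gs →
  Σ ℕ λ k′ → Σ (Circuit m k′) λ c′ → k′ ≤ s + k × (∀ {h} → CircuitComputes c h → CircuitComputes c′ h) × CircuitComputes c′ g

inputs-computed : (c : Circuit m k) (i : Fin m) → CircuitComputes c (λ x → lookup x i)
inputs-computed inputs         i = i , λ x → refl
inputs-computed (gate c f _ _) i with inputs-computed c i
... | o , eq = suc o , eq

gate-keeps : (c : Circuit m k) (f : Bool → Bool → Bool) (i j : Fin (k + m)) {h : BoolFun m} →
  CircuitComputes c h → CircuitComputes (gate c f i j) h
gate-keeps c f i j (o , eq) = suc o , eq

cost-input : (gs : List (BoolFun m)) (i : Fin m) → Cost gs 0 (λ x → lookup x i)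
cost-input gs i c _ = _ , c , ≤-refl , (λ h → h) , inputs-computed c i

cost-∈ : {gs : List (BoolFun m)} {g : BoolFun m} → g ∈ gs → Cost gs 0 g
cost-∈ g∈ c has = _ , c , ≤-refl , (λ h → h) , lookupAll has g∈

cost-cong : {gs : List (BoolFun m)} {g h : BoolFun m} → (∀ x → g x ≡ h x) → Cost gs s g → Cost gs s h
cost-cong eq cost c has with cost c has
... | k′ , c′ , k′≤ , keeps , o , comp = k′ , c′ , k′≤ , keeps , o , λ x → trans (comp x) (eq x)

cost-≤ : {gs : List (BoolFun m)} {g : BoolFun m} → s ≤ t → Cost gs s g → Cost gs t g
cost-≤ s≤t cost c has with cost c has
... | k′ , c′ , k′≤ , rest = k′ , c′ , ≤-trans k′≤ (+-monoˡ-≤ _ s≤t) , rest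

cost-weaken : {gs hs : List (BoolFun m)} {g : BoolFun m} → (∀ {h} → h ∈ gs → h ∈ hs) → Cost gs s g → Cost hs s g
cost-weaken sub cost c has = cost c (tabulateAll (λ h∈ → lookupAll has (sub h∈)))

cost-let : {gs : List (BoolFun m)} {g h : BoolFun m} → Cost gs s g → Cost (g ∷ gs) t h → Cost gs (s + t) h
cost-let {s = s} {t = t} cg ch {k} c has with cg c has
... | k₁ , c₁ , k₁≤ , keeps₁ , comp₁ with ch c₁ (comp₁ ∷ mapAll keeps₁ has)
... | k₂ , c₂ , k₂≤ , keeps₂ , comp₂ = k₂ , c₂ , ≤-trans k₂≤ (≤-trans (+-monoʳ-≤ t k₁≤) (≤-reflexive (lem s t k))) ,
  (λ p → keeps₂ (keeps₁ p)) , comp₂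
  where
  lem : ∀ s t k → t + (s + k) ≡ s + t + k
  lem = solve-∀

cost-gate : {gs : List (BoolFun m)} {g h : BoolFun m} (f : Bool → Bool → Bool) → Cost gs s g → Cost gs t h →
  Cost gs (suc (s + t)) (λ x → f (g x) (h x))
cost-gate {m} {s} {t} {gs} {g} {h} f cg ch = cost-≤ (≤-reflexive (+-suc s t)) (cost-let cg rest)
  where
  rest : Cost (g ∷ gs) (suc t) (λ x → f (g x) (h x))
  rest c (comp-g ∷ has) with ch c has
  ... | k₁ , c₁ , k₁≤ , keeps₁ , (o , comp-h) with keeps₁ comp-g
  ... | o′ , comp-g′ = suc k₁ , gate c₁ f o′ o , s≤s k₁≤ , (λ p → gate-keeps c₁ f o′ o (keeps₁ p)) ,
    zero , λ x → cong₂ f (comp-g′ x) (comp-h x)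

cost-const : (gs : List (BoolFun m)) → Fin m → (v : Bool) → Cost gs 1 (λ _ → v)
cost-const gs i v = cost-gate (λ _ _ → v) (cost-input gs i) (cost-input gs i)

cost-lets : {gs hs : List (BoolFun m)} {h : BoolFun m} → All (Cost gs s) hs → Cost (hs ++ gs) t h → Cost gs (length hs * s + t) h
cost-lets []                                    ch = ch
cost-lets {s = s} {t = t} {gs} {h₀ ∷ hs} (c₀ ∷ cs) ch = cost-≤ (≤-reflexive (sym (+-assoc s (length hs * s) t)))
  (cost-let c₀ (cost-lets (mapAll (cost-weaken there) cs) (cost-weaken move ch)))
  where
  move : ∀ {h} → h ∈ h₀ ∷ hs ++ gs → h ∈ hs ++ h₀ ∷ gs
  move (here eq) = ∈-++⁺ʳ hs (here eq)
  move (there h∈) with ∈-++⁻ hs h∈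
  ... | inj₁ p = ∈-++⁺ˡ p
  ... | inj₂ p = ∈-++⁺ʳ hs (there p)

apply : Vec (BoolFun m) p → Vec Bool m → Vec Bool p
apply []       x = []
apply (a ∷ as) x = a x ∷ apply as x

data AllCost {m : ℕ} (gs : List (BoolFun m)) (s : ℕ) : {p : ℕ} → Vec (BoolFun m) p → Set where
  []  : AllCost gs s []
  _∷_ : ∀ {p a} {as : Vec (BoolFun m) p} → Cost gs s a → AllCost gs s as → AllCost gs s (a ∷ as)

-- Shannon expansion.
cost-table : (gs : List (BoolFun m)) → Fin m → (as : Vec (BoolFun m) p) → AllCost gs 0 as → (T : Vec Bool p → Bool) →
  Cost gs (4 * 2 ^ p) (λ x → T (apply as x))
cost-table {m} gs i as cas T with expand as cas T
  where
  mux : Bool → Bool → Bool → Bool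
  mux a u v = (a ∧ u) ∨ (not a ∧ v)
  -- A Shannon step combines two subcircuits with three gates, so it is s + 3 that doubles; a bound
  -- on s alone would not be inductive.
  expand : ∀ {p} (as : Vec (BoolFun m) p) → AllCost gs 0 as → (T : Vec Bool p → Bool) →
    ∃ λ s → s + 3 ≤ 4 * 2 ^ p × Cost gs s (λ x → T (apply as x))
  expand []       []         T = 1 , ≤-refl , cost-const gs i (T [])
  expand {suc p} (a ∷ as) (ca ∷ cas) T with expand as cas (λ v → T (true ∷ v)) | expand as cas (λ v → T (false ∷ v))
  ... | s , s≤ , cs | t , t≤ , ct = suc (suc s + suc t) , bound ,
    cost-cong correct (cost-gate _∨_ (cost-gate _∧_ ca cs) (cost-gate (λ u v → not u ∧ v) ca ct))
    where
    correct : ∀ x → mux (a x) (T (true ∷ apply as x)) (T (false ∷ apply as x)) ≡ T (a x ∷ apply as x)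
    correct x with a x
    ... | false = refl
    ... | true with T (true ∷ apply as x)
    ... | false = refl
    ... | true  = refl
    bound : suc (suc s + suc t) + 3 ≤ 4 * 2 ^ suc p
    bound = ≤-trans (≤-reflexive (lem s t)) (≤-trans (+-mono-≤ s≤ t≤) (≤-reflexive (lem′ (2 ^ p))))
      where
      lem : ∀ s t → 1 + (1 + s + (1 + t)) + 3 ≡ s + 3 + (t + 3)
      lem = solve-∀
      lem′ : ∀ y → 4 * y + 4 * y ≡ 4 * (2 * y)
      lem′ = solve-∀
... | s , s≤ , cs = cost-≤ (≤-trans (m≤m+n s 3) s≤) cs

same : Bool → Bool → Bool
same true  b = b
same false b = not b

eqᵛ : {q : ℕ} → Vec Bool q → Vec Bool q → Bool
eqᵛ []       []       = true
eqᵛ (a ∷ as) (b ∷ bs) = same a b ∧ eqᵛ as bs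

eqᵛ-refl : {q : ℕ} (u : Vec Bool q) → eqᵛ u u ≡ true
eqᵛ-refl []          = refl
eqᵛ-refl (true  ∷ u) = eqᵛ-refl u
eqᵛ-refl (false ∷ u) = eqᵛ-refl u

eqᵛ⇒≡ : {q : ℕ} (u v : Vec Bool q) → eqᵛ u v ≡ true → u ≡ v
eqᵛ⇒≡ []          []          eq = refl
eqᵛ⇒≡ (true  ∷ u) (true  ∷ v) eq = cong (true ∷_) (eqᵛ⇒≡ u v eq)
eqᵛ⇒≡ (false ∷ u) (false ∷ v) eq = cong (false ∷_) (eqᵛ⇒≡ u v eq)

cost-eq : (gs : List (BoolFun m)) → Fin m → (u : Vec Bool p) (as : Vec (BoolFun m) p) → AllCost gs 0 as →
  Cost gs (suc p) (λ x → eqᵛ u (apply as x))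
cost-eq gs i []      []       []         = cost-const gs i true
cost-eq gs i (b ∷ u) (a ∷ as) (ca ∷ cas) = cost-gate (λ y z → same b y ∧ z) ca (cost-eq gs i u as cas)

module _ {D : Set} (default : D) where

  assoc : List (Vec Bool p × D) → Vec Bool p → D
  assoc []             u = default
  assoc ((v , d) ∷ es) u = if eqᵛ v u then d else assoc es u

  -- Each stored bit is a constant absorbed into the selecting gate: an entry costs p + 1 gates for
  -- the comparison and one for the selection.
  cost-assoc : (gs : List (BoolFun m)) → Fin m → (bit : D → Bool) (es : List (Vec Bool p × D))
    (as : Vec (BoolFun m) p) → AllCost gs 0 as →
    Cost gs (length es * (2 + p) + 1) (λ x → bit (assoc es (apply as x)))
  cost-assoc gs i bit []             as cas = cost-const gs i (bit default)
  cost-assoc {p = p} gs i bit ((v , d) ∷ es) as cas = cost-≤ (≤-reflexive (lem p (length es)))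
    (cost-cong correct (cost-gate (λ y z → if y then bit d else z) (cost-eq gs i v as cas) (cost-assoc gs i bit es as cas)))
    where
    lem : ∀ p l → 1 + (1 + p + (l * (2 + p) + 1)) ≡ (1 + l) * (2 + p) + 1
    lem = solve-∀
    correct : ∀ x → (if eqᵛ v (apply as x) then bit d else bit (assoc es (apply as x))) ≡ bit (if eqᵛ v (apply as x) then d else assoc es (apply as x))
    correct x with eqᵛ v (apply as x)
    ... | true  = refl
    ... | false = refl

-- The circuit for a string of table sums

unindex : ∀ m → Fin (2 ^ m) → Vec Bool m
unindex zero    i = []
unindex (suc m) i with splitAt (2 ^ m) i
... | inj₁ j = false ∷ unindex m j
... | inj₂ j with splitAt (2 ^ m) j
... | inj₁ l = true ∷ unindex m l

unindex-ttIndex : (x : Vec Bool m) → unindex m (ttIndex x) ≡ x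
unindex-ttIndex []                    = refl
unindex-ttIndex {suc m} (false ∷ x)
  rewrite splitAt-↑ˡ (2 ^ m) (ttIndex x) (2 ^ m + 0) = cong (false ∷_) (unindex-ttIndex x)
unindex-ttIndex {suc m} (true ∷ x)
  rewrite splitAt-↑ʳ (2 ^ m) (2 ^ m + 0) (ttIndex x ↑ˡ 0) | splitAt-↑ˡ (2 ^ m) (ttIndex x) 0 = cong (true ∷_) (unindex-ttIndex x)

ttIndex-unindex : ∀ m (i : Fin (2 ^ m)) → ttIndex (unindex m i) ≡ i
ttIndex-unindex zero    zero = refl
ttIndex-unindex (suc m) i with splitAt (2 ^ m) i in eq
... | inj₁ j = trans (cong (_↑ˡ (2 ^ m + 0)) (ttIndex-unindex m j)) (splitAt⁻¹-↑ˡ eq)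
... | inj₂ j with splitAt (2 ^ m) j in eq′
... | inj₁ l = trans (cong (λ z → 2 ^ m ↑ʳ (z ↑ˡ 0)) (ttIndex-unindex m l)) (trans (cong (2 ^ m ↑ʳ_) (splitAt⁻¹-↑ˡ eq′)) (splitAt⁻¹-↑ʳ eq))

take-++ : {A : Set} {n n′ : ℕ} (u : Vec A n) (v : Vec A n′) → Vec.take n (u Vec.++ v) ≡ u
take-++ []      v = refl
take-++ (a ∷ u) v = cong (a ∷_) (take-++ u v)

drop-++ : {A : Set} {n n′ : ℕ} (u : Vec A n) (v : Vec A n′) → Vec.drop n (u Vec.++ v) ≡ v
drop-++ []      v = refl
drop-++ (a ∷ u) v = drop-++ u v

_⊕_ : {n : ℕ} → Vec Bool n → Vec Bool n → Vec Bool n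
_⊕_ = zipWith _xor_

-- The tuple of indices selects one summand per table, so the values are the entries of `sums` once
-- every table is enumerated by ρ-bit indices.
combine : {n ρ c : ℕ} → Vec Bool n → Vec (Vec Bool ρ → Vec Bool n) c → Vec (Vec Bool ρ) c → Vec Bool n
combine z []       []       = z
combine z (T ∷ Ts) (j ∷ js) = combine (z ⊕ T j) Ts js

allCost-inputs : {m : ℕ} (gs : List (BoolFun m)) {p : ℕ} (ι : Fin p → Fin m) → AllCost gs 0 (tabulate (λ i x → lookup x (ι i)))
allCost-inputs gs {zero}  ι = []
allCost-inputs gs {suc p} ι = cost-input gs (ι zero) ∷ allCost-inputs gs (λ i → ι (suc i))

apply-++ : {m p p′ : ℕ} (as : Vec (BoolFun m) p) (bs : Vec (BoolFun m) p′) (x : Vec Bool m) → apply (as Vec.++ bs) x ≡ apply as x Vec.++ apply bs x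
apply-++ []       bs x = refl
apply-++ (a ∷ as) bs x = cong (a x ∷_) (apply-++ as bs x)

allCost-++ : {m p p′ : ℕ} {gs : List (BoolFun m)} {as : Vec (BoolFun m) p} {bs : Vec (BoolFun m) p′} → AllCost gs 0 as → AllCost gs 0 bs → AllCost gs 0 (as Vec.++ bs)
allCost-++ []        cbs = cbs
allCost-++ (c ∷ cas) cbs = c ∷ allCost-++ cas cbs

allCost-∈ : {m p : ℕ} {gs : List (BoolFun m)} (as : Vec (BoolFun m) p) → (∀ {a} → a ∈ Vec.toList as → a ∈ gs) → AllCost gs 0 as
allCost-∈ []       sub = []
allCost-∈ (a ∷ as) sub = cost-∈ (sub (here refl)) ∷ allCost-∈ as (λ p → sub (there p))

apply-tabulate : {m p : ℕ} (f : Fin p → BoolFun m) (x : Vec Bool m) → apply (tabulate f) x ≡ tabulate (λ i → f i x)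
apply-tabulate {p = zero}  f x = refl
apply-tabulate {p = suc p} f x = cong (f zero x ∷_) (apply-tabulate (λ i → f (suc i)) x)

length-toList : {A : Set} {p : ℕ} (as : Vec A p) → length (Vec.toList as) ≡ p
length-toList []       = refl
length-toList (a ∷ as) = cong suc (length-toList as)

toList-tabulate : {m p : ℕ} {P : BoolFun m → Set} (f : Fin p → BoolFun m) → (∀ i → P (f i)) → All P (Vec.toList (tabulate f))
toList-tabulate {p = zero}  f h = []
toList-tabulate {p = suc p} f h = h zero ∷ toList-tabulate (λ i → f (suc i)) (λ i → h (suc i))

module Layout (q b : ℕ) where

  Block : Set
  Block = Vec Bool (2 ^ b)

  hiFuns : Vec (BoolFun (q + b)) q
  hiFuns = tabulate (λ i x → lookup x (i ↑ˡ b))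

  loFuns : Vec (BoolFun (q + b)) b
  loFuns = tabulate (λ i x → lookup x (q ↑ʳ i))

  hi : Vec Bool (q + b) → Vec Bool q
  hi = apply hiFuns

  lo : Vec Bool (q + b) → Vec Bool b
  lo = apply loFuns

  -- A table of blocks is a single Boolean function of ρ index bits and b position bits, so all live
  -- blocks share one Shannon expansion per table; only the index bits, of cost s each, depend on
  -- the block addressed.
  cost-combine : {ρ c s t : ℕ} → Fin (q + b) → (gs : List (BoolFun (q + b))) (Ts : Vec (Vec Bool ρ → Block) c)
    (Z : Vec Bool (q + b) → Block) (J : Vec Bool (q + b) → Vec (Vec Bool ρ) c) →
    Cost gs t (λ x → lookup (Z x) (ttIndex (lo x))) →
    (∀ l i → Cost gs s (λ x → lookup (lookup (J x) l) i)) →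
    Cost gs (c * (ρ * s + 4 * 2 ^ (ρ + b) + 1) + t) (λ x → lookup (combine (Z x) Ts (J x)) (ttIndex (lo x)))
  cost-combine {ρ} i₀ gs [] Z J cz cJ = cost-cong (λ x → cong (λ v → lookup v (ttIndex (lo x))) (unfold (Z x) (J x))) cz
    where
    unfold : ∀ (z : Block) (js : Vec (Vec Bool ρ) 0) → z ≡ combine z [] js
    unfold z [] = refl
  cost-combine {ρ} {suc c} {s} {t} i₀ gs (T ∷ Ts) Z J cz cJ =
    cost-≤ (≤-reflexive (lem c (ρ * s) (4 * 2 ^ (ρ + b)) t))
      (cost-cong (λ x → cong (λ v → lookup v (ttIndex (lo x))) (unfold (Z x) (J x)))
        (cost-combine i₀ gs Ts Z′ (λ x → tail (J x)) cz′ (λ l i → cost-cong (λ x → cong (λ v → lookup v i) (lookup-tail (J x) l)) (cJ (suc l) i))))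
    where
    lem : ∀ c u v t → c * (u + v + 1) + (1 + (t + (u + v))) ≡ (1 + c) * (u + v + 1) + t
    lem = solve-∀
    unfold : ∀ z js → combine (z ⊕ T (head js)) Ts (tail js) ≡ combine z (T ∷ Ts) js
    unfold z (j ∷ js) = refl
    lookup-tail : ∀ {A : Set} {n} (v : Vec A (suc n)) l → lookup v (suc l) ≡ lookup (tail v) l
    lookup-tail (x ∷ v) l = refl
    Z′ : Vec Bool (q + b) → Block
    Z′ x = Z x ⊕ T (head (J x))
    bits : Vec (BoolFun (q + b)) ρ
    bits = tabulate (λ i x → lookup (head (J x)) i)
    head-bit : ∀ {A : Set} {n} (v : Vec A (suc n)) → lookup v zero ≡ head v
    head-bit (x ∷ v) = refl
    table : Vec Bool (ρ + b) → Bool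
    table v = lookup (T (Vec.take ρ v)) (ttIndex (Vec.drop ρ v))
    c-table : Cost gs (ρ * s + 4 * 2 ^ (ρ + b)) (λ x → lookup (T (head (J x))) (ttIndex (lo x)))
    c-table = cost-cong correct (cost-≤ (≤-reflexive (cong (λ l → l * s + 4 * 2 ^ (ρ + b)) (length-toList bits)))
      (cost-lets (toList-tabulate _ (λ i → cost-cong (λ x → cong (λ v → lookup v i) (head-bit (J x))) (cJ zero i)))
        (cost-table _ i₀ (bits Vec.++ loFuns) (allCost-++ (allCost-∈ bits ∈-++⁺ˡ) (allCost-inputs _ (q ↑ʳ_))) table)))
      where
      correct : ∀ x → table (apply (bits Vec.++ loFuns) x) ≡ lookup (T (head (J x))) (ttIndex (lo x))
      correct x rewrite apply-++ bits loFuns x | take-++ (apply bits x) (lo x) | drop-++ (apply bits x) (lo x)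
        | apply-tabulate (λ i x → lookup (head (J x)) i) x | tabulate∘lookup (head (J x)) = refl
    cz′ : Cost gs (1 + (t + (ρ * s + 4 * 2 ^ (ρ + b)))) (λ x → lookup (Z′ x) (ttIndex (lo x)))
    cz′ = cost-cong (λ x → sym (lookup-zipWith _xor_ (ttIndex (lo x)) (Z x) (T (head (J x))))) (cost-gate _xor_ cz c-table)

  hi-++ : (u : Vec Bool q) (v : Vec Bool b) → hi (u Vec.++ v) ≡ u
  hi-++ u v = trans (apply-tabulate (λ i x → lookup x (i ↑ˡ b)) (u Vec.++ v)) (trans (tabulate-cong (lookup-++ˡ u v)) (tabulate∘lookup u))

  lo-++ : (u : Vec Bool q) (v : Vec Bool b) → lo (u Vec.++ v) ≡ v
  lo-++ u v = trans (apply-tabulate (λ i x → lookup x (q ↑ʳ i)) (u Vec.++ v)) (trans (tabulate-cong (lookup-++ʳ u v)) (tabulate∘lookup v))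

  zeros : Block
  zeros = Vec.replicate _ false

  combineAt : {ρ c : ℕ} → Vec (Vec Bool ρ → Block) c → List (Vec Bool q × Vec (Vec Bool ρ) c) → List (Vec Bool q × Block)
  combineAt Ts = map (λ e → proj₁ e , combine zeros Ts (proj₂ e))

  cost-blocks : {ρ c : ℕ} → Fin (q + b) → (Ts : Vec (Vec Bool ρ → Block) c) (es : List (Vec Bool q × Vec (Vec Bool ρ) c)) →
    let s = length es * (2 + q) + 1 in
    Cost [] (suc (s + (c * (ρ * s + 4 * 2 ^ (ρ + b) + 1) + 1)))
      (λ x → lookup (assoc zeros (combineAt Ts es) (hi x)) (ttIndex (lo x)))
  cost-blocks {ρ} {c} i₀ Ts es = cost-cong (λ x → correct (hi x) (ttIndex (lo x)) es)
    (cost-gate _∧_ live-cost (cost-combine i₀ [] Ts (λ _ → zeros) (λ x → assoc js₀ es (hi x))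
      (cost-cong (λ x → sym (lookup-replicate (ttIndex (lo x)) false)) (cost-const [] i₀ false))
      (λ l i → cost-assoc js₀ [] i₀ (λ js → lookup (lookup js l) i) es hiFuns (allCost-inputs [] _))))
    where
    js₀ : Vec (Vec Bool ρ) c
    js₀ = Vec.replicate c (Vec.replicate ρ false)
    -- Outside the listed blocks the default tuple `js₀` still selects some sum of table entries;
    -- the mask `live` forces it to zero.
    live : List (Vec Bool q × Vec (Vec Bool ρ) c) → List (Vec Bool q × Bool)
    live = map (λ e → proj₁ e , true)
    live-cost : Cost [] (length es * (2 + q) + 1) (λ x → assoc false (live es) (hi x))
    live-cost = cost-≤ (≤-reflexive (cong (λ l → l * (2 + q) + 1) (length-map _ es)))
      (cost-assoc false [] i₀ (λ d → d) (live es) hiFuns (allCost-inputs [] _))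
    correct : ∀ u pos es → assoc false (live es) u ∧ lookup (combine zeros Ts (assoc js₀ es u)) pos ≡ lookup (assoc zeros (combineAt Ts es) u) pos
    correct u pos []             = sym (lookup-replicate pos false)
    correct u pos ((v , js) ∷ es) with eqᵛ v u
    ... | true  = refl
    ... | false = correct u pos es

  computable : {s : ℕ} {g : BoolFun (q + b)} → Cost [] s g → Σ ℕ λ k → Σ (Circuit (q + b) k) λ c → k ≤ s × CircuitComputes c g
  computable cost with cost inputs []
  ... | k , c , k≤ , _ , comp = k , c , ≤-trans k≤ (≤-reflexive (+-identityʳ _)) , comp

-- Counting circuits

∈-concatMap : {f : A → List B} {xs : List A} {x : A} {y : B} → x ∈ xs → y ∈ f x → y ∈ concatMap f xs
∈-concatMap {f = f} x∈ y∈ = ∈-concatMap⁺ f (mapAny (λ { refl → y∈ }) x∈)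

length-concatMap : (xs : List A) (f : A → List B) → length (concatMap f xs) ≡ ∑ xs (λ x → length (f x))
length-concatMap xs f = trans (length≡∑ (concatMap f xs)) (trans (∑-concatMap xs f (λ _ → 1)) (∑-cong xs (λ x → sym (length≡∑ (f x)))))

allBools : List Bool
allBools = false ∷ true ∷ []

∈-allBools : ∀ b → b ∈ allBools
∈-allBools false = here refl
∈-allBools true  = there (here refl)

fromTable : Bool × Bool × Bool × Bool → Bool → Bool → Bool
fromTable (a , b , c , d) x y = if x then (if y then a else b) else (if y then c else d)

toTable : (Bool → Bool → Bool) → Bool × Bool × Bool × Bool
toTable f = f true true , f true false , f false true , f false false

fromTable-toTable : ∀ f x y → fromTable (toTable f) x y ≡ f x y
fromTable-toTable f true  true  = refl
fromTable-toTable f true  false = refl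
fromTable-toTable f false true  = refl
fromTable-toTable f false false = refl

gateTables : List (Bool × Bool × Bool × Bool)
gateTables = cartesianProduct allBools (cartesianProduct allBools (cartesianProduct allBools allBools))

∈-gateTables : ∀ T → T ∈ gateTables
∈-gateTables (a , b , c , d) = ∈-cartesianProduct⁺ (∈-allBools a) (∈-cartesianProduct⁺ (∈-allBools b) (∈-cartesianProduct⁺ (∈-allBools c) (∈-allBools d)))

circuits : ∀ m k → List (Circuit m k)
circuits m zero    = inputs ∷ []
circuits m (suc k) = map (λ (c , T , i , j) → gate c (fromTable T) i j)
  (cartesianProduct (circuits m k) (cartesianProduct gateTables (cartesianProduct (allFin (k + m)) (allFin (k + m)))))

-- A gate carries a function, which its table determines only pointwise; completeness therefore
-- concerns evaluation and not equality of circuits.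
circuits-complete : ∀ {m k} (c : Circuit m k) → ∃ λ c′ → c′ ∈ circuits m k × (∀ x → evalNodes c x ≡ evalNodes c′ x)
circuits-complete inputs         = inputs , here refl , λ x → refl
circuits-complete (gate c f i j) with circuits-complete c
... | c′ , c′∈ , eq = gate c′ (fromTable (toTable f)) i j ,
  ∈-map⁺ _ (∈-cartesianProduct⁺ c′∈ (∈-cartesianProduct⁺ (∈-gateTables (toTable f)) (∈-cartesianProduct⁺ (∈-allFin i) (∈-allFin j)))) ,
  λ x → cong₂ _∷_ (trans (cong₂ (λ v w → f (lookup v i) (lookup w j)) (eq x) (eq x)) (sym (fromTable-toTable f _ _))) (eq x)

length-circuits : ∀ m k K → k ≤ K → length (circuits m k) ≤ (16 * ((K + m) * (K + m))) ^ k
length-circuits m zero    K _   = ≤-refl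
length-circuits m (suc k) K k<K = begin
  length (circuits m (suc k))                         ≡⟨ trans (length-map (λ (c , T , i , j) → gate c (fromTable T) i j) (cartesianProduct (circuits m k) choices))
                                                          (trans (length-cartesianProduct (circuits m k) choices) (cong (length (circuits m k) *_)
                                                          (trans (length-cartesianProduct gateTables (cartesianProduct (allFin (k + m)) (allFin (k + m)))) (cong (16 *_)
                                                          (trans (length-cartesianProduct (allFin (k + m)) (allFin (k + m)))
                                                            (cong (λ t → t * t) (length-tabulate {n = k + m} (λ i → i)))))))) ⟩
  length (circuits m k) * (16 * ((k + m) * (k + m)))  ≤⟨ *-mono-≤ (length-circuits m k K (<⇒≤ k<K)) (*-monoʳ-≤ 16 (*-mono-≤ k≤ k≤)) ⟩
  (16 * ((K + m) * (K + m))) ^ k * (16 * ((K + m) * (K + m))) ≡⟨ *-comm ((16 * ((K + m) * (K + m))) ^ k) _ ⟩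
  (16 * ((K + m) * (K + m))) ^ suc k                  ∎
  where
  open ≤-Reasoning
  choices = cartesianProduct gateTables (cartesianProduct (allFin (k + m)) (allFin (k + m)))
  k≤ : k + m ≤ K + m
  k≤ = +-monoˡ-≤ m (<⇒≤ k<K)

functionsOfSize : ∀ m k → List (BoolFun m)
functionsOfSize m k = map (λ (c , o) x → lookup (evalNodes c x) o) (cartesianProduct (circuits m k) (allFin (k + m)))

functions : ∀ m K → List (BoolFun m)
functions m K = concatMap (functionsOfSize m) (downFrom (suc K))

functions-complete : ∀ {m k K} → k ≤ K → (c : Circuit m k) {g : BoolFun m} → CircuitComputes c g →
  ∃ λ h → h ∈ functions m K × (∀ x → h x ≡ g x)
functions-complete {m} {k} {K} k≤K c (o , comp) with circuits-complete c
... | c′ , c′∈ , eq = (λ x → lookup (evalNodes c′ x) o) ,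
  ∈-concatMap {f = functionsOfSize m} (∈-downFrom⁺ (s≤s k≤K)) (∈-map⁺ _ (∈-cartesianProduct⁺ c′∈ (∈-allFin o))) ,
  λ x → trans (cong (λ v → lookup v o) (sym (eq x))) (comp x)

length-functions : ∀ m K → 1 ≤ m → length (functions m K) ≤ suc K * ((16 * ((K + m) * (K + m))) ^ K * (K + m))
length-functions m K 1≤m = begin
  length (functions m K)                              ≡⟨ length-concatMap (downFrom (suc K)) (functionsOfSize m) ⟩
  ∑ (downFrom (suc K)) (λ k → length (functionsOfSize m k)) ≤⟨ ∑-mono-∈ (downFrom (suc K)) (λ k∈ → bound (≤-pred (∈-downFrom⁻ k∈))) ⟩
  ∑ (downFrom (suc K)) (λ _ → (16 * ((K + m) * (K + m))) ^ K * (K + m)) ≡⟨ trans (∑-const (downFrom (suc K)) _) (cong (_* ((16 * ((K + m) * (K + m))) ^ K * (K + m))) (length-downFrom (suc K))) ⟩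
  suc K * ((16 * ((K + m) * (K + m))) ^ K * (K + m))  ∎
  where
  open ≤-Reasoning
  1≤K+m : 1 ≤ K + m
  1≤K+m = ≤-trans 1≤m (m≤n+m m K)
  bound : ∀ {k} → k ≤ K → length (functionsOfSize m k) ≤ (16 * ((K + m) * (K + m))) ^ K * (K + m)
  bound {k} k≤K = begin
    length (functionsOfSize m k)              ≡⟨ trans (length-map (λ (c , o) x → lookup (evalNodes c x) o) (cartesianProduct (circuits m k) (allFin (k + m))))
                                                  (trans (length-cartesianProduct (circuits m k) (allFin (k + m))) (cong (length (circuits m k) *_) (length-tabulate {n = k + m} (λ i → i)))) ⟩
    length (circuits m k) * (k + m)           ≤⟨ *-mono-≤ (length-circuits m k K k≤K) (+-monoˡ-≤ m k≤K) ⟩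
    (16 * ((K + m) * (K + m))) ^ k * (K + m)  ≤⟨ *-monoˡ-≤ (K + m) (^-monoʳ-≤ (16 * ((K + m) * (K + m))) {{>-nonZero (*-mono-≤ {1} {16} (s≤s z≤n) (*-mono-≤ 1≤K+m 1≤K+m))}} k≤K) ⟩
    (16 * ((K + m) * (K + m))) ^ K * (K + m)  ∎

-- The hybrid argument

allVecs : ∀ n → List (Vec Bool n)
allVecs zero    = [] ∷ []
allVecs (suc n) = map (false ∷_) (allVecs n) ++ map (true ∷_) (allVecs n)

length-allVecs : ∀ n → length (allVecs n) ≡ 2 ^ n
length-allVecs zero    = refl
length-allVecs (suc n) = trans (length-++ (map (false ∷_) (allVecs n)))
  (trans (cong₂ _+_ (trans (length-map _ (allVecs n)) (length-allVecs n)) (trans (length-map _ (allVecs n)) (length-allVecs n)))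
    (cong (2 ^ n +_) (sym (+-identityʳ (2 ^ n)))))

∈-allVecs : (v : Vec Bool n) → v ∈ allVecs n
∈-allVecs []          = here refl
∈-allVecs (false ∷ v) = ∈-++⁺ˡ (∈-map⁺ (false ∷_) (∈-allVecs v))
∈-allVecs (true ∷ v)  = ∈-++⁺ʳ _ (∈-map⁺ (true ∷_) (∈-allVecs v))

allVecs-unique : ∀ n → Unique (allVecs n)
allVecs-unique zero    = [] ∷ []
allVecs-unique (suc n) = Unique-++⁺ (Unique-map⁺ ∷-injectiveʳ (allVecs-unique n)) (Unique-map⁺ ∷-injectiveʳ (allVecs-unique n)) disjoint
  where
  disjoint : ∀ {v} → ¬ (v ∈ map (false ∷_) (allVecs n) × v ∈ map (true ∷_) (allVecs n))
  disjoint (p , q) with ∈-map⁻ _ p | ∈-map⁻ _ q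
  ... | _ , _ , refl | _ , _ , ()

∑-allVecs-suc : ∀ n (f : Vec Bool (suc n) → ℕ) →
  ∑ (allVecs (suc n)) f ≡ ∑ (allVecs n) (λ v → f (false ∷ v)) + ∑ (allVecs n) (λ v → f (true ∷ v))
∑-allVecs-suc n f = trans (∑-++ (map (false ∷_) (allVecs n)) _ f) (cong₂ _+_ (∑-map (allVecs n) _ f) (∑-map (allVecs n) _ f))

∑-eqᵛ : (v : Vec Bool n) → ∑ (allVecs n) (λ u → ⟦ eqᵛ u v ⟧) ≡ 1
∑-eqᵛ []                  = refl
∑-eqᵛ {suc n} (false ∷ v) = trans (∑-allVecs-suc n _) (cong₂ _+_ (∑-eqᵛ v) (∑-zero (allVecs n)))
∑-eqᵛ {suc n} (true ∷ v)  = trans (∑-allVecs-suc n _) (cong₂ _+_ (∑-zero (allVecs n)) (∑-eqᵛ v))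

∑-⊕ˡ : (s : Vec Bool n) (g : Vec Bool n → ℕ) → ∑ (allVecs n) (λ a → g (s ⊕ a)) ≡ ∑ (allVecs n) g
∑-⊕ˡ []                  g = refl
∑-⊕ˡ {suc n} (false ∷ s) g = trans (∑-allVecs-suc n _) (trans (cong₂ _+_ (∑-⊕ˡ s _) (∑-⊕ˡ s _)) (sym (∑-allVecs-suc n g)))
∑-⊕ˡ {suc n} (true ∷ s)  g = trans (∑-allVecs-suc n _)
  (trans (cong₂ _+_ (∑-⊕ˡ s (λ v → g (true ∷ v))) (∑-⊕ˡ s (λ v → g (false ∷ v)))) (trans (+-comm (∑ (allVecs n) _) _) (sym (∑-allVecs-suc n g))))

∑-⊕ʳ : (s : Vec Bool n) (g : Vec Bool n → ℕ) → ∑ (allVecs n) (λ a → g (a ⊕ s)) ≡ ∑ (allVecs n) g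
∑-⊕ʳ s g = trans (∑-cong (allVecs _) (λ a → cong g (zipWith-comm xor-comm a s))) (∑-⊕ˡ s g)

length-filterᵇ : (f : A → Bool) (xs : List A) → length (filterᵇ f xs) ≡ count f xs
length-filterᵇ f []       = refl
length-filterᵇ f (x ∷ xs) with f x
... | true  = cong suc (length-filterᵇ f xs)
... | false = length-filterᵇ f xs

∈-filterᵇ : (f : A → Bool) {x : A} {xs : List A} → x ∈ xs → f x ≡ true → x ∈ filterᵇ f xs
∈-filterᵇ f {xs = y ∷ ys} (here refl) fx with f y
... | true = here refl
∈-filterᵇ f {xs = y ∷ ys} (there x∈)  fx with f y
... | true  = there (∈-filterᵇ f x∈ fx)
... | false = ∈-filterᵇ f x∈ fx

eqᵛ-≢ : (u v : Vec Bool n) → u ≢ v → eqᵛ u v ≡ false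
eqᵛ-≢ u v u≢v with eqᵛ u v in eq
... | true  = ⊥-elim (u≢v (eqᵛ⇒≡ u v eq))
... | false = refl

module Hybrid {q n : ℕ} (accept : (Vec Bool q → Vec Bool n) → Bool)
  (accept-cong : ∀ {Z Z′} → (∀ v → Z v ≡ Z′ v) → accept Z ≡ accept Z′) where

  open ≤-Reasoning

  String : Set
  String = Vec Bool q → Vec Bool n

  private
    dom : List (Vec Bool n)
    dom = allVecs n
    N : ℕ
    N = length dom

  upd : String → Vec Bool q → Vec Bool n → String
  upd Z u y v = if eqᵛ u v then y else Z v

  upd-same : ∀ Z u y → upd Z u y u ≡ y
  upd-same Z u y rewrite eqᵛ-refl u = refl

  upd-other : ∀ Z {u v} y → u ≢ v → upd Z u y v ≡ Z v
  upd-other Z {u} {v} y u≢v rewrite eqᵛ-≢ u v u≢v = refl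

  upd-cong : ∀ {Z Z′} u y → (∀ v → Z v ≡ Z′ v) → ∀ v → upd Z u y v ≡ upd Z′ u y v
  upd-cong u y eq v with eqᵛ u v
  ... | true  = refl
  ... | false = eq v

  upd-comm : ∀ Z {u u′} y y′ → u ≢ u′ → ∀ v → upd (upd Z u y) u′ y′ v ≡ upd (upd Z u′ y′) u y v
  upd-comm Z {u} {u′} y y′ u≢u′ v with eqᵛ u v in eq | eqᵛ u′ v in eq′
  ... | true  | true  = ⊥-elim (u≢u′ (trans (eqᵛ⇒≡ u v eq) (sym (eqᵛ⇒≡ u′ v eq′))))
  ... | true  | false = refl
  ... | false | true  = refl
  ... | false | false = refl

  accepted : List (Vec Bool q) → String → ℕ
  accepted []       Z = ⟦ accept Z ⟧
  accepted (u ∷ us) Z = ∑ dom (λ y → accepted us (upd Z u y))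

  accepted-cong : ∀ us {Z Z′} → (∀ v → Z v ≡ Z′ v) → accepted us Z ≡ accepted us Z′
  accepted-cong []       eq = cong ⟦_⟧ (accept-cong eq)
  accepted-cong (u ∷ us) eq = ∑-cong dom (λ y → accepted-cong us (upd-cong u y eq))

  -- Every f has exactly one block y at u, so filtering fs by y partitions it, and no f accounts for
  -- two completions.
  accepted≤ : {F : Set} (table : F → String) (us : List (Vec Bool q)) → Unique us → (Z : String) (fs : List F) →
    (∀ Z′ → (∀ v → v ∉ us → Z′ v ≡ Z v) → accept Z′ ≡ true → ∃ λ f → f ∈ fs × (∀ v → table f v ≡ Z′ v)) →
    accepted us Z ≤ length fs
  accepted≤ table [] [] Z fs covered with accept Z in eq
  ... | false = z≤n
  ... | true with covered Z (λ v _ → refl) eq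
  ... | f , f∈ , _ = nonempty f∈
    where
    nonempty : ∀ {f fs} → f ∈ fs → 1 ≤ length fs
    nonempty (here _)  = s≤s z≤n
    nonempty (there _) = s≤s z≤n
  accepted≤ table (u ∷ us) (u∉ ∷ us!) Z fs covered = begin
    ∑ dom (λ y → accepted us (upd Z u y))                   ≤⟨ ∑-mono dom (λ y → ≤-trans (accepted≤ table us us! (upd Z u y) (filterᵇ (λ f → eqᵛ y (table f u)) fs) (covered′ y)) (≤-reflexive (length-filterᵇ _ fs))) ⟩
    ∑ dom (λ y → ∑ fs (λ f → ⟦ eqᵛ y (table f u) ⟧))        ≡⟨ ∑-swap dom fs _ ⟩
    ∑ fs (λ f → ∑ dom (λ y → ⟦ eqᵛ y (table f u) ⟧))        ≡⟨ ∑-cong fs (λ f → ∑-eqᵛ (table f u)) ⟩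
    ∑ fs (λ _ → 1)                                          ≡⟨ sym (length≡∑ fs) ⟩
    length fs                                               ∎
    where
    covered′ : ∀ y Z′ → (∀ v → v ∉ us → Z′ v ≡ upd Z u y v) → accept Z′ ≡ true →
      ∃ λ f → f ∈ filterᵇ (λ f → eqᵛ y (table f u)) fs × (∀ v → table f v ≡ Z′ v)
    covered′ y Z′ agree acc with covered Z′ (λ v v∉ → trans (agree v (λ v∈ → v∉ (there v∈))) (upd-other Z y (λ u≡v → v∉ (here (sym u≡v))))) acc
    ... | f , f∈ , eq = f , ∈-filterᵇ _ f∈ (trans (cong (eqᵛ y) (trans (eq u) (trans (agree u (λ u∈ → lookupAll u∉ u∈ refl)) (upd-same Z u y)))) (eqᵛ-refl y)) , eq

  module _ (H : List (Vec Bool n)) (nonempty : 1 ≤ length H) (e : ℕ) where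

    -- Acceptance over H exceeds acceptance over all blocks by at most e / `length H` in density,
    -- whatever stands elsewhere. One direction suffices, since replacements are chosen to minimise
    -- acceptance.
    Fooled : Vec Bool q → Set
    Fooled u = ∀ Z → N * ∑ H (λ h → ⟦ accept (upd Z u h) ⟧) ≤ length H * ∑ dom (λ y → ⟦ accept (upd Z u y) ⟧) + N * e

    -- The hypothesis is applied with each of the N^(`length us`) completions of the other blocks
    -- held fixed, and the errors are added; since u is not among us, the updates commute.
    fooled-accepted : ∀ {u} → Fooled u → ∀ us → All (u ≢_) us → ∀ Z →
      N * ∑ H (λ h → accepted us (upd Z u h)) ≤ length H * ∑ dom (λ y → accepted us (upd Z u y)) + N * (e * N ^ length us)
    fooled-accepted {u} fool []        []          Z = ≤-trans (fool Z) (≤-reflexive (cong (λ t → length H * ∑ dom (λ y → ⟦ accept (upd Z u y) ⟧) + N * t) (sym (*-identityʳ e))))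
    fooled-accepted {u} fool (u′ ∷ us) (u≢u′ ∷ u∉) Z = begin
      N * ∑ H (λ h → ∑ dom (λ y′ → accepted us (upd (upd Z u h) u′ y′)))   ≡⟨ cong (N *_) (exchange H) ⟩
      N * ∑ dom (λ y′ → ∑ H (λ h → accepted us (upd (upd Z u′ y′) u h)))   ≡⟨ sym (∑-*ˡ dom N _) ⟩
      ∑ dom (λ y′ → N * ∑ H (λ h → accepted us (upd (upd Z u′ y′) u h)))   ≤⟨ ∑-mono dom (λ y′ → fooled-accepted fool us u∉ (upd Z u′ y′)) ⟩
      ∑ dom (λ y′ → length H * ∑ dom (λ y → accepted us (upd (upd Z u′ y′) u y)) + N * (e * N ^ length us))
        ≡⟨ trans (∑-+ dom _ _) (cong₂ _+_ (trans (∑-*ˡ dom (length H) _) (cong (length H *_) (sym (exchange dom)))) (∑-const dom _)) ⟩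
      length H * ∑ dom (λ y → ∑ dom (λ y′ → accepted us (upd (upd Z u y) u′ y′))) + N * (N * (e * N ^ length us))
        ≡⟨ cong (λ t → length H * ∑ dom (λ y → accepted (u′ ∷ us) (upd Z u y)) + N * t) (lem N e (N ^ length us)) ⟩
      length H * ∑ dom (λ y → accepted (u′ ∷ us) (upd Z u y)) + N * (e * N ^ suc (length us)) ∎
      where
      lem : ∀ a b c → a * (b * c) ≡ b * (a * c)
      lem = solve-∀
      exchange : ∀ xs → ∑ xs (λ h → ∑ dom (λ y′ → accepted us (upd (upd Z u h) u′ y′)))
                      ≡ ∑ dom (λ y′ → ∑ xs (λ h → accepted us (upd (upd Z u′ y′) u h)))
      exchange xs = trans (∑-swap xs dom _) (∑-cong dom (λ y′ → ∑-cong xs (λ h → accepted-cong us (upd-comm Z h y′ u≢u′))))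

    module _ {D : Set} (block : D → Vec Bool n) (preimage : ∀ {h} → h ∈ H → ∃ λ d → block d ≡ h) where

      blocks : List (Vec Bool q × D) → List (Vec Bool q × Vec Bool n)
      blocks = map (λ e → proj₁ e , block (proj₂ e))

      -- Each block is replaced by the element of H that leaves the fewest accepted completions.
      hybrid : ∀ us → Unique us → All Fooled us → ∀ Z → ∃ λ es → map proj₁ es ≡ us ×
        length H * N ^ length us * ⟦ accept (λ v → assoc (Z v) (blocks es) v) ⟧
          ≤ length H * accepted us Z + length us * (e * N ^ length us)
      hybrid []       []         []          Z = [] , refl , ≤-reflexive (lem (length H) _)
        where
        lem : ∀ h x → h * 1 * x ≡ h * x + 0
        lem = solve-∀
      hybrid (u ∷ us) (u∉ ∷ us!) (fool ∷ fools) Z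
        with ∃-≤-mean H nonempty (λ h → accepted us (upd Z u h))
      ... | h , h∈ , best with preimage h∈
      ... | d , refl with hybrid us us! fools (upd Z u (block d))
      ... | es , keys , bound = (u , d) ∷ es , cong (u ∷_) keys , (begin
        M * (N * P) * ⟦ accept (λ v → assoc (Z v) (blocks ((u , d) ∷ es)) v) ⟧   ≡⟨ cong (λ b → M * (N * P) * ⟦ b ⟧) (accept-cong (λ v → sym (same-string v))) ⟩
        M * (N * P) * ⟦ accept (λ v → assoc (upd Z u (block d) v) (blocks es) v) ⟧ ≡⟨ lem₁ M N P _ ⟩
        N * (M * P * ⟦ accept (λ v → assoc (upd Z u (block d) v) (blocks es) v) ⟧) ≤⟨ *-monoʳ-≤ N bound ⟩
        N * (M * accepted us (upd Z u (block d)) + length us * (e * P))            ≤⟨ *-monoʳ-≤ N (+-monoˡ-≤ (length us * (e * P)) best) ⟩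
        N * (∑ H (λ h → accepted us (upd Z u h)) + length us * (e * P))            ≡⟨ *-distribˡ-+ N (∑ H (λ h → accepted us (upd Z u h))) _ ⟩
        N * ∑ H (λ h → accepted us (upd Z u h)) + N * (length us * (e * P))        ≤⟨ +-monoˡ-≤ (N * (length us * (e * P))) (fooled-accepted fool us u∉ Z) ⟩
        M * accepted (u ∷ us) Z + N * (e * P) + N * (length us * (e * P))          ≡⟨ lem₂ (M * accepted (u ∷ us) Z) N e P (length us) ⟩
        M * accepted (u ∷ us) Z + suc (length us) * (e * (N * P))                  ∎)
        where
        M = length H
        P = N ^ length us
        lem₁ : ∀ m n p x → m * (n * p) * x ≡ n * (m * p * x)
        lem₁ = solve-∀
        lem₂ : ∀ a n e p l → a + n * (e * p) + n * (l * (e * p)) ≡ a + (1 + l) * (e * (n * p))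
        lem₂ = solve-∀
        -- The key u does not recur in es, so its lookup falls through to the default, where the
        -- update has already placed the chosen block.
        assoc-∉ : ∀ es {y} → u ∉ map proj₁ es → assoc y (blocks es) u ≡ y
        assoc-∉ []              _  = refl
        assoc-∉ ((v , _) ∷ es) u∉ rewrite eqᵛ-≢ v u (λ v≡u → u∉ (here (sym v≡u))) = assoc-∉ es (λ u∈ → u∉ (there u∈))
        same-string : ∀ v → assoc (upd Z u (block d) v) (blocks es) v ≡ assoc (Z v) (blocks ((u , d) ∷ es)) v
        same-string v with eqᵛ u v in eq
        ... | false = refl
        ... | true with refl ← eqᵛ⇒≡ u v eq = assoc-∉ es (λ u∈ → lookupAll u∉ (subst (u ∈_) keys u∈) refl)

-- Light blocks and indexed tables

markov : (f : A → ℕ) (b : ℕ) (xs : List A) → b * length xs ≤ b * length (filter (λ x → f x ≤? b) xs) + ∑ xs f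
markov f b []       = ≤-reflexive (sym (+-identityʳ (b * 0)))
markov f b (x ∷ xs) with f x ≤? b
... | yes f≤b = begin
  b * suc (length xs)          ≡⟨ *-suc b (length xs) ⟩
  b + b * length xs            ≤⟨ +-monoʳ-≤ b (markov f b xs) ⟩
  b + (b * g + ∑ xs f)         ≤⟨ ≤-trans (+-monoʳ-≤ b (+-monoʳ-≤ (b * g) (m≤n+m (∑ xs f) (f x)))) (≤-reflexive (lem b g (f x + ∑ xs f))) ⟩
  b * suc g + (f x + ∑ xs f)   ≡⟨ cong (λ l → b * length l + (f x + ∑ xs f)) (sym (filter-accept (λ x → f x ≤? b) {xs = xs} f≤b)) ⟩
  b * length (filter (λ x → f x ≤? b) (x ∷ xs)) + (f x + ∑ xs f) ∎
  where
  open ≤-Reasoning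
  g = length (filter (λ x → f x ≤? b) xs)
  lem : ∀ b g r → b + (b * g + r) ≡ b * (1 + g) + r
  lem = solve-∀
... | no f≰b = begin
  b * suc (length xs)          ≡⟨ *-suc b (length xs) ⟩
  b + b * length xs            ≤⟨ +-mono-≤ (<⇒≤ (≰⇒> f≰b)) (markov f b xs) ⟩
  f x + (b * g + ∑ xs f)       ≡⟨ lem (f x) (b * g) (∑ xs f) ⟩
  b * g + (f x + ∑ xs f)       ≡⟨ cong (λ l → b * length l + (f x + ∑ xs f)) (sym (filter-reject (λ x → f x ≤? b) {xs = xs} f≰b)) ⟩
  b * length (filter (λ x → f x ≤? b) (x ∷ xs)) + (f x + ∑ xs f) ∎
  where
  open ≤-Reasoning
  g = length (filter (λ x → f x ≤? b) xs)
  lem : ∀ x y z → x + (y + z) ≡ y + (x + z)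
  lem = solve-∀

length-filter-≟true : (f : A → Bool) (xs : List A) → length (filter (λ x → f x ≟ᵇ true) xs) ≡ count f xs
length-filter-≟true f []       = refl
length-filter-≟true f (x ∷ xs) with f x
... | true  = cong suc (length-filter-≟true f xs)
... | false = length-filter-≟true f xs

enumerate : ∀ ρ (xs : List A) → length xs ≡ 2 ^ ρ → ∃ λ (T : Vec Bool ρ → A) → ∀ {a} → a ∈ xs → ∃ λ j → T j ≡ a
enumerate ρ xs eq = (λ j → List.lookup xs (subst Fin (sym eq) (ttIndex j))) , λ a∈ → unindex ρ (subst Fin eq (index a∈)) ,
  trans (cong (λ i → List.lookup xs (subst Fin (sym eq) i)) (ttIndex-unindex ρ _))
    (trans (cong (List.lookup xs) (subst-sym-subst eq)) (sym (lookup-index a∈)))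

enumerate-sums : ∀ {n} ρ (Ts : List (List (Vec Bool n))) → All (λ T → length T ≡ 2 ^ ρ) Ts →
  ∃ λ (V : Vec (Vec Bool ρ → Vec Bool n) (length Ts)) → ∀ z {h} → h ∈ sums _⊕_ Ts z → ∃ λ js → combine z V js ≡ h
enumerate-sums ρ []       []         = [] , λ { z (here eq) → [] , sym eq }
enumerate-sums ρ (T ∷ Ts) (eq ∷ eqs) with enumerate ρ T eq | enumerate-sums ρ Ts eqs
... | t , t-onto | V , V-onto = t ∷ V , onto
  where
  onto : ∀ z {h} → h ∈ sums _⊕_ (T ∷ Ts) z → ∃ λ js → combine z (t ∷ V) js ≡ h
  onto z h∈ with find (∈-concatMap⁻ (λ a → sums _⊕_ Ts (z ⊕ a)) {xs = T} h∈)
  ... | a , a∈ , h∈′ with t-onto a∈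
  ... | j , refl with V-onto (z ⊕ t j) h∈′
  ... | js , eq′ = j ∷ js , eq′

-- The contradiction for fixed parameters

familyBound : ℕ → ℕ
familyBound B = 2 * (1 + suc (B * B) ^ (B * B) * B)

familyBound-mono : ∀ {B B′} → B ≤ B′ → familyBound B ≤ familyBound B′
familyBound-mono {B} {B′} B≤ = *-monoʳ-≤ 2 (+-monoʳ-≤ 1 (*-mono-≤
  (≤-trans (^-monoˡ-≤ (B * B) (s≤s (*-mono-≤ B≤ B≤))) (^-monoʳ-≤ (suc (B′ * B′)) (*-mono-≤ B≤ B≤))) B≤))

circuitCost : (q b ρ c t : ℕ) → ℕ
circuitCost q b ρ c t = suc (cost + (c * (ρ * cost + 4 * 2 ^ (ρ + b) + 1) + 1))
  where
  cost = t * (2 + q) + 1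

-- `Kmin` and `Kmax` enclose n^α, which need not be a power of two: `easy` and `hard` are the two
-- directions of correctness, weakened accordingly. By `few-gates` fewer than w blocks carry more
-- than B touched wires.
module Core (q b ρ c t w Q r S B Kmin Kmax : ℕ) (C : Comparator (2 ^ (q + b))) (i₀ : Fin (q + b))
  (easy : ∀ a → (∃ λ k → k ≤ Kmin × Σ (Circuit (q + b) k) λ D → CircuitComputes D (ttFunction a)) → evalComparator C a ≡ true)
  (hard : ∀ a → evalComparator C a ≡ true → ∃ λ k → k ≤ Kmax × Σ (Circuit (q + b) k) λ D → CircuitComputes D (ttFunction a))
  (many-blocks : t + w ≤ 2 ^ q) (few-gates : 1 + 2 * size C < B * w)
  (Qr : Q * r ≡ 2 ^ ρ) (1≤Q : 1 ≤ Q) (1≤r : 1 ≤ r) (r-large : 4 * (Q * Q) * S ≤ r)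
  (small-family : t * familyBound B * (2 ^ (2 ^ b) * (2 * (4 * r) ^ c)) < 2 ^ S)
  (few-functions : 2 * (suc Kmax * ((16 * ((Kmax + (q + b)) * (Kmax + (q + b)))) ^ Kmax * (Kmax + (q + b)))) < (2 ^ (2 ^ b)) ^ t)
  (small-error : 2 * (t * (4 * r) ^ c) ≤ (Q * r) ^ c)
  (enough : circuitCost q b ρ c t ≤ Kmin)
  where

  open Layout q b
  open ≤-Reasoning

  private
    dom : List Block
    dom = allVecs (2 ^ b)
    N : ℕ
    N = length dom
    N≡ : N ≡ 2 ^ (2 ^ b)
    N≡ = length-allVecs (2 ^ b)
    1≤N : 1 ≤ N
    1≤N = ≤-trans (m^n>0 2 (2 ^ b)) (≤-reflexive (sym N≡))
    instance
      N≢0 : NonZero N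
      N≢0 = >-nonZero 1≤N

  blockOf : Fin (2 ^ (q + b)) → Vec Bool q
  blockOf i = hi (unindex (q + b) i)

  string : (Vec Bool q → Block) → Fin (2 ^ (q + b)) → Bool
  string Z i = lookup (Z (blockOf i)) (ttIndex (lo (unindex (q + b) i)))

  accept : (Vec Bool q → Block) → Bool
  accept Z = evalComparator C (string Z)

  accept-cong : ∀ {Z Z′} → (∀ v → Z v ≡ Z′ v) → accept Z ≡ accept Z′
  accept-cong eq = evalComparator-cong C (λ i → cong (λ y → lookup y (ttIndex (lo (unindex (q + b) i)))) (eq (blockOf i)))

  open Hybrid accept accept-cong hiding (String)

  live : Vec Bool q → Fin (2 ^ (q + b)) → Bool
  live u i = eqᵛ u (blockOf i)

  load : Vec Bool q → ℕ
  load u = length (active C (live u))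

  -- Each touched wire reads one position and so belongs to exactly one block.
  total-load : ∑ (allVecs q) load ≡ length (touched C)
  total-load = begin-equality
    ∑ (allVecs q) load                                                         ≡⟨ ∑-cong (allVecs q) (λ u → length-filter-≟true (λ c → live u (proj₁ (label C c))) (touched C)) ⟩
    ∑ (allVecs q) (λ u → count (λ c → live u (proj₁ (label C c))) (touched C)) ≡⟨ ∑-swap (allVecs q) (touched C) _ ⟩
    ∑ (touched C) (λ c → ∑ (allVecs q) (λ u → ⟦ eqᵛ u (blockOf (proj₁ (label C c))) ⟧)) ≡⟨ ∑-cong (touched C) (λ c → ∑-eqᵛ (blockOf (proj₁ (label C c)))) ⟩
    ∑ (touched C) (λ _ → 1)                                                    ≡⟨ sym (length≡∑ (touched C)) ⟩
    length (touched C)                                                         ∎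

  private
    light : List (Vec Bool q)
    light = filter (λ u → load u ≤? B) (allVecs q)

    many-light : t ≤ length light
    many-light = <⇒≤ (*-cancelˡ-< B t (length light) (+-cancelʳ-< (B * w) _ _ (begin-strict
      B * t + B * w                              ≡⟨ sym (*-distribˡ-+ B t w) ⟩
      B * (t + w)                                ≤⟨ *-monoʳ-≤ B (≤-trans many-blocks (≤-reflexive (sym (length-allVecs q)))) ⟩
      B * length (allVecs q)                     ≤⟨ markov load B (allVecs q) ⟩
      B * length light + ∑ (allVecs q) load      ≡⟨ cong (B * length light +_) total-load ⟩
      B * length light + length (touched C)      <⟨ +-monoʳ-< (B * length light) (≤-<-trans (length-touched C) few-gates) ⟩
      B * length light + B * w                   ∎)))

    us : List (Vec Bool q)
    us = take t light

    length-us : length us ≡ t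
    length-us = trans (length-take t light) (m≤n⇒m⊓n≡m many-light)

    us! : Unique us
    us! = Unique-take⁺ t (filter⁺ (λ u → load u ≤? B) (allVecs-unique q))

    us-light : All (λ u → load u ≤ B) us
    us-light = All-take⁺ t (all-filter (λ u → load u ≤? B) (allVecs q))

  Z₀ : Vec Bool q → Block
  Z₀ _ = zeros

  module Sub (u : Vec Bool q) = Subfunctions C dom ∈-allVecs zeros (live u) (λ y → string (upd Z₀ u y))

  -- `Sub.Index u` mentions only the wires of `C` and is the same type for every u, so the all-zero
  -- vector serves as a representative.
  BlockIndex : Set
  BlockIndex = Vec Bool q × Sub.Index zeroVec
    where
    zeroVec : Vec Bool q
    zeroVec = Vec.replicate q false

  sub : BlockIndex → Block → Bool
  sub (u , k) = Sub.member u k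

  sub-complement : BlockIndex → BlockIndex
  sub-complement (u , k) = u , Sub.complement u k

  subs : List BlockIndex
  subs = concatMap (λ u → map (u ,_) (Sub.family u)) us

  ∈-subs : ∀ {u k} → u ∈ us → k ∈ Sub.family u → (u , k) ∈ subs
  ∈-subs {u} u∈ k∈ = ∈-concatMap {f = λ u → map (u ,_) (Sub.family u)} u∈ (∈-map⁺ (u ,_) k∈)

  sub-complement-∈ : ∀ {i} → i ∈ subs → sub-complement i ∈ subs
  sub-complement-∈ i∈ with find (∈-concatMap⁻ (λ u → map (u ,_) (Sub.family u)) {xs = us} i∈)
  ... | u , u∈ , i∈′ with ∈-map⁻ (u ,_) i∈′
  ... | k , k∈ , refl = ∈-subs u∈ (Sub.complement-∈ u k∈)

  length-subs : length subs ≤ t * familyBound B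
  length-subs = begin
    length subs                                                ≡⟨ length-concatMap us _ ⟩
    ∑ us (λ u → length (map (u ,_) (Sub.family u)))            ≤⟨ ∑-mono-∈ us (λ {u} u∈ → ≤-trans (≤-reflexive (length-map (u ,_) (Sub.family u))) (≤-trans (Sub.length-family u) (familyBound-mono (lookupAll us-light u∈)))) ⟩
    ∑ us (λ _ → familyBound B)                                 ≡⟨ ∑-const us _ ⟩
    length us * familyBound B                                  ≡⟨ cong (_* familyBound B) length-us ⟩
    t * familyBound B                                          ∎

  private
    subs-small : length subs * (N * (2 * (4 * r) ^ c)) < 2 ^ S
    subs-small = ≤-<-trans (*-mono-≤ length-subs (*-monoˡ-≤ (2 * (4 * r) ^ c) (≤-reflexive N≡))) small-family

  open Sampler dom ∈-allVecs 1≤N _⊕_ ∑-⊕ˡ ∑-⊕ʳ subs sub sub-complement sub-complement-∈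
    (λ (u , k) → Sub.member-complement u k) Q r S c 1≤Q subs-small 1≤r r-large

  -- Cutting the truth table of h into blocks recovers Z, so accepted strings inject into the
  -- functions of circuit size at most `Kmax`.
  covered : ∀ Z → accept Z ≡ true → ∃ λ h → h ∈ functions (q + b) Kmax ×
    (∀ v → tabulate (λ pos → h (v Vec.++ unindex b pos)) ≡ Z v)
  covered Z acc with hard (string Z) acc
  ... | k , k≤ , D , comp with functions-complete k≤ D comp
  ... | h , h∈ , eq = h , h∈ , λ v → trans (tabulate-cong (λ pos → trans (eq (v Vec.++ unindex b pos)) (entry v pos))) (tabulate∘lookup (Z v))
    where
    entry : ∀ v pos → string Z (ttIndex (v Vec.++ unindex b pos)) ≡ lookup (Z v) pos
    entry v pos rewrite unindex-ttIndex (v Vec.++ unindex b pos) | hi-++ v (unindex b pos) | lo-++ v (unindex b pos) | ttIndex-unindex b pos = refl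

  few-accepted : 2 * accepted us Z₀ < N ^ length us
  few-accepted = begin-strict
    2 * accepted us Z₀                      ≤⟨ *-monoʳ-≤ 2 (accepted≤ (λ h v → tabulate (λ pos → h (v Vec.++ unindex b pos))) us us! Z₀ (functions (q + b) Kmax) (λ Z _ → covered Z)) ⟩
    2 * length (functions (q + b) Kmax)     ≤⟨ *-monoʳ-≤ 2 (length-functions (q + b) Kmax (1≤ i₀)) ⟩
    2 * (suc Kmax * ((16 * ((Kmax + (q + b)) * (Kmax + (q + b)))) ^ Kmax * (Kmax + (q + b)))) <⟨ few-functions ⟩
    (2 ^ (2 ^ b)) ^ t                       ≡⟨ cong₂ _^_ (sym N≡) (sym length-us) ⟩
    N ^ length us                           ∎
    where
    1≤ : ∀ {m} → Fin m → 1 ≤ m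
    1≤ zero    = s≤s z≤n
    1≤ (suc _) = s≤s z≤n

  impossible : ⊥
  impossible with tables c ≤-refl
  ... | Ts , len-Ts , lens , approx with enumerate-sums ρ Ts (mapAll (λ eq → trans eq Qr) lens)
  ... | V , onto with hybrid H 1≤H e (combine zeros V) (onto zeros) us us! (tabulateAll fooled) Z₀
    where
    H : List Block
    H = sums _⊕_ Ts zeros
    e = (4 * r) ^ c
    length-H : length H ≡ (Q * r) ^ c
    length-H = trans (length-sums _⊕_ (Q * r) Ts lens zeros) (cong ((Q * r) ^_) len-Ts)
    1≤H : 1 ≤ length H
    1≤H = ≤-trans (>-nonZero⁻¹ ((Q * r) ^ c) {{m^n≢0 (Q * r) c {{>-nonZero (*-mono-≤ 1≤Q 1≤r)}}}}) (≤-reflexive (sym length-H))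
    fooled : ∀ {u} → u ∈ us → Fooled H 1≤H e u
    -- The family at u was built with zeros in the other blocks, yet it contains the subfunction
    -- arising from every Z.
    fooled {u} u∈ Z with Sub.subfunction-∈ u (λ y → string (upd Z u y)) agree rest
      where
      agree : ∀ y i → live u i ≡ true → string (upd Z u y) i ≡ string (upd Z₀ u y) i
      agree y i l rewrite l = refl
      rest : ∀ y y′ i → live u i ≢ true → string (upd Z u y) i ≡ string (upd Z u y′) i
      rest y y′ i ¬l with live u i
      ... | true  = ⊥-elim (¬l refl)
      ... | false = refl
    ... | k , k∈ , eq = begin
      N * ∑ H (λ h → ⟦ accept (upd Z u h) ⟧)       ≡⟨ cong (N *_) (∑-cong H (λ h → cong ⟦_⟧ (eq h))) ⟩
      N * count (sub (u , k)) H                     ≤⟨ approx (∈-subs u∈ k∈) zeros ⟩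
      (Q * r) ^ c * count (sub (u , k)) dom + N * e ≡⟨ cong₂ (λ l x → l * x + N * e) (sym length-H) (sym (∑-cong dom (λ h → cong ⟦_⟧ (eq h)))) ⟩
      length H * ∑ dom (λ y → ⟦ accept (upd Z u y) ⟧) + N * e ∎
  -- Less than half of the completions are accepted at the start, and the t replacements add at most
  -- te/M ≤ 1/2 in density. The final density is thus below 1, whereas a string with a small circuit
  -- must be accepted.
  ... | es , keys , bound = <-irrefl refl (begin-strict
    2 * (M * P)                                      ≡⟨ cong (2 *_) (sym (trans (cong (λ v → M * P * ⟦ v ⟧) accepts) (*-identityʳ (M * P)))) ⟩
    2 * (M * P * ⟦ accept Zfinal ⟧)                  ≤⟨ *-monoʳ-≤ 2 bound ⟩
    2 * (M * accepted us Z₀ + length us * (e * P))   ≡⟨ lem M (accepted us Z₀) (length us) e P ⟩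
    M * (2 * accepted us Z₀) + 2 * (length us * e) * P ≡⟨ cong (λ l → M * (2 * accepted us Z₀) + 2 * (l * e) * P) length-us ⟩
    M * (2 * accepted us Z₀) + 2 * (t * e) * P       ≤⟨ +-monoʳ-≤ (M * (2 * accepted us Z₀)) (*-monoˡ-≤ P (≤-trans small-error (≤-reflexive (sym length-H)))) ⟩
    M * (2 * accepted us Z₀) + M * P                 <⟨ +-monoˡ-< (M * P) (*-monoʳ-< M {{M≢0}} few-accepted) ⟩
    M * P + M * P                                    ≡⟨ cong (M * P +_) (sym (+-identityʳ (M * P))) ⟩
    2 * (M * P)                                      ∎)
    where
    e = (4 * r) ^ c
    M = length (sums _⊕_ Ts zeros)
    P = N ^ length us
    length-H : M ≡ (Q * r) ^ c
    length-H = trans (length-sums _⊕_ (Q * r) Ts lens zeros) (cong ((Q * r) ^_) len-Ts)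
    M≢0 : NonZero M
    M≢0 = subst NonZero (sym length-H) (m^n≢0 (Q * r) c {{>-nonZero (*-mono-≤ 1≤Q 1≤r)}})
    lem : ∀ m a l e p → 2 * (m * a + l * (e * p)) ≡ m * (2 * a) + 2 * (l * e) * p
    lem = solve-∀
    Zfinal : Vec Bool q → Block
    Zfinal v = assoc zeros (combineAt V es) v
    length-es : length es ≡ t
    length-es = trans (sym (length-map proj₁ es)) (trans (cong length keys) length-us)
    accepts : accept Zfinal ≡ true
    accepts with computable (cost-blocks i₀ V es)
    ... | k , D , k≤ , comp = easy (string Zfinal) (k ,
      ≤-trans k≤ (≤-trans (≤-reflexive (cong₂ (circuitCost q b ρ) len-Ts length-es)) enough) , D , proj₁ comp ,
      λ x → trans (proj₂ comp x) (sym (cong₂ (λ v w → lookup (Zfinal (hi v)) (ttIndex (lo w))) (unindex-ttIndex x) (unindex-ttIndex x))))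

-- Choice of parameters

suc≤2^ : ∀ n → suc n ≤ 2 ^ n
suc≤2^ zero    = ≤-refl
suc≤2^ (suc n) = begin
  1 + suc n          ≤⟨ +-mono-≤ (m^n>0 2 n) (suc≤2^ n) ⟩
  2 ^ n + 2 ^ n      ≡⟨ cong (2 ^ n +_) (sym (+-identityʳ (2 ^ n))) ⟩
  2 ^ suc n          ∎
  where open ≤-Reasoning

linear≤exponential : ∀ c → ∃ λ l₀ → ∀ l → l₀ ≤ l → c * suc l ≤ 2 ^ l
linear≤exponential c = l₀ , λ l l₀≤l → subst (λ l → c * suc l ≤ 2 ^ l) (m∸n+n≡m l₀≤l) (from-base (l ∸ l₀))
  where
  open ≤-Reasoning
  -- 2^l₀ is 2^c times 4 · 2^c: one factor dominates c, the other l₀ + 1.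
  l₀ = c + (2 + c)
  from-base : ∀ i → c * suc (i + l₀) ≤ 2 ^ (i + l₀)
  from-base zero    = begin
    c * suc (c + (2 + c))        ≤⟨ *-mono-≤ (≤-trans (n≤1+n c) (suc≤2^ c)) (≤-trans (≤-trans (m≤m+n _ (suc (c + c))) (≤-reflexive (lem c))) (*-monoʳ-≤ 4 (suc≤2^ c))) ⟩
    2 ^ c * (4 * 2 ^ c)          ≡⟨ cong (2 ^ c *_) (sym (^-distribˡ-+-* 2 2 c)) ⟩
    2 ^ c * 2 ^ (2 + c)          ≡⟨ sym (^-distribˡ-+-* 2 c (2 + c)) ⟩
    2 ^ l₀                       ∎
    where
    lem : ∀ c → 1 + (c + (2 + c)) + (1 + (c + c)) ≡ 4 * (1 + c)
    lem = solve-∀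
  from-base (suc i) = begin
    c * (2 + (i + l₀))           ≤⟨ ≤-trans (m≤m+n _ (c * (i + l₀))) (≤-reflexive (lem c (i + l₀))) ⟩
    2 * (c * suc (i + l₀))       ≤⟨ *-monoʳ-≤ 2 (from-base i) ⟩
    2 ^ suc (i + l₀)             ∎
    where
    lem : ∀ c x → c * (2 + x) + c * x ≡ 2 * (c * (1 + x))
    lem = solve-∀

^-cancelˡ-≤ : ∀ d x y .{{_ : NonZero d}} → x ^ d ≤ y ^ d → x ≤ y
^-cancelˡ-≤ d x y x^d≤y^d = ≮⇒≥ λ y<x → <⇒≱ (strict d y<x) x^d≤y^d
  where
  strict : ∀ d .{{_ : NonZero d}} → y < x → y ^ d < x ^ d
  strict (suc zero)    y<x = subst₂ _<_ (sym (*-identityʳ y)) (sym (*-identityʳ x)) y<x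
  strict (suc (suc d)) y<x = *-mono-< y<x (strict (suc d) y<x)

affine≤ : ∀ x y l → x + y * l ≤ (x + y) * suc l
affine≤ x y l = ≤-trans (m≤m+n _ (x * l + y)) (≤-reflexive (lem x y l))
  where
  lem : ∀ x y l → x + y * l + (x * l + y) ≡ (x + y) * (1 + l)
  lem = solve-∀

2^-mono : ∀ {x y} → x ≤ y → 2 ^ x ≤ 2 ^ y
2^-mono = ^-monoʳ-≤ 2

2^-* : ∀ x y {z} → x + y ≡ z → 2 ^ x * 2 ^ y ≡ 2 ^ z
2^-* x y refl = sym (^-distribˡ-+-* 2 x y)

2^2^ : ∀ x → 2 * 2 ^ x ≡ 2 ^ x + 2 ^ x
2^2^ x = cong (2 ^ x +_) (+-identityʳ (2 ^ x))

familyBound-2^ : ∀ κ → familyBound (2 ^ κ) ≤ 2 ^ (2 + κ + (1 + (κ + κ)) * 2 ^ (κ + κ))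
familyBound-2^ κ = begin
  2 * (1 + suc (2 ^ κ * 2 ^ κ) ^ (2 ^ κ * 2 ^ κ) * 2 ^ κ)  ≡⟨ cong (λ t → 2 * (1 + suc t ^ t * 2 ^ κ)) (2^-* κ κ refl) ⟩
  2 * (1 + suc L ^ L * 2 ^ κ)                              ≤⟨ *-monoʳ-≤ 2 (+-mono-≤ (m^n>0 2 (κ + (1 + (κ + κ)) * L)) inner) ⟩
  2 * (2 ^ (κ + (1 + (κ + κ)) * L) + 2 ^ (κ + (1 + (κ + κ)) * L)) ≡⟨ cong (2 *_) (sym (2^2^ (κ + (1 + (κ + κ)) * L))) ⟩
  2 ^ (2 + κ + (1 + (κ + κ)) * L)                          ∎
  where
  open ≤-Reasoning
  L = 2 ^ (κ + κ)
  inner : suc L ^ L * 2 ^ κ ≤ 2 ^ (κ + (1 + (κ + κ)) * L)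
  inner = begin
    suc L ^ L * 2 ^ κ                      ≤⟨ *-monoˡ-≤ (2 ^ κ) (^-monoˡ-≤ L (≤-trans (+-monoˡ-≤ L (m^n>0 2 (κ + κ))) (≤-reflexive (sym (2^2^ (κ + κ)))))) ⟩
    (2 ^ suc (κ + κ)) ^ L * 2 ^ κ          ≡⟨ cong (_* 2 ^ κ) (^-*-assoc 2 (suc (κ + κ)) L) ⟩
    2 ^ (suc (κ + κ) * L) * 2 ^ κ          ≡⟨ 2^-* (suc (κ + κ) * L) κ (+-comm (suc (κ + κ) * L) κ) ⟩
    2 ^ (κ + (1 + (κ + κ)) * L)            ∎

functionBound : ℕ → ℕ → ℕ
functionBound K m = 2 * (suc K * ((16 * ((K + m) * (K + m))) ^ K * (K + m)))

functionBound-2^ : ∀ K m ν → 1 ≤ m → K + m ≤ 2 ^ ν → functionBound K m ≤ 2 ^ (1 + (ν + ((4 + (ν + ν)) * K + ν)))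
functionBound-2^ K m ν 1≤m K+m≤ = *-monoʳ-≤ 2 (begin
  suc K * ((16 * ((K + m) * (K + m))) ^ K * (K + m))
    ≤⟨ *-mono-≤ (≤-trans (≤-trans (≤-reflexive (+-comm 1 K)) (+-monoʳ-≤ K 1≤m)) K+m≤)
        (*-mono-≤ (^-monoˡ-≤ K (*-monoʳ-≤ 16 (*-mono-≤ K+m≤ K+m≤))) K+m≤) ⟩
  2 ^ ν * ((16 * (2 ^ ν * 2 ^ ν)) ^ K * 2 ^ ν)
    ≡⟨ cong (λ t → 2 ^ ν * (t ^ K * 2 ^ ν)) (trans (cong (16 *_) (2^-* ν ν refl)) (2^-* 4 (ν + ν) refl)) ⟩
  2 ^ ν * ((2 ^ (4 + (ν + ν))) ^ K * 2 ^ ν)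
    ≡⟨ cong (λ t → 2 ^ ν * (t * 2 ^ ν)) (^-*-assoc 2 (4 + (ν + ν)) K) ⟩
  2 ^ ν * (2 ^ ((4 + (ν + ν)) * K) * 2 ^ ν)
    ≡⟨ cong (2 ^ ν *_) (2^-* ((4 + (ν + ν)) * K) ν refl) ⟩
  2 ^ ν * 2 ^ ((4 + (ν + ν)) * K + ν)
    ≡⟨ 2^-* ν ((4 + (ν + ν)) * K + ν) refl ⟩
  2 ^ (ν + ((4 + (ν + ν)) * K + ν)) ∎)
  where open ≤-Reasoning

-- The exponents of the construction for α = 2a/D with a = 16 + a′, D = 48 + 2a′ + d′, and ε ≥ 16/D; with
-- l = ⌊m/D⌋, all sizes below are powers of two whose exponents are multiples of l.
module Parameters (a′ d′ c D G : ℕ) (c≡ : c ≡ 32 + 2 * a′) (D≡ : D ≡ 48 + 2 * a′ + d′) (G≡ : G ≡ 48 + 3 * a′ + d′) where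

  -- Coefficients of the linear factors in l that are to be absorbed by one 2^l each: `C₁` for the
  -- family exponent `S`, `C₂` for counting functions (including 2^c from rounding m), `C₃` for the
  -- number of variables, `C₄` for the final circuit. Their sum yields a common threshold for l.
  C₁ C₂ C₃ C₄ slope : ℕ
  C₁ = (6 + c * 2) + (29 + 2 * a′ + 3 * (6 + a′) + c * (16 + 2 * a′))
  C₂ = (10 + 4 * c) * 2 ^ c
  C₃ = 3 + D
  C₄ = (3 + c * 2) + c * (17 + 2 * a′)
  slope = C₁ + C₂ + (C₃ + C₄)

  module _ (l q : ℕ) (l-large : 64 + 4 * a′ + d′ ≤ l) (exponential : slope * suc l ≤ 2 ^ l)
    (m≥ : D * l ≤ q + 4 * l) (m< : q + 4 * l < D * suc l) where

    open ≤-Reasoning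

    size′ : ℕ
    size′ = q + 4 * l

    -- Blocks have 2^(4l) bits and n^α is about 2^(cl), so t = 2^τ stays 2^(3l) below n^α while the
    -- live bits exceed it by 2^l. The load bound 2^κ is about 2^(2l) times the average: one l keeps
    -- the heavy blocks rare, one absorbs rounding. Its square makes S at most 2^((13 + 2a′)l), and
    -- r = 2^g adds 2l for Q² and one l for constants; ρ adds the l of Q.
    τ κ g ρ S : ℕ
    τ = (29 + 2 * a′) * l
    κ = (6 + a′) * l
    g = (16 + 2 * a′) * l
    ρ = (17 + 2 * a′) * l
    -- The exponent of the product bounded in `small-family`, plus one for strictness.
    S = 1 + (τ + (2 + κ + (1 + (κ + κ)) * 2 ^ (κ + κ)) + (2 ^ (4 * l) + (1 + c * (2 + g))))

    below : ∀ C → C ≤ slope → C * suc l ≤ 2 ^ l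
    below C C≤ = ≤-trans (*-monoˡ-≤ (suc l) C≤) exponential

    C₁≤ : C₁ * suc l ≤ 2 ^ l
    C₁≤ = below C₁ (≤-trans (m≤m+n C₁ C₂) (m≤m+n (C₁ + C₂) (C₃ + C₄)))
    C₂≤ : C₂ * suc l ≤ 2 ^ l
    C₂≤ = below C₂ (≤-trans (m≤n+m C₂ C₁) (m≤m+n (C₁ + C₂) (C₃ + C₄)))
    C₃≤ : C₃ * suc l ≤ 2 ^ l
    C₃≤ = below C₃ (≤-trans (m≤m+n C₃ C₄) (m≤n+m (C₃ + C₄) (C₁ + C₂)))
    C₄≤ : C₄ * suc l ≤ 2 ^ l
    C₄≤ = below C₄ (≤-trans (m≤n+m C₄ C₃) (m≤n+m (C₃ + C₄) (C₁ + C₂)))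

    1≤l : 1 ≤ l
    1≤l = ≤-trans (s≤s z≤n) l-large

    q≥ : (44 + 2 * a′ + d′) * l ≤ q
    q≥ = +-cancelʳ-≤ (4 * l) _ _ (≤-trans (≤-reflexive (trans (lem a′ d′ l) (cong (_* l) (sym D≡)))) m≥)
      where
      lem : ∀ a d l → (44 + 2 * a + d) * l + 4 * l ≡ (48 + 2 * a + d) * l
      lem = solve-∀

    many-blocks : 2 ^ τ + 2 ^ ((43 + 2 * a′ + d′) * l) ≤ 2 ^ q
    many-blocks = begin
      2 ^ τ + 2 ^ width                ≤⟨ +-monoˡ-≤ (2 ^ width) (2^-mono (*-monoˡ-≤ l (≤-trans (m≤m+n (29 + 2 * a′) (14 + d′)) (≤-reflexive (lem a′ d′))))) ⟩
      2 ^ width + 2 ^ width                ≡⟨ sym (2^2^ width) ⟩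
      2 ^ suc width                    ≤⟨ 2^-mono (≤-trans (+-monoˡ-≤ width 1≤l) q≥) ⟩
      2 ^ q                        ∎
      where
      width = (43 + 2 * a′ + d′) * l
      lem : ∀ a d → 29 + 2 * a + (14 + d) ≡ 43 + 2 * a + d
      lem = solve-∀

    few-gates : ∀ s → s ≤ 2 ^ (suc l * G) → 1 + 2 * s < 2 ^ κ * 2 ^ ((43 + 2 * a′ + d′) * l)
    few-gates s s≤ = begin-strict
      1 + 2 * s                                    <⟨ +-mono-≤ (s≤s (m^n>0 2 (suc l * G))) (*-monoʳ-≤ 2 s≤) ⟩
      1 + 2 ^ (suc l * G) + 2 * 2 ^ (suc l * G)    ≤⟨ +-monoˡ-≤ (2 * 2 ^ (suc l * G)) (+-monoˡ-≤ (2 ^ (suc l * G)) (m^n>0 2 (suc l * G))) ⟩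
      2 ^ (suc l * G) + 2 ^ (suc l * G) + 2 * 2 ^ (suc l * G) ≡⟨ lem (2 ^ (suc l * G)) ⟩
      2 ^ (2 + suc l * G)                          ≤⟨ 2^-mono (begin
        2 + suc l * G                               ≡⟨ trans (cong (λ G → 2 + suc l * G) G≡) (lem₁ a′ d′ l) ⟩
        50 + 3 * a′ + d′ + (48 + 3 * a′ + d′) * l   ≤⟨ +-monoˡ-≤ ((48 + 3 * a′ + d′) * l) (≤-trans (≤-trans (m≤m+n (50 + 3 * a′ + d′) (14 + a′)) (≤-reflexive (lem₂ a′ d′))) l-large) ⟩
        l + (48 + 3 * a′ + d′) * l                  ≡⟨ lem₃ a′ d′ l ⟩
        κ + (43 + 2 * a′ + d′) * l                  ∎) ⟩
      2 ^ (κ + (43 + 2 * a′ + d′) * l)             ≡⟨ ^-distribˡ-+-* 2 κ _ ⟩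
      2 ^ κ * 2 ^ ((43 + 2 * a′ + d′) * l)         ∎
      where
      lem : ∀ x → x + x + 2 * x ≡ 2 * (2 * x)
      lem = solve-∀
      lem₁ : ∀ a d l → 2 + (1 + l) * (48 + 3 * a + d) ≡ 50 + 3 * a + d + (48 + 3 * a + d) * l
      lem₁ = solve-∀
      lem₂ : ∀ a d → 50 + 3 * a + d + (14 + a) ≡ 64 + 4 * a + d
      lem₂ = solve-∀
      lem₃ : ∀ a d l → l + (48 + 3 * a + d) * l ≡ (6 + a) * l + (43 + 2 * a + d) * l
      lem₃ = solve-∀

    Qr : 2 ^ l * 2 ^ g ≡ 2 ^ ρ
    Qr = 2^-* l g (lem a′ l)
      where
      lem : ∀ a l → l + (16 + 2 * a) * l ≡ (17 + 2 * a) * l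
      lem = solve-∀

    S≤ : S ≤ 2 ^ ((13 + 2 * a′) * l)
    S≤ = begin
      S                                              ≡⟨ lem₁ τ κ X (2 ^ (4 * l)) (c * (2 + g)) ⟩
      4 + (τ + κ + c * (2 + g)) + (1 + (κ + κ)) * X + 2 ^ (4 * l)
        ≤⟨ +-mono-≤ (+-monoˡ-≤ ((1 + (κ + κ)) * X) (m≤m*n (4 + (τ + κ + c * (2 + g))) X)) (2^-mono 4l≤) ⟩
      (4 + (τ + κ + c * (2 + g))) * X + (1 + (κ + κ)) * X + X
        ≡⟨ lem₂ τ κ (c * (2 + g)) X ⟩
      (6 + (τ + 3 * κ + c * (2 + g))) * X            ≡⟨ cong (_* X) (lem₃ a′ c l) ⟩
      ((6 + c * 2) + (29 + 2 * a′ + 3 * (6 + a′) + c * (16 + 2 * a′)) * l) * X ≤⟨ *-monoˡ-≤ X (≤-trans (affine≤ (6 + c * 2) (29 + 2 * a′ + 3 * (6 + a′) + c * (16 + 2 * a′)) l) C₁≤) ⟩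
      2 ^ l * X                                      ≡⟨ 2^-* l (κ + κ) (lem₄ a′ l) ⟩
      2 ^ ((13 + 2 * a′) * l)                        ∎
      where
      X = 2 ^ (κ + κ)
      instance
        X≢0 : NonZero X
        X≢0 = m^n≢0 2 (κ + κ)
      4l≤ : 4 * l ≤ κ + κ
      4l≤ = ≤-trans (m≤m+n (4 * l) ((8 + 2 * a′) * l)) (≤-reflexive (lem a′ l))
        where
        lem : ∀ a l → 4 * l + (8 + 2 * a) * l ≡ (6 + a) * l + (6 + a) * l
        lem = solve-∀
      lem₁ : ∀ t k x y z → 1 + (t + (2 + k + (1 + (k + k)) * x) + (y + (1 + z))) ≡ 4 + (t + k + z) + (1 + (k + k)) * x + y
      lem₁ = solve-∀
      lem₂ : ∀ t k z x → (4 + (t + k + z)) * x + (1 + (k + k)) * x + x ≡ (6 + (t + 3 * k + z)) * x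
      lem₂ = solve-∀
      lem₃ : ∀ a c l → 6 + ((29 + 2 * a) * l + 3 * ((6 + a) * l) + c * (2 + (16 + 2 * a) * l))
                     ≡ (6 + c * 2) + (29 + 2 * a + 3 * (6 + a) + c * (16 + 2 * a)) * l
      lem₃ = solve-∀
      lem₄ : ∀ a l → l + ((6 + a) * l + (6 + a) * l) ≡ (13 + 2 * a) * l
      lem₄ = solve-∀

    r-large : 4 * (2 ^ l * 2 ^ l) * S ≤ 2 ^ g
    r-large = begin
      4 * (2 ^ l * 2 ^ l) * S                          ≤⟨ *-monoʳ-≤ (4 * (2 ^ l * 2 ^ l)) S≤ ⟩
      4 * (2 ^ l * 2 ^ l) * 2 ^ ((13 + 2 * a′) * l)    ≡⟨ cong (λ t → 4 * t * 2 ^ ((13 + 2 * a′) * l)) (2^-* l l refl) ⟩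
      4 * 2 ^ (l + l) * 2 ^ ((13 + 2 * a′) * l)        ≡⟨ trans (cong (_* 2 ^ ((13 + 2 * a′) * l)) (2^-* 2 (l + l) refl)) (2^-* (2 + (l + l)) ((13 + 2 * a′) * l) refl) ⟩
      2 ^ (2 + (l + l) + (13 + 2 * a′) * l)            ≤⟨ 2^-mono (≤-trans (+-monoˡ-≤ _ (+-monoˡ-≤ (l + l) (≤-trans (m≤m+n 2 _) l-large))) (≤-reflexive (lem a′ l))) ⟩
      2 ^ g                                            ∎
      where
      lem : ∀ a l → l + (l + l) + (13 + 2 * a) * l ≡ (16 + 2 * a) * l
      lem = solve-∀

    small-family : 2 ^ τ * familyBound (2 ^ κ) * (2 ^ (2 ^ (4 * l)) * (2 * (4 * 2 ^ g) ^ c)) < 2 ^ S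
    small-family = begin-strict
      2 ^ τ * familyBound (2 ^ κ) * (2 ^ (2 ^ (4 * l)) * (2 * (4 * 2 ^ g) ^ c))
        ≤⟨ *-mono-≤ (*-monoʳ-≤ (2 ^ τ) (familyBound-2^ κ)) (*-monoʳ-≤ (2 ^ (2 ^ (4 * l))) (≤-reflexive (cong (2 *_) (trans (cong (_^ c) (2^-* 2 g refl)) (trans (^-*-assoc 2 (2 + g) c) (cong (2 ^_) (*-comm (2 + g) c))))))) ⟩
      2 ^ τ * 2 ^ (2 + κ + (1 + (κ + κ)) * 2 ^ (κ + κ)) * (2 ^ (2 ^ (4 * l)) * 2 ^ (1 + c * (2 + g)))
        ≡⟨ cong₂ _*_ (2^-* τ (2 + κ + (1 + (κ + κ)) * 2 ^ (κ + κ)) refl) (2^-* (2 ^ (4 * l)) (1 + c * (2 + g)) refl) ⟩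
      2 ^ (τ + (2 + κ + (1 + (κ + κ)) * 2 ^ (κ + κ))) * 2 ^ (2 ^ (4 * l) + (1 + c * (2 + g)))
        ≡⟨ 2^-* (τ + (2 + κ + (1 + (κ + κ)) * 2 ^ (κ + κ))) (2 ^ (4 * l) + (1 + c * (2 + g))) refl ⟩
      2 ^ (τ + (2 + κ + (1 + (κ + κ)) * 2 ^ (κ + κ)) + (2 ^ (4 * l) + (1 + c * (2 + g))))
        <⟨ ^-monoʳ-< 2 ≤-refl (n<1+n (τ + (2 + κ + (1 + (κ + κ)) * 2 ^ (κ + κ)) + (2 ^ (4 * l) + (1 + c * (2 + g))))) ⟩
      2 ^ S ∎

    -- The number of functions has logarithm O(K log K) for K = 2^(c(l+1)). The factor log K and the
    -- 2^c from rounding m fit into the 2^l by which the live bits exceed 2^(cl).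
    few-functions : functionBound (2 ^ (c * suc l)) size′ < (2 ^ (2 ^ (4 * l))) ^ (2 ^ τ)
    few-functions = begin-strict
      functionBound K size′                                       ≤⟨ functionBound-2^ K size′ ν 1≤size′ K+size′≤ ⟩
      2 ^ (1 + (ν + ((4 + (ν + ν)) * K + ν)))                 <⟨ ^-monoʳ-< 2 ≤-refl exponent ⟩
      2 ^ (2 ^ (4 * l) * 2 ^ τ)                               ≡⟨ sym (^-*-assoc 2 (2 ^ (4 * l)) (2 ^ τ)) ⟩
      (2 ^ (2 ^ (4 * l))) ^ (2 ^ τ)                           ∎
      where
      K = 2 ^ (c * suc l)
      ν = 1 + c * suc l
      1≤size′ : 1 ≤ size′
      1≤size′ = ≤-trans 1≤l (≤-trans (m≤n*m l D {{subst NonZero (sym D≡) _}}) m≥)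
      size′≤K : size′ ≤ K
      size′≤K = begin
        size′                  ≤⟨ <⇒≤ m< ⟩
        D * suc l          ≤⟨ *-monoˡ-≤ (suc l) (m≤n+m D 3) ⟩
        C₃ * suc l         ≤⟨ C₃≤ ⟩
        2 ^ l              ≤⟨ 2^-mono (≤-trans (n≤1+n l) (m≤n*m (suc l) c {{subst NonZero (sym c≡) _}})) ⟩
        K                  ∎
      K+size′≤ : K + size′ ≤ 2 ^ ν
      K+size′≤ = ≤-trans (+-monoʳ-≤ K size′≤K) (≤-reflexive (sym (2^2^ (c * suc l))))
      instance
        K≢0 : NonZero K
        K≢0 = m^n≢0 2 (c * suc l)
        2^c≢0 : NonZero (2 ^ c)
        2^c≢0 = m^n≢0 2 c
      exponent : 1 + (ν + ((4 + (ν + ν)) * K + ν)) < 2 ^ (4 * l) * 2 ^ τ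
      exponent = begin-strict
        1 + (ν + ((4 + (ν + ν)) * K + ν))                 ≡⟨ lem₁ ν K ⟩
        (1 + (ν + ν)) + (4 + (ν + ν)) * K                 ≤⟨ +-monoˡ-≤ _ (m≤m*n (1 + (ν + ν)) K) ⟩
        (1 + (ν + ν)) * K + (4 + (ν + ν)) * K             ≡⟨ lem₂ (c * suc l) K ⟩
        (9 + 4 * (c * suc l)) * K                         <⟨ *-monoˡ-< K (begin-strict
          9 + 4 * (c * suc l)                               <⟨ n<1+n _ ⟩
          10 + 4 * (c * suc l)                              ≤⟨ +-monoˡ-≤ _ (m≤m*n 10 (suc l)) ⟩
          10 * suc l + 4 * (c * suc l)                      ≡⟨ lem₃ c (suc l) ⟩
          (10 + 4 * c) * suc l                              ∎) ⟩
        (10 + 4 * c) * suc l * K                          ≡⟨ cong (((10 + 4 * c) * suc l) *_) (trans (cong (2 ^_) (*-suc c l)) (^-distribˡ-+-* 2 c (c * l))) ⟩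
        (10 + 4 * c) * suc l * (2 ^ c * 2 ^ (c * l))      ≡⟨ lem₄ (10 + 4 * c) (suc l) (2 ^ c) (2 ^ (c * l)) ⟩
        C₂ * suc l * 2 ^ (c * l)                          ≤⟨ *-monoˡ-≤ (2 ^ (c * l)) C₂≤ ⟩
        2 ^ l * 2 ^ (c * l)                               ≡⟨ trans (2^-* l (c * l) (trans (cong (λ c → l + c * l) c≡) (lem₅ a′ l))) (^-distribˡ-+-* 2 (4 * l) τ) ⟩
        2 ^ (4 * l) * 2 ^ τ                               ∎
        where
        lem₁ : ∀ n k → 1 + (n + ((4 + (n + n)) * k + n)) ≡ (1 + (n + n)) + (4 + (n + n)) * k
        lem₁ = solve-∀
        lem₂ : ∀ x k → (1 + (1 + x + (1 + x))) * k + (4 + (1 + x + (1 + x))) * k ≡ (9 + 4 * x) * k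
        lem₂ = solve-∀
        lem₃ : ∀ c s → 10 * s + 4 * (c * s) ≡ (10 + 4 * c) * s
        lem₃ = solve-∀
        lem₄ : ∀ x s y z → x * s * (y * z) ≡ x * y * s * z
        lem₄ = solve-∀
        lem₅ : ∀ a l → l + (32 + 2 * a) * l ≡ 4 * l + (29 + 2 * a) * l
        lem₅ = solve-∀

    -- The relative error is (4/Q)^c = 2^((2-l)c). As cl = τ + 3l, it beats 1/t, and the 3l pay for
    -- the constant 1 + 2c; hence c tables.
    small-error : 2 * (2 ^ τ * (4 * 2 ^ g) ^ c) ≤ (2 ^ l * 2 ^ g) ^ c
    small-error = begin
      2 * (2 ^ τ * (4 * 2 ^ g) ^ c)              ≡⟨ cong (λ t → 2 * (2 ^ τ * t)) (trans (cong (_^ c) (2^-* 2 g refl)) (^-*-assoc 2 (2 + g) c)) ⟩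
      2 * (2 ^ τ * 2 ^ ((2 + g) * c))            ≡⟨ cong (2 *_) (2^-* τ ((2 + g) * c) refl) ⟩
      2 ^ (1 + (τ + (2 + g) * c))                ≤⟨ 2^-mono (begin
        1 + (τ + (2 + g) * c)                     ≡⟨ trans (cong (λ c → 1 + (τ + (2 + g) * c)) c≡) (lem₁ a′ l g) ⟩
        (65 + 4 * a′) + ((29 + 2 * a′) * l + g * (32 + 2 * a′)) ≤⟨ +-monoˡ-≤ _ (begin
          65 + 4 * a′            ≤⟨ ≤-trans (m≤m+n (65 + 4 * a′) (d′ + 4 * a′)) (≤-reflexive (lem₃ a′ d′)) ⟩
          (64 + 4 * a′ + d′) + (1 + 4 * a′) ≤⟨ +-mono-≤ l-large (≤-trans (≤-trans (m≤m+n _ (63 + d′)) (≤-reflexive (lem₄ a′ d′))) l-large) ⟩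
          l + l                  ≤⟨ +-monoʳ-≤ l (m≤m+n l (1 * l)) ⟩
          3 * l                  ∎) ⟩
        3 * l + ((29 + 2 * a′) * l + g * (32 + 2 * a′)) ≡⟨ trans (lem₂ a′ l g) (cong ((l + g) *_) (sym c≡)) ⟩
        (l + g) * c                               ∎) ⟩
      2 ^ ((l + g) * c)                          ≡⟨ sym (^-*-assoc 2 (l + g) c) ⟩
      (2 ^ (l + g)) ^ c                          ≡⟨ cong (_^ c) (^-distribˡ-+-* 2 l g) ⟩
      (2 ^ l * 2 ^ g) ^ c                        ∎
      where
      lem₁ : ∀ a l g → 1 + ((29 + 2 * a) * l + (2 + g) * (32 + 2 * a)) ≡ (65 + 4 * a) + ((29 + 2 * a) * l + g * (32 + 2 * a))
      lem₁ = solve-∀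
      lem₂ : ∀ a l g → 3 * l + ((29 + 2 * a) * l + g * (32 + 2 * a)) ≡ (l + g) * (32 + 2 * a)
      lem₂ = solve-∀
      lem₃ : ∀ a d → 65 + 4 * a + (d + 4 * a) ≡ (64 + 4 * a + d) + (1 + 4 * a)
      lem₃ = solve-∀
      lem₄ : ∀ a d → 1 + 4 * a + (63 + d) ≡ 64 + 4 * a + d
      lem₄ = solve-∀

    -- Looking up index bits, with about tq gates per bit, dominates; a table costs only about
    -- 2^((21 + 2a′)l). Of the 3l between τ and cl, one l covers q, one covers the factor cρ, and
    -- one is left over.
    enough : circuitCost q (4 * l) ρ c (2 ^ τ) ≤ 2 ^ (c * l)
    enough = begin
      1 + (cost + (c * (ρ * cost + 4 * 2 ^ (ρ + 4 * l) + 1) + 1))  ≤⟨ +-mono-≤ 1≤Y (+-mono-≤ cost≤Y (+-mono-≤ (*-monoʳ-≤ c (+-mono-≤ (+-mono-≤ (*-monoʳ-≤ ρ cost≤Y) table≤Y) 1≤Y)) 1≤Y)) ⟩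
      Y + (Y + (c * (ρ * Y + Y + Y) + Y))                    ≡⟨ lem₁ Y c ρ ⟩
      (3 + c * (ρ + 2)) * Y                                  ≡⟨ cong (_* Y) (lem₂ a′ c l) ⟩
      ((3 + c * 2) + c * (17 + 2 * a′) * l) * Y              ≤⟨ *-monoˡ-≤ Y (≤-trans (affine≤ (3 + c * 2) (c * (17 + 2 * a′)) l) C₄≤) ⟩
      2 ^ l * Y                                              ≡⟨ 2^-* l ((30 + 2 * a′) * l) (lem₃ a′ l) ⟩
      2 ^ ((31 + 2 * a′) * l)                                ≤⟨ 2^-mono (*-monoˡ-≤ l (≤-trans (n≤1+n (31 + 2 * a′)) (≤-reflexive (sym c≡)))) ⟩
      2 ^ (c * l)                                            ∎
      where
      cost = 2 ^ τ * (2 + q) + 1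
      Y = 2 ^ ((30 + 2 * a′) * l)
      1≤Y : 1 ≤ Y
      1≤Y = m^n>0 2 ((30 + 2 * a′) * l)
      cost≤Y : cost ≤ Y
      cost≤Y = begin
        2 ^ τ * (2 + q) + 1          ≤⟨ +-monoʳ-≤ (2 ^ τ * (2 + q)) (m^n>0 2 τ) ⟩
        2 ^ τ * (2 + q) + 2 ^ τ      ≡⟨ lem (2 ^ τ) q ⟩
        2 ^ τ * (3 + q)              ≤⟨ *-monoʳ-≤ (2 ^ τ) (begin
          3 + q                        ≤⟨ +-monoʳ-≤ 3 (≤-trans (m≤m+n q (4 * l)) (<⇒≤ m<)) ⟩
          3 + D * suc l                ≤⟨ +-monoˡ-≤ (D * suc l) (m≤m*n 3 (suc l)) ⟩
          3 * suc l + D * suc l        ≡⟨ sym (*-distribʳ-+ (suc l) 3 D) ⟩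
          C₃ * suc l                   ≤⟨ C₃≤ ⟩
          2 ^ l                        ∎) ⟩
        2 ^ τ * 2 ^ l                ≡⟨ 2^-* τ l (lem′ a′ l) ⟩
        Y                            ∎
        where
        lem : ∀ x q → x * (2 + q) + x ≡ x * (3 + q)
        lem = solve-∀
        lem′ : ∀ a l → (29 + 2 * a) * l + l ≡ (30 + 2 * a) * l
        lem′ = solve-∀
      table≤Y : 4 * 2 ^ (ρ + 4 * l) ≤ Y
      table≤Y = begin
        4 * 2 ^ (ρ + 4 * l)          ≡⟨ 2^-* 2 (ρ + 4 * l) refl ⟩
        2 ^ (2 + (ρ + 4 * l))        ≤⟨ 2^-mono (≤-trans (+-monoˡ-≤ (ρ + 4 * l) (≤-trans (≤-trans (m≤m+n 2 _) l-large) (m≤m+n l (8 * l)))) (≤-reflexive (lem a′ l))) ⟩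
        Y                            ∎
        where
        lem : ∀ a l → l + 8 * l + ((17 + 2 * a) * l + 4 * l) ≡ (30 + 2 * a) * l
        lem = solve-∀
      lem₁ : ∀ y c r → y + (y + (c * (r * y + y + y) + y)) ≡ (3 + c * (r + 2)) * y
      lem₁ = solve-∀
      lem₂ : ∀ a c l → 3 + c * ((17 + 2 * a) * l + 2) ≡ (3 + c * 2) + c * (17 + 2 * a) * l
      lem₂ = solve-∀
      lem₃ : ∀ a l → l + (30 + 2 * a) * l ≡ (31 + 2 * a) * l
      lem₃ = solve-∀

-- Instantiating the parameters

separate : (a′ d′ c D G : ℕ) → c ≡ 32 + 2 * a′ → D ≡ 48 + 2 * a′ + d′ → G ≡ 48 + 3 * a′ + d′ → (α β : ℚ) →
  (∀ l m k → D * l ≤ m → k ≤ 2 ^ (c * l) → k ≤ (2 ^ m) ^^ α) →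
  (∀ l m k → m < D * suc l → k ≤ (2 ^ m) ^^ α → k ≤ 2 ^ (c * suc l)) →
  (∀ l m s → m < D * suc l → s ≤ (2 ^ m) ^^ β → s ≤ 2 ^ (suc l * G)) →
  ∃ λ m₀ → ∀ m → m₀ ≤ m → (C : Comparator (2 ^ m)) → size C ≤ (2 ^ m) ^^ β → ¬ Decides C (MCSP m α)
-- With l = m / D, n = 2^m lies between 2^(Dl) and 2^(D(l+1)), and n^α between 2^(cl) and
-- 2^(c(l+1)); the m - 4l variables beyond the position bits number the blocks.
separate a′ d′ c D G c≡ D≡ G≡ α β α-lower α-upper β-upper = D * l₀ , λ m m≥ C → large m (m / D) (l≥ m m≥) (div≤ m) (div> m) C
  where
  open Parameters a′ d′ c D G c≡ D≡ G≡
  instance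
    D≢0 : NonZero D
    D≢0 = subst NonZero (sym D≡) _
  threshold = linear≤exponential slope
  l₀ = proj₁ threshold + (64 + 4 * a′ + d′)
  l≥ : ∀ m → D * l₀ ≤ m → l₀ ≤ m / D
  l≥ m m≥ = subst (_≤ m / D) (trans (cong (_/ D) (*-comm D l₀)) (m*n/n≡m l₀ D)) (/-monoˡ-≤ D m≥)
  div≤ : ∀ m → D * (m / D) ≤ m
  div≤ m = ≤-trans (≤-reflexive (*-comm D (m / D))) (≤-trans (m≤n+m _ (m % D)) (≤-reflexive (sym (m≡m%n+[m/n]*n m D))))
  div> : ∀ m → m < D * suc (m / D)
  div> m = ≤-trans (s≤s (≤-reflexive (m≡m%n+[m/n]*n m D))) (≤-trans (+-monoˡ-≤ (m / D * D) (m%n<n m D)) (≤-reflexive (*-comm (suc (m / D)) D)))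
  large′ : ∀ l q m → m ≡ q + 4 * l → l₀ ≤ l → D * l ≤ m → m < D * suc l →
    (C : Comparator (2 ^ m)) → size C ≤ (2 ^ m) ^^ β → ¬ Decides C (MCSP m α)
  large′ l q m refl l≥l₀ m≥ m< C small decides =
    Core.impossible q (4 * l) (ρ l q l-large exponential m≥ m<) c (2 ^ τ l q l-large exponential m≥ m<) (2 ^ ((43 + 2 * a′ + d′) * l)) (2 ^ l)
      (2 ^ g l q l-large exponential m≥ m<) (S l q l-large exponential m≥ m<) (2 ^ κ l q l-large exponential m≥ m<) (2 ^ (c * l)) (2 ^ (c * suc l))
      C (fromℕ< 0<m)
      (λ a (k , k≤ , D′ , comp) → proj₂ (decides a) (k , α-lower l m k m≥ k≤ , D′ , comp))
      (λ a acc → let (k , k≤ , D′ , comp) = proj₁ (decides a) acc in k , α-upper l m k m< k≤ , D′ , comp)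
      (many-blocks l q l-large exponential m≥ m<)
      (few-gates l q l-large exponential m≥ m< (size C) (β-upper l m (size C) m< small))
      (Qr l q l-large exponential m≥ m<)
      (m^n>0 2 l) (m^n>0 2 (g l q l-large exponential m≥ m<))
      (r-large l q l-large exponential m≥ m<)
      (small-family l q l-large exponential m≥ m<)
      (few-functions l q l-large exponential m≥ m<)
      (small-error l q l-large exponential m≥ m<)
      (enough l q l-large exponential m≥ m<)
    where
    l-large : 64 + 4 * a′ + d′ ≤ l
    l-large = ≤-trans (m≤n+m _ (proj₁ threshold)) l≥l₀
    exponential : slope * suc l ≤ 2 ^ l
    exponential = proj₂ threshold l (≤-trans (m≤m+n (proj₁ threshold) _) l≥l₀)
    0<m : 0 < q + 4 * l
    0<m = ≤-trans (≤-trans (≤-trans (s≤s z≤n) l-large) (m≤n*m l D)) m≥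
  large : ∀ m l → l₀ ≤ l → D * l ≤ m → m < D * suc l →
    (C : Comparator (2 ^ m)) → size C ≤ (2 ^ m) ^^ β → ¬ Decides C (MCSP m α)
  large m l l≥l₀ m≥ m< C = large′ l (m ∸ 4 * l) m (sym (m∸n+n≡m (≤-trans (*-monoˡ-≤ l 4≤D) m≥))) l≥l₀ m≥ m< C
    where
    4≤D : 4 ≤ D
    4≤D = ≤-trans (≤-trans (m≤m+n 4 (44 + 2 * a′ + d′)) ≤-refl) (≤-reflexive (sym D≡))

-- Rational exponents

-- Raising both sides to the other denominator reduces the claim to comparing exponents of n. A
-- negative exponent forces x ≤ 1.
≤^^⇒≤^ : (β : ℚ) (G D : ℕ) → toℚᵘ β ℚᵘ.≤ mkℚᵘ (posℤ G) D → ∀ x n → 1 ≤ n → x ≤ n ^^ β → x ^ suc D ≤ n ^ G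
≤^^⇒≤^ (mkℚ (posℤ b) d _) G D (ℚᵘ.*≤* bD≤Gd) x n 1≤n x≤ = ^-cancelˡ-≤ (suc d) _ _ (begin
  (x ^ suc D) ^ suc d      ≡⟨ trans (^-*-assoc x (suc D) (suc d)) (trans (cong (x ^_) (*-comm (suc D) (suc d))) (sym (^-*-assoc x (suc d) (suc D)))) ⟩
  (x ^ suc d) ^ suc D      ≤⟨ ^-monoˡ-≤ (suc D) x≤ ⟩
  (n ^ b) ^ suc D          ≡⟨ ^-*-assoc n b (suc D) ⟩
  n ^ (b * suc D)          ≤⟨ ^-monoʳ-≤ n {{>-nonZero 1≤n}} (ℤₚ.drop‿+≤+ (subst₂ ℤ._≤_ (sym (ℤₚ.pos-* b (suc D))) (sym (ℤₚ.pos-* G (suc d))) bD≤Gd)) ⟩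
  n ^ (G * suc d)          ≡⟨ sym (^-*-assoc n G (suc d)) ⟩
  (n ^ G) ^ suc d          ∎)
  where open ≤-Reasoning
≤^^⇒≤^ (mkℚ -[1+ b ] d _) G D _ x n 1≤n x≤ = begin
  x ^ suc D                ≤⟨ ^-monoˡ-≤ (suc D) x≤1 ⟩
  1 ^ suc D                ≡⟨ ^-zeroˡ (suc D) ⟩
  1                        ≤⟨ >-nonZero⁻¹ (n ^ G) {{m^n≢0 n G {{>-nonZero 1≤n}}}} ⟩
  n ^ G                    ∎
  where
  open ≤-Reasoning
  x≤1 : x ≤ 1
  x≤1 = ^-cancelˡ-≤ (suc d) x 1 (begin
    x ^ suc d                   ≤⟨ m≤m*n (x ^ suc d) (n ^ suc b) {{m^n≢0 n (suc b) {{>-nonZero 1≤n}}}} ⟩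
    x ^ suc d * n ^ suc b       ≤⟨ x≤ ⟩
    1                           ≡⟨ sym (^-zeroˡ (suc d)) ⟩
    1 ^ suc d                   ∎)

≤-moveʳ : ∀ X Y Z → X ℚᵘ.≤ Y ℚᵘ.+ Z → X ℚᵘ.- Z ℚᵘ.≤ Y
≤-moveʳ X Y Z X≤ = ℚᵘₚ.≤-respʳ-≃ (ℚᵘₚ.≃-trans (ℚᵘₚ.+-assoc Y Z (ℚᵘ.- Z)) (ℚᵘₚ.≃-trans (ℚᵘₚ.+-congʳ Y (ℚᵘₚ.+-inverseʳ Z)) (ℚᵘₚ.+-identityʳ Y)))
  (ℚᵘₚ.+-monoˡ-≤ (ℚᵘ.- Z) X≤)

-- Normalising divides by a gcd that depends on α and ε; the unnormalised form has explicit
-- numerator and denominator, so the exponent is compared there.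
exponent-≃ : ∀ α ε → toℚᵘ (1ℚ ℚ.+ α ℚ.* ½ ℚ.- ε) ℚᵘ.≃ (1ℚᵘ ℚᵘ.+ toℚᵘ α ℚᵘ.* ℚᵘ.½) ℚᵘ.- toℚᵘ ε
exponent-≃ α ε = ℚᵘₚ.≃-trans (ℚₚ.toℚᵘ-homo-+ (1ℚ ℚ.+ α ℚ.* ½) (ℚ.- ε))
  (ℚᵘₚ.+-cong (ℚᵘₚ.≃-trans (ℚₚ.toℚᵘ-homo-+ 1ℚ (α ℚ.* ½)) (ℚᵘₚ.+-congʳ 1ℚᵘ (ℚₚ.toℚᵘ-homo-* α ½))) (ℚₚ.toℚᵘ-homo‿- ε))

sum≤1 : ∀ α ε → α ℚ.≤ 1ℚ ℚ.- ε → toℚᵘ α ℚᵘ.+ toℚᵘ ε ℚᵘ.≤ 1ℚᵘ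
sum≤1 α ε α≤ = ℚᵘₚ.≤-respˡ-≃ (ℚₚ.toℚᵘ-homo-+ α ε) (ℚₚ.toℚᵘ-mono-≤ (subst (α ℚ.+ ε ℚ.≤_) cancel (ℚₚ.+-monoˡ-≤ ε α≤)))
  where
  cancel : 1ℚ ℚ.- ε ℚ.+ ε ≡ 1ℚ
  cancel = trans (ℚₚ.+-assoc 1ℚ (ℚ.- ε) ε) (trans (cong (1ℚ ℚ.+_) (ℚₚ.+-inverseˡ ε)) (ℚₚ.+-identityʳ 1ℚ))

module _ (p da c D : ℕ) (cda≡pD : c * suc da ≡ D * suc p) where

  open ≤-Reasoning

  swap-exponents : ∀ l → c * l * suc da ≡ D * l * suc p
  swap-exponents l = trans (lem c l (suc da)) (trans (cong (l *_) cda≡pD) (lem′ l D (suc p)))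
    where
    lem : ∀ c l x → c * l * x ≡ l * (c * x)
    lem = solve-∀
    lem′ : ∀ l x y → l * (x * y) ≡ x * l * y
    lem′ = solve-∀

  power-lower : ∀ l m k → D * l ≤ m → k ≤ 2 ^ (c * l) → k ^ suc da ≤ (2 ^ m) ^ suc p
  power-lower l m k m≥ k≤ = begin
    k ^ suc da                ≤⟨ ^-monoˡ-≤ (suc da) k≤ ⟩
    (2 ^ (c * l)) ^ suc da    ≡⟨ trans (^-*-assoc 2 (c * l) (suc da)) (cong (2 ^_) (swap-exponents l)) ⟩
    2 ^ (D * l * suc p)       ≤⟨ 2^-mono (*-monoˡ-≤ (suc p) m≥) ⟩
    2 ^ (m * suc p)           ≡⟨ sym (^-*-assoc 2 m (suc p)) ⟩
    (2 ^ m) ^ suc p           ∎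

  power-upper : ∀ l m k → m < D * suc l → k ^ suc da ≤ (2 ^ m) ^ suc p → k ≤ 2 ^ (c * suc l)
  power-upper l m k m< k≤ = ^-cancelˡ-≤ (suc da) k _ (begin
    k ^ suc da                ≤⟨ k≤ ⟩
    (2 ^ m) ^ suc p           ≡⟨ ^-*-assoc 2 m (suc p) ⟩
    2 ^ (m * suc p)           ≤⟨ 2^-mono (*-monoˡ-≤ (suc p) (<⇒≤ m<)) ⟩
    2 ^ (D * suc l * suc p)   ≡⟨ sym (trans (^-*-assoc 2 (c * suc l) (suc da)) (cong (2 ^_) (swap-exponents (suc l)))) ⟩
    (2 ^ (c * suc l)) ^ suc da ∎)

size-upper : ∀ β G D → toℚᵘ β ℚᵘ.≤ mkℚᵘ (posℤ G) D → ∀ l m s → m < suc D * suc l → s ≤ (2 ^ m) ^^ β → s ≤ 2 ^ (suc l * G)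
size-upper β G D β≤ l m s m< s≤ = ^-cancelˡ-≤ (suc D) s _ (begin
  s ^ suc D                 ≤⟨ ≤^^⇒≤^ β G D β≤ s (2 ^ m) (m^n>0 2 m) s≤ ⟩
  (2 ^ m) ^ G               ≡⟨ ^-*-assoc 2 m G ⟩
  2 ^ (m * G)               ≤⟨ 2^-mono (*-monoˡ-≤ G (<⇒≤ m<)) ⟩
  2 ^ (suc D * suc l * G)   ≡⟨ cong (2 ^_) (lem (suc D) (suc l) G) ⟩
  2 ^ (suc l * G * suc D)   ≡⟨ sym (^-*-assoc 2 (suc l * G) (suc D)) ⟩
  (2 ^ (suc l * G)) ^ suc D ∎)
  where
  open ≤-Reasoning
  lem : ∀ d l g → d * l * g ≡ l * g * d
  lem = solve-∀

-- G/D ≥ 1 + α/2 - ε for α = 32 p d_ε / D, ε ≥ 32/D and G = D + 16 p d_ε - 16, with denominators cleared.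
exponent-numerators : ∀ p da e de G D → suc D ≡ 32 * (suc da * suc de) → G + 16 ≡ suc D + 16 * (suc p * suc de) →
  (1 * (suc da * 2) + suc p * 1 * 1) * (suc D * suc de) ≤ (G * suc de + suc e * suc D) * (1 * (suc da * 2))
exponent-numerators p da e de G D D≡ G≡ = begin
  (1 * (x * 2) + y * 1 * 1) * (suc D * z)             ≡⟨ lem₁ x y (suc D) z ⟩
  2 * x * suc D * z + suc D * (y * z)                 ≡⟨ cong (λ d → 2 * x * suc D * z + d * (y * z)) D≡ ⟩
  2 * x * suc D * z + 32 * (x * z) * (y * z)          ≡⟨ lem₂ x y (suc D) z ⟩
  2 * x * z * (suc D + 16 * (y * z))                  ≡⟨ cong (2 * x * z *_) (sym G≡) ⟩
  2 * x * z * (G + 16)                                ≡⟨ lem₃ x z G ⟩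
  (G * z + 16 * z) * (1 * (x * 2))                    ≤⟨ *-monoˡ-≤ (1 * (x * 2)) (+-monoʳ-≤ (G * z) (begin
    16 * z                                              ≤⟨ m≤n*m (16 * z) x ⟩
    x * (16 * z)                                        ≤⟨ m≤n*m (x * (16 * z)) 2 ⟩
    2 * (x * (16 * z))                                  ≡⟨ trans (lem₄ x z) (sym D≡) ⟩
    suc D                                               ≤⟨ m≤n*m (suc D) (suc e) ⟩
    suc e * suc D                                       ∎)) ⟩
  (G * z + suc e * suc D) * (1 * (x * 2))             ∎
  where
  open ≤-Reasoning
  x = suc da
  y = suc p
  z = suc de
  lem₁ : ∀ x y d z → (1 * (x * 2) + y * 1 * 1) * (d * z) ≡ 2 * x * d * z + d * (y * z)
  lem₁ = solve-∀
  lem₂ : ∀ x y d z → 2 * x * d * z + 32 * (x * z) * (y * z) ≡ 2 * x * z * (d + 16 * (y * z))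
  lem₂ = solve-∀
  lem₃ : ∀ x z g → 2 * x * z * (g + 16) ≡ (g * z + 16 * z) * (1 * (x * 2))
  lem₃ = solve-∀
  lem₄ : ∀ x z → 2 * (x * (16 * z)) ≡ 32 * (x * z)
  lem₄ = solve-∀

exponent≤ : ∀ α ε p da e de G D → toℚᵘ α ≡ mkℚᵘ +[1+ p ] da → toℚᵘ ε ≡ mkℚᵘ +[1+ e ] de →
  suc D ≡ 32 * (suc da * suc de) → G + 16 ≡ suc D + 16 * (suc p * suc de) →
  toℚᵘ (1ℚ ℚ.+ α ℚ.* ½ ℚ.- ε) ℚᵘ.≤ mkℚᵘ (posℤ G) D
-- G = 0 contradicts `G≡`, whose right side exceeds 16; for a successor the integer products reduce
-- to products of naturals.
exponent≤ _ _ p da e de zero D _ _ _ G≡ =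
  ⊥-elim (<-irrefl G≡ (+-mono-≤ {1} {suc D} (s≤s z≤n) (m≤m*n 16 (suc p * suc de))))
exponent≤ α ε p da e de (suc G) D α≡ ε≡ D≡ G≡ = ℚᵘₚ.≤-respˡ-≃ (ℚᵘₚ.≃-sym (exponent-≃ α ε))
  (subst₂ (λ x y → (1ℚᵘ ℚᵘ.+ x ℚᵘ.* ℚᵘ.½) ℚᵘ.- y ℚᵘ.≤ mkℚᵘ (posℤ (suc G)) D) (sym α≡) (sym ε≡)
    (≤-moveʳ (1ℚᵘ ℚᵘ.+ mkℚᵘ +[1+ p ] da ℚᵘ.* ℚᵘ.½) (mkℚᵘ (posℤ (suc G)) D) (mkℚᵘ +[1+ e ] de)
      (ℚᵘ.*≤* (+≤+ (exponent-numerators p da e de (suc G) D D≡ G≡)))))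

sum≤-numerators : ∀ p da e de → mkℚᵘ +[1+ p ] da ℚᵘ.+ mkℚᵘ +[1+ e ] de ℚᵘ.≤ 1ℚᵘ → suc p * suc de + suc e * suc da ≤ suc da * suc de
sum≤-numerators p da e de (ℚᵘ.*≤* h) = ≤-trans (≤-reflexive (sym (*-identityʳ _))) (≤-trans (ℤₚ.drop‿+≤+ h) (≤-reflexive (*-identityˡ (suc da * suc de))))

abstract
  -- Over 32 times the product of the denominators, α is 2a/D with a = 16(u+1), and ε is at least
  -- 32/D. The factor 32 makes a′ = a - 16 natural, and α + ε ≤ 1 gives D ≥ 2a + 32, which leaves
  -- room for d′.
  parameters : ∀ p da e de → suc p * suc de + suc e * suc da ≤ suc da * suc de →
    ∃ λ a′ → ∃ λ d′ → ∃ λ c → ∃ λ D → ∃ λ G → c ≡ 32 + 2 * a′ × suc D ≡ 48 + 2 * a′ + d′ × G ≡ 48 + 3 * a′ + d′ ×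
      c * suc da ≡ suc D * suc p × suc D ≡ 32 * (suc da * suc de) × G + 16 ≡ suc D + 16 * (suc p * suc de)
  parameters p da e de sum≤ = 16 * u , d′ , 32 * suc u , 31 + 32 * (de + da * suc de) , 48 + 3 * (16 * u) + d′ ,
    lem₁ u , D≡ , refl , lem₂ p da de , lem₃ da de , trans (lem₄ u d′) (cong (_+ 16 * suc u) (sym D≡))
    where
    u d′ : ℕ
    -- Chosen so that `suc u` is `suc p * suc de`, the numerator of α over the product of the two
    -- denominators.
    u = de + p * suc de
    d′ = 32 * (suc da * suc de) ∸ (48 + 2 * (16 * u))
    lem₁ : ∀ u → 32 * (1 + u) ≡ 32 + 2 * (16 * u)
    lem₁ = solve-∀
    lem₂ : ∀ p da de → 32 * (1 + (de + p * (1 + de))) * (1 + da) ≡ (32 + 32 * (de + da * (1 + de))) * (1 + p)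
    lem₂ = solve-∀
    lem₃ : ∀ da de → 32 + 32 * (de + da * (1 + de)) ≡ 32 * ((1 + da) * (1 + de))
    lem₃ = solve-∀
    lem₄ : ∀ u d → 48 + 3 * (16 * u) + d + 16 ≡ 48 + 2 * (16 * u) + d + 16 * (1 + u)
    lem₄ = solve-∀
    lem₅ : ∀ u → 48 + 2 * (16 * u) + 16 ≡ 32 * (1 + u + 1)
    lem₅ = solve-∀
    D≥ : 48 + 2 * (16 * u) ≤ 32 * (suc da * suc de)
    D≥ = begin
      48 + 2 * (16 * u)                            ≤⟨ ≤-trans (m≤m+n (48 + 2 * (16 * u)) 16) (≤-reflexive (lem₅ u)) ⟩
      32 * (suc p * suc de + 1)                    ≤⟨ *-monoʳ-≤ 32 (+-monoʳ-≤ (suc p * suc de) (s≤s z≤n)) ⟩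
      32 * (suc p * suc de + suc e * suc da)       ≤⟨ *-monoʳ-≤ 32 sum≤ ⟩
      32 * (suc da * suc de)                       ∎
      where open ≤-Reasoning
    D≡ : 32 + 32 * (de + da * suc de) ≡ 48 + 2 * (16 * u) + d′
    D≡ = trans (lem₃ da de) (sym (m+[n∸m]≡n D≥))

separate-fraction : ∀ p da .(cop : Coprime (suc p) (suc da)) e de (β : ℚ) → suc p * suc de + suc e * suc da ≤ suc da * suc de →
  (∀ G D → suc D ≡ 32 * (suc da * suc de) → G + 16 ≡ suc D + 16 * (suc p * suc de) → toℚᵘ β ℚᵘ.≤ mkℚᵘ (posℤ G) D) →
  ∃ λ m₀ → ∀ m → m₀ ≤ m → (C : Comparator (2 ^ m)) → size C ≤ (2 ^ m) ^^ β → ¬ Decides C (MCSP m (mkℚ +[1+ p ] da cop))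
separate-fraction p da cop e de β sum≤ β≤ with parameters p da e de sum≤
... | a′ , d′ , c , D , G , c≡ , D≡ , G≡ , cda≡pD , D≡′ , G≡′ =
  separate a′ d′ c (suc D) G c≡ D≡ G≡ (mkℚ +[1+ p ] da cop) β
    (power-lower p da c (suc D) cda≡pD) (power-upper p da c (suc D) cda≡pD) (size-upper β G D (β≤ G D D≡′ G≡′))

theorem4 : (ε α : ℚ) → 0ℚ ℚ.< ε → 0ℚ ℚ.< α → α ℚ.≤ 1ℚ ℚ.- ε →
    ∃[ m₀ ] ((m : ℕ) → m₀ ≤ m → (C : Comparator (2 ^ m)) →
    size C ≤ (2 ^ m) ^^ (1ℚ ℚ.+ α ℚ.* ½ ℚ.- ε) →
    ¬ Decides C (MCSP m α))
theorem4 (mkℚ -[1+ _ ] _ _) _ (ℚ.*<* ())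
theorem4 (mkℚ (posℤ 0) _ _) _ (ℚ.*<* (+<+ ()))
theorem4 (mkℚ +[1+ _ ] _ _) (mkℚ -[1+ _ ] _ _) _ (ℚ.*<* ())
theorem4 (mkℚ +[1+ _ ] _ _) (mkℚ (posℤ 0) _ _) _ (ℚ.*<* (+<+ ()))
theorem4 ε@(mkℚ +[1+ e ] de _) α@(mkℚ +[1+ p ] da cop) _ _ α≤1-ε =
  separate-fraction p da cop e de (1ℚ ℚ.+ α ℚ.* ½ ℚ.- ε) (sum≤-numerators p da e de (sum≤1 α ε α≤1-ε))
    (λ G D → exponent≤ α ε p da e de G D refl refl)
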